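{- Let $n\ge3$. The extended Walsh series of matched $n$-cycles is given, for $n$ odd, by $$W_{C_n}^{\mathrm m}(\mathbf a;\mathbf b;\mathbf c;\beta;\gamma)=\frac{1}{2n}\sum_{d\mid n}\phi\!\left(\tfrac nd\right)a_{n/d}^{\,d}\,T_d(b_{n/d},\beta_{n/d})+\frac12\,a_1a_2^{\frac{n-1}{2}}\Big(\beta_2\gamma_1U_{\frac{n-1}{2}}(b_2,\beta_2)+\beta_2^2c_1U_{\frac{n-3}{2}}(b_2,\beta_2)\Big),$$ and, for $n$ even, by $$W_{C_n}^{\mathrm m}(\mathbf a;\mathbf b;\mathbf c;\beta;\gamma)=\frac{1}{2n}\sum_{d\mid n}\phi\!\left(\tfrac nd\right)a_{n/d}^{\,d}\,T_d(b_{n/d},\beta_{n/d})+\frac14\Big[a_1^2a_2^{\frac{n-2}{2}}\beta_2^2U_{\frac{n-2}{2}}(b_2,\beta_2)$$ $$+\,a_2^{\frac n2}\Big(\gamma_1^2U_{\frac n2}(b_2,\beta_2)+2c_1\gamma_1\beta_2U_{\frac{n-2}{2}}(b_2,\beta_2)+c_1^2\beta_2^2U_{\frac{n-4}{2}}(b_2,\beta_2)\Big)\Big],$$ where $\phi$ is the Euler $\phi$-function.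
   Context: A matching $\mu$ of a finite simple graph $G$ is a set of pairwise disjoint edges of $G$. The homogeneous matching polynomial of $G$ is $M_G(y,z)=\sum_{\mu}y^{|\mu|}z^{m-|\mu|}$, where $\mu$ runs over all matchings of $G$ and $m=|E(G)|$. $P_n$ and $C_n$ denote the path and cycle graphs on $\{1,\ldots,n\}$. Put $U_n(y,z)=M_{P_n}(y,z)$ for $n\ge1$ (so $U_1=1$, $U_2=y+z$), with the convention $U_0(y,z)=1/z$; and $T_n(y,z)=M_{C_n}(y,z)$ for $n\ge3$, with $T_1(y,z)=z$ and $T_2(y,z)=2yz+z^2$. (They satisfy $U_n=yzU_{n-2}+zU_{n-1}$ and $T_n=yz^2U_{n-2}+zU_n$ for $n\ge2$.) Given a graph $G$ with a matching $\mu$, edges in $\mu$ are said to be of sort $Y$ and edges not in $\mu$ of sort $Z$. An automorphism $\sigma$ of $G$ induces a permutation of $E(G)$; a cycle of length $l$ of this permutation is cylindrical if $\sigma^l$ fixes both endpoints of each edge of the cycle, and Möbius if $\sigma^l$ exchanges the two endpoints of each edge of the cycle. Let $\sigma_k$ be the number of vertex cycles of length $k$ of $\sigma$. Let $\mathrm{Fix}^{\mathrm m}(\sigma)$ be the set of matchings $\mu$ of $G$ with $\sigma(\mu)=\mu$. For $\mu\in\mathrm{Fix}^{\mathrm m}(\sigma)$ let $\mathrm{cyl}_{k,Y},\mathrm{m\ddot ob}_{k,Y},\mathrm{cyl}_{k,Z},\mathrm{m\ddot ob}_{k,Z}$ be the numbers of cylindrical and Möbius edge cycles of $\sigma$ of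 length $k$ and of sort $Y$ or $Z$ respectively, and put $$w^\mu(\sigma)=\prod_k a_k^{\sigma_k}b_k^{\mathrm{cyl}_{k,Y}}c_k^{\mathrm{m\ddot ob}_{k,Y}}\beta_k^{\mathrm{cyl}_{k,Z}}\gamma_k^{\mathrm{m\ddot ob}_{k,Z}}.$$ The extended Walsh series of $C_n$ is $$W^{\mathrm m}_{C_n}(\mathbf a;\mathbf b;\mathbf c;\beta;\gamma)=\frac1{|\mathrm{Aut}(C_n)|}\sum_{\sigma\in\mathrm{Aut}(C_n)}\ \sum_{\mu\in\mathrm{Fix}^{\mathrm m}(\sigma)}w^\mu(\sigma),$$ in variables $\mathbf a=(a_k)_{k\ge 1}$, $\mathbf b=(b_k)$, $\mathbf c=(c_k)$, $\beta=(\beta_k)$, $\gamma=(\gamma_k)$. -}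

module Defs where

open import Algebra.Bundles using (CommutativeRing)
open import Algebra.Definitions using (Invertible)
open import Algebra.Morphism.Structures using (IsRingHomomorphism)
open import Data.Bool.Base using (if_then_else_)
open import Data.Fin.Base using (Fin; toℕ)
open import Data.Fin.Properties using (all?; any?; _≟_; _<?_)
open import Data.Integer.Base using (+_)
open import Data.List.Base
  using (List; []; _∷_; _++_; [_]; map; filter; foldr; length; upTo; allFin; iterate;
         deduplicate; cartesianProduct; cartesianProductWith)
open import Data.List.Membership.Propositional using (_∈_; _∉_)
open import Data.List.Membership.Propositional.Properties
  using (∈-cartesianProductWith⁺; ∈-filter⁺; ∈-allFin; ∈-length)
import Data.List.Membership.DecPropositional as DecMembership
import Data.List.Relation.Binary.Subset.DecPropositional as DecSubset
open import Data.List.Relation.Unary.All as All using (All)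
open import Data.List.Relation.Unary.AllPairs as AllPairs using (AllPairs)
open import Data.List.Relation.Unary.Any using (here)
import Data.Nat.Base as ℕ
open import Data.Nat.Base using (ℕ; zero; suc; NonZero; _≤_; z≤n; s≤s; _⊔_; _∸_)
open import Data.Nat.Coprimality using (Coprime; coprime?)
open import Data.Nat.Divisibility using (_∣_; _∣?_)
import Data.Nat.Properties as ℕₚ
open import Data.Product.Base using (_×_; _,_; proj₁; proj₂; ∃-syntax)
open import Data.Product.Properties using (≡-dec)
import Data.Rational.Base as ℚ
open import Data.Rational.Base using (ℚ)
open import Data.Sum.Base using (_⊎_; inj₁; inj₂; swap)
open import Data.Vec.Base as Vec using (Vec; []; _∷_; lookup)
open import Data.Vec.Properties using (lookup∘tabulate)
open import Function.Base using (id; _∘_)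
open import Function.Definitions using (Bijective; Injective)
import Function.Endo.Propositional as Endo
open import Level using (Level; 0ℓ) renaming (suc to lsuc; _⊔_ to _⊔ℓ_)
open import Relation.Binary.Core using (Rel)
open import Relation.Binary.Definitions using (DecidableEquality; Symmetric; Irreflexive)
import Relation.Binary.Definitions as Binary
open import Relation.Binary.PropositionalEquality
  using (_≡_; _≢_; refl; sym; trans; cong; subst₂)
open import Relation.Nullary using (Dec; does; ¬_; ¬?)
open import Relation.Nullary.Decidable using (map′; _×-dec_; _⊎-dec_; _→-dec_)
import Relation.Unary as Unary

private variable
  a ℓ p : Level
  A : Set a

count : {P : Unary.Pred A p} → Unary.Decidable P → List A → ℕ
count P? xs = length (filter P? xs)

-- If the entries of xs are distinct, these are the subsets of {xs}, each listed once.
sublists : List A → List (List A)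
sublists []       = [ [] ]
sublists (x ∷ xs) = map (x ∷_) (sublists xs) ++ sublists xs

vectors : List A → (n : ℕ) → List (Vec A n)
vectors xs zero    = [ [] ]
vectors xs (suc n) = cartesianProductWith _∷_ xs (vectors xs n)

-- The cycles of a map f that permutes a finite set, enumerated by a list xs without
-- repetition.  No orbit has more than |xs| elements, so |xs| iterations exhaust it.
-- A cycle is listed as x, f x, f² x, ..., starting at the element x of it that
-- comes first in xs.
module Cycles (_≟_ : DecidableEquality A) (f : A → A) (xs : List A) where

  open DecMembership _≟_ using (_∈?_)

  orbit : A → List A
  orbit x = deduplicate _≟_ (iterate f x (length xs))

  cycles : List (List A)
  cycles = map orbit (deduplicate (λ x y → y ∈? orbit x) xs)

-- Finite simple graphs on the vertex set {0, ..., n-1}.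
record Graph (n : ℕ) : Set₁ where
  field
    _~_      : Rel (Fin n) 0ℓ
    ~-sym    : Symmetric _~_
    ~-irrefl : Irreflexive _≡_ _~_
    _~?_     : Binary.Decidable _~_

module _ {n : ℕ} (G : Graph n) where

  open Graph G

  IsAutomorphism : (Fin n → Fin n) → Set
  IsAutomorphism σ =
    Bijective _≡_ _≡_ σ × (∀ i j → (i ~ j → σ i ~ σ j) × (σ i ~ σ j → i ~ j))

  isAutomorphism? : Unary.Decidable IsAutomorphism
  isAutomorphism? σ = (injective? ×-dec surjective?) ×-dec
    all? (λ i → all? (λ j →
      ((i ~? j) →-dec (σ i ~? σ j)) ×-dec ((σ i ~? σ j) →-dec (i ~? j))))
    where
    injective? : Dec (Injective _≡_ _≡_ σ)
    injective? = map′ (λ inj {i} {j} → inj i j) (λ inj i j → inj)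
      (all? (λ i → all? (λ j → (σ i ≟ σ j) →-dec (i ≟ j))))

    surjective? : Dec (∀ j → ∃[ i ] (∀ {k} → k ≡ i → σ k ≡ j))
    surjective? = map′
      (λ surj j → proj₁ (surj j) , λ { refl → proj₂ (surj j) })
      (λ surj j → proj₁ (surj j) , proj₂ (surj j) refl)
      (all? (λ j → any? (λ i → σ i ≟ j)))

  -- A self-map σ of the vertices is stored as the vector of its values, so that it
  -- is listed only once.
  automorphisms : List (Vec (Fin n) n)
  automorphisms = filter (isAutomorphism? ∘ lookup) (vectors (allFin n) n)

-- An edge {i , j} is stored as the pair (i , j) with i < j.
Edge : ℕ → Set
Edge n = Fin n × Fin n

_≟ᵉ_ : ∀ {n} → DecidableEquality (Edge n)
_≟ᵉ_ = ≡-dec _≟_ _≟_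

⟪_,_⟫ : ∀ {n} → Fin n → Fin n → Edge n
⟪ i , j ⟫ = if does (i <? j) then (i , j) else (j , i)

edgeMap : ∀ {n} → (Fin n → Fin n) → Edge n → Edge n
edgeMap σ (i , j) = ⟪ σ i , σ j ⟫

Disjoint : ∀ {n} → Rel (Edge n) 0ℓ
Disjoint (i , j) (k , l) = (i ≢ k) × (i ≢ l) × (j ≢ k) × (j ≢ l)

disjoint? : ∀ {n} → Binary.Decidable (Disjoint {n})
disjoint? (i , j) (k , l) =
  ¬? (i ≟ k) ×-dec ¬? (i ≟ l) ×-dec ¬? (j ≟ k) ×-dec ¬? (j ≟ l)

module _ {n : ℕ} where

  open DecMembership (_≟ᵉ_ {n}) using (_∈?_; _∉?_)
  open DecSubset (_≟ᵉ_ {n}) using (_⊆_; _⊆?_)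
  open Endo (Fin n) using (_^_)

  Stable : (Fin n → Fin n) → List (Edge n) → Set
  Stable σ μ = (map (edgeMap σ) μ ⊆ μ) × (μ ⊆ map (edgeMap σ) μ)

  stable? : ∀ σ → Unary.Decidable (Stable σ)
  stable? σ μ = (map (edgeMap σ) μ ⊆? μ) ×-dec (μ ⊆? map (edgeMap σ) μ)

  Cylindrical Möbius : (Fin n → Fin n) → List (Edge n) → Set
  Cylindrical σ κ =
    All (λ (i , j) → ((σ ^ length κ) i ≡ i) × ((σ ^ length κ) j ≡ j)) κ
  Möbius σ κ =
    All (λ (i , j) → ((σ ^ length κ) i ≡ j) × ((σ ^ length κ) j ≡ i)) κ

  cylindrical? : ∀ σ → Unary.Decidable (Cylindrical σ)
  cylindrical? σ κ = All.all?
    (λ (i , j) → ((σ ^ length κ) i ≟ i) ×-dec ((σ ^ length κ) j ≟ j)) κ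

  möbius? : ∀ σ → Unary.Decidable (Möbius σ)
  möbius? σ κ = All.all?
    (λ (i , j) → ((σ ^ length κ) i ≟ j) ×-dec ((σ ^ length κ) j ≟ i)) κ

  SortY SortZ : List (Edge n) → List (Edge n) → Set
  SortY μ κ = All (_∈ μ) κ
  SortZ μ κ = All (_∉ μ) κ

  sortY? : ∀ μ → Unary.Decidable (SortY μ)
  sortY? μ = All.all? (_∈? μ)

  sortZ? : ∀ μ → Unary.Decidable (SortZ μ)
  sortZ? μ = All.all? (_∉? μ)

module _ {n : ℕ} (G : Graph n) where

  open Graph G

  edges : List (Edge n)
  edges = filter (λ (i , j) → (i <? j) ×-dec (i ~? j))
                 (cartesianProduct (allFin n) (allFin n))

  matchings : List (List (Edge n))
  matchings = filter (AllPairs.allPairs? disjoint?) (sublists edges)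

  fixedMatchings : (Fin n → Fin n) → List (List (Edge n))
  fixedMatchings σ = filter (stable? σ) matchings

  vertexCycles : (Fin n → Fin n) → List (List (Fin n))
  vertexCycles σ = Cycles.cycles _≟_ σ (allFin n)

  edgeCycles : (Fin n → Fin n) → List (List (Edge n))
  edgeCycles σ = Cycles.cycles _≟ᵉ_ (edgeMap σ) edges

  #vertexCycles : (Fin n → Fin n) → ℕ → ℕ
  #vertexCycles σ k = count (λ κ → length κ ℕₚ.≟ k) (vertexCycles σ)

  module _ (σ : Fin n → Fin n) (μ : List (Edge n)) (k : ℕ) where

    cylY möbY cylZ möbZ : ℕ
    cylY = count (λ κ → length κ ℕₚ.≟ k ×-dec cylindrical? σ κ ×-dec sortY? μ κ) (edgeCycles σ)
    möbY = count (λ κ → length κ ℕₚ.≟ k ×-dec möbius?      σ κ ×-dec sortY? μ κ) (edgeCycles σ)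
    cylZ = count (λ κ → length κ ℕₚ.≟ k ×-dec cylindrical? σ κ ×-dec sortZ? μ κ) (edgeCycles σ)
    möbZ = count (λ κ → length κ ℕₚ.≟ k ×-dec möbius?      σ κ ×-dec sortZ? μ κ) (edgeCycles σ)

Consecutive : ∀ {n} → Rel (Fin n) 0ℓ
Consecutive i j = suc (toℕ i) ≡ toℕ j

consecutive? : ∀ {n} → Binary.Decidable (Consecutive {n})
consecutive? i j = suc (toℕ i) ℕₚ.≟ toℕ j

pathGraph : (n : ℕ) → Graph n
pathGraph n = record
  { _~_      = λ i j → Consecutive i j ⊎ Consecutive j i
  ; ~-sym    = swap
  ; ~-irrefl = λ { refl (inj₁ e) → ℕₚ.1+n≢n e ; refl (inj₂ e) → ℕₚ.1+n≢n e }
  ; _~?_     = λ i j → consecutive? i j ⊎-dec consecutive? j i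
  }

Ends : ∀ {n} → Rel (Fin n) 0ℓ
Ends {n} i j = (toℕ i ≡ 0) × (suc (toℕ j) ≡ n)

ends? : ∀ {n} → Binary.Decidable (Ends {n})
ends? {n} i j = (toℕ i ℕₚ.≟ 0) ×-dec (suc (toℕ j) ℕₚ.≟ n)

cycleGraph : (n : ℕ) → 3 ≤ n → Graph n
cycleGraph n 3≤n = record
  { _~_      = λ i j → (Consecutive i j ⊎ Ends i j) ⊎ (Consecutive j i ⊎ Ends j i)
  ; ~-sym    = swap
  ; ~-irrefl = λ { refl (inj₁ e) → irrefl e ; refl (inj₂ e) → irrefl e }
  ; _~?_     = λ i j → (consecutive? i j ⊎-dec ends? i j) ⊎-dec
                       (consecutive? j i ⊎-dec ends? j i)
  }
  where
  irrefl : {i : Fin n} → ¬ (Consecutive i i ⊎ Ends i i)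
  irrefl (inj₁ e)         = ℕₚ.1+n≢n e
  irrefl (inj₂ (i≡0 , e)) =
    ℕₚ.<⇒≢ (ℕₚ.≤-trans (s≤s (s≤s z≤n)) 3≤n) (trans (cong suc (sym i≡0)) e)

φ : ℕ → ℕ
φ n = count (λ k → coprime? k n) (map suc (upTo n))

module _ {n : ℕ} (G : Graph n) where

  open Graph G

  private
    ∈-vectors : ∀ {a} {A : Set a} {xs : List A} → (∀ x → x ∈ xs) →
                ∀ {n} (v : Vec A n) → v ∈ vectors xs n
    ∈-vectors ∈xs []      = here refl
    ∈-vectors ∈xs (x ∷ v) = ∈-cartesianProductWith⁺ _∷_ (∈xs x) (∈-vectors ∈xs v)

    identity : Vec (Fin n) n
    identity = Vec.tabulate id

    lookup-id : ∀ i → lookup identity i ≡ i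
    lookup-id = lookup∘tabulate id

    identity-isAutomorphism : IsAutomorphism G (lookup identity)
    identity-isAutomorphism =
      ( (λ {i} {j} e → trans (sym (lookup-id i)) (trans e (lookup-id j)))
      , (λ j → j , λ { refl → lookup-id j }) ) ,
      λ i j → subst₂ _~_ (sym (lookup-id i)) (sym (lookup-id j))
            , subst₂ _~_ (lookup-id i) (lookup-id j)

  ∣Aut∣≢0 : NonZero (length (automorphisms G))
  ∣Aut∣≢0 = ℕ.>-nonZero (∈-length
    (∈-filter⁺ (isAutomorphism? G ∘ lookup) (∈-vectors ∈-allFin identity)
               identity-isAutomorphism))

record ℚ-Algebra c ℓ : Set (lsuc (c ⊔ℓ ℓ)) where
  field
    commutativeRing : CommutativeRing c ℓ
  open CommutativeRing commutativeRing public
  field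
    ι              : ℚ → Carrier
    ι-homomorphism : IsRingHomomorphism ℚ.+-*-rawRing rawRing ι

-- Polynomials over ℚ are evaluated at arbitrary elements of an arbitrary commutative
-- ℚ-algebra K; taking for K a (Laurent) polynomial ring and for the elements its
-- indeterminates gives back the formal polynomials.
module WalshSeries {c ℓ} (K : ℚ-Algebra c ℓ) where

  open ℚ-Algebra K
  open import Algebra.Properties.Semiring.Exp semiring public using (_^_)
  open import Algebra.Properties.Semiring.Mult semiring public renaming (_×_ to _·_) using ()

  ∑ ∏ : List A → (A → Carrier) → Carrier
  ∑ xs f = foldr (λ x s → f x + s) 0# xs
  ∏ xs f = foldr (λ x s → f x * s) 1# xs

  syntax ∑ xs (λ x → e) = ∑[ x ← xs ] e
  syntax ∏ xs (λ x → e) = ∏[ x ← xs ] e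

  infix 9 1/_
  1/_ : (n : ℕ) .{{_ : NonZero n}} → Carrier
  1/ n = ι (+ 1 ℚ./ n)

  -- The sum of f (n/d) d over the divisors d of n; each d is written as suc i so that
  -- it is visibly nonzero.
  ∑-divisors : (n : ℕ) → ((n/d d : ℕ) .{{_ : NonZero d}} → Carrier) → Carrier
  ∑-divisors n f = ∑[ i ← filter (λ i → suc i ∣? n) (upTo n) ] f (n ℕ./ suc i) (suc i)

  M : ∀ {n} → Graph n → (y z : Carrier) → Carrier
  M G y z = ∑[ μ ← matchings G ] (y ^ length μ * z ^ (length (edges G) ∸ length μ))

  -- The convention U₀(y,z) = 1/z requires z to be invertible.
  U : ℕ → (y z : Carrier) → Invertible _≈_ 1# _*_ z → Carrier
  U zero      y z (z⁻¹ , _) = z⁻¹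
  U n@(suc _) y z _         = M (pathGraph n) y z

  T : (n : ℕ) .{{_ : NonZero n}} → (y z : Carrier) → Carrier
  T 1                       y z = z
  T 2                       y z = 2 · (y * z) + z ^ 2
  T n@(suc (suc (suc _)))   y z = M (cycleGraph n (s≤s (s≤s (s≤s z≤n)))) y z

  module _ (a b c β γ : ℕ → Carrier) where

    -- Vertex cycles have length at most n and edge cycles length at most |E(G)|, so
    -- all further factors of the product over k ≥ 1 are 1.
    weight : ∀ {n} → Graph n → (Fin n → Fin n) → List (Edge n) → Carrier
    weight {n} G σ μ =
      ∏[ k ← map suc (upTo (n ⊔ length (edges G))) ]
        ( a k ^ #vertexCycles G σ k
        * b k ^ cylY G σ μ k
        * c k ^ möbY G σ μ k
        * β k ^ cylZ G σ μ k
        * γ k ^ möbZ G σ μ k )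

    W : ∀ {n} → Graph n → Carrier
    W G = (1/ length (automorphisms G)) {{∣Aut∣≢0 G}} *
      (∑[ σ ← automorphisms G ] ∑[ μ ← fixedMatchings G (lookup σ) ] weight G (lookup σ) μ)

{-# OPTIONS --safe #-}

-- For an automorphism σ of Cₙ, a matching fixed by σ is a union of σ-orbits of edges, and
-- the weight is a product over orbits.  The orbits of edges form a cycle (if σ is a rotation) or
-- a path (if σ is a reflection), and the admissible sets of orbits are those without two
-- consecutive members, where a reflection that fixes a vertex also excludes the orbit of
-- the edges at this vertex.  So each inner sum is a transfer sum R, which the recursions
-- for Uₙ and Tₙ evaluate.  The reflections fall into the types listed in the theorem, and
-- the rotations by k are grouped by d = gcd(k, n), each d occurring φ(n/d) times.

module Submission where

open import Defs
open import Algebra.Bundles using (CommutativeMonoid)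
open import Algebra.Definitions using (Invertible)
open import Algebra.Morphism.Structures using (IsRingHomomorphism)
open import Data.Bool.Base using (Bool; true; false; if_then_else_; not; _∧_)
open import Data.Bool.Properties using (T?; ∧-identityʳ)
open import Data.Empty using (⊥; ⊥-elim)
open import Data.Fin.Base using (Fin; toℕ; fromℕ<)
open import Data.Fin.Properties using (toℕ-injective; toℕ<n; toℕ-fromℕ<; _≟_; _<?_)
import Data.Integer.Base as ℤ
import Data.Integer.Properties as ℤₚ
open import Data.Integer.Tactic.RingSolver using () renaming (solve-∀ to solve-ℤ)
open import Data.List.Base using (List; []; _∷_; _++_; [_]; map; filter; foldr; length; upTo; applyUpTo; allFin; iterate; deduplicate; cartesianProduct)
open import Data.List.Properties using (length-map; length-++; length-upTo; length-tabulate; length-iterate; length-filter; filter-accept; filter-reject; ∷-injectiveʳ; map-applyUpTo; upTo-∷ʳ)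
open import Data.List.Membership.Propositional using (_∈_)
open import Data.List.Membership.Propositional.Properties
open import Data.List.Membership.Propositional.Properties.WithK using (unique∧set⇒bag)
import Data.List.Membership.DecPropositional as DecMembership
open import Data.List.Relation.Binary.BagAndSetEquality using (∼bag⇒↭)
open import Data.List.Relation.Binary.Permutation.Propositional using (_↭_)
import Data.List.Relation.Binary.Permutation.Propositional as Perm
open import Data.List.Relation.Binary.Permutation.Propositional.Properties using (↭-length)
open import Data.List.Relation.Unary.All as All using (All; []; _∷_)
import Data.List.Relation.Unary.All.Properties as Allₚ
open import Data.List.Relation.Unary.AllPairs as AllPairs using (AllPairs; []; _∷_)
import Data.List.Relation.Unary.AllPairs.Properties as AllPairsₚ
open import Data.List.Relation.Unary.Any using (here; there)
open import Data.List.Relation.Unary.Unique.Propositional using (Unique)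
import Data.List.Relation.Unary.Unique.Propositional.Properties as Uniqueₚ
import Data.List.Relation.Unary.Unique.DecPropositional.Properties as DecUniqueₚ
open import Data.Nat.Base as ℕ using (ℕ; zero; suc; NonZero; _≤_; _<_; _∸_; _/_; _%_; _⊔_; _⊓_; z≤n; s≤s)
open import Data.Nat.Coprimality using (Coprime; coprime?; coprime⇒gcd≡1)
open import Data.Nat.Divisibility
open import Data.Nat.DivMod
open import Data.Nat.GCD using (gcd; gcd[m,n]∣m; gcd[m,n]∣n; gcd-greatest)
import Data.Nat.GCD as GCD
open import Data.Nat.Properties
  using (m*n≢0; ≤-trans; ≤-refl; ≤-reflexive; <-trans; <-irrefl; <⇒≤; <⇒≢; n<1+n;
         m+[n∸m]≡n; suc-injective; ≤∧≢⇒<)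
import Data.Nat.Properties as ℕₚ
open import Data.Nat.Tactic.RingSolver using () renaming (solve-∀ to solve-ℕ)
open import Data.Product.Base using (_×_; _,_; proj₁; proj₂; ∃-syntax)
import Data.Rational.Base as ℚ
import Data.Rational.Properties as ℚₚ
import Data.Rational.Unnormalised.Base as ℚᵘ
import Data.Rational.Unnormalised.Properties as ℚᵘₚ
open import Data.Sum.Base using (_⊎_; inj₁; inj₂; swap)
import Data.Sum.Base as Sum
open import Data.Unit.Base using (tt)
open import Data.Vec.Base as Vec using (Vec; []; _∷_; lookup)
open import Data.Vec.Properties using (lookup∘tabulate; tabulate-cong; tabulate∘lookup)
open import Function.Base using (id; _∘_; case_of_)
open import Function.Bundles using (mk⇔)
import Function.Endo.Propositional as Endo
open import Level using (Level)
open import Relation.Binary.Core using (Rel)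
open import Relation.Binary.Definitions using (DecidableEquality; tri<; tri≈; tri>)
import Relation.Binary.Definitions as Binary
open import Relation.Binary.PropositionalEquality using (_≡_; _≢_; refl; sym; trans; cong; cong₂; subst; subst₂; module ≡-Reasoning)
open import Relation.Nullary using (yes; no; does; ¬_; ¬?; contradiction)
open import Relation.Nullary.Decidable using (_×-dec_; dec-true; dec-false)
import Relation.Unary as Unary

-- The definitions list matchings, cycles and automorphisms in whatever order filtering produces, so
-- no such list is computed. Each is shown to be repetition-free with known members, which
-- determines it up to permutation; for a sum or a product that suffices.
--
-- Each edge is named by the vertex `v` from which it leads to `s v`. A rotation `σ` then moves
-- edges as it moves vertices. A reflection reverses the orientation and moves them as `σ ∘ s`,
-- which is again a reflection, with its axis shifted by half a step. Hence vertex orbits and edge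
-- orbits of a reflection are described by the same folding lemmas, and its Möbius edges are the
-- fixed points of `σ ∘ s`.
--
-- The convention `U₀ = 1/z` enters because an orbit that must stay unchosen contributes a factor
-- `z`: a path of orbits with nothing left to choose has sum 1, which is `z * U₀`.

module MatchedCycles where

  open import Data.Bool.Base using (T)
  open import Data.Nat.Base using (_+_; _*_)

  -- Sublists, partitions and orbits

  variable
    ℓa ℓb ℓp : Level
    A : Set ℓa
    B : Set ℓb

  -- Lists of matchings, cycles and automorphisms are re-indexed through this, since membership in
  -- them is accessible while their order is not.
  unique∧set⇒↭ : {xs ys : List A} → Unique xs → Unique ys →
                 (∀ {x} → x ∈ xs → x ∈ ys) → (∀ {x} → x ∈ ys → x ∈ xs) → xs ↭ ys
  unique∧set⇒↭ xs! ys! to from = ∼bag⇒↭ (unique∧set⇒bag xs! ys! (mk⇔ to from))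

  sublists-⊆ : ∀ (xs : List A) {μ x} → μ ∈ sublists xs → x ∈ μ → x ∈ xs
  sublists-⊆ [] (here refl) ()
  sublists-⊆ (x ∷ xs) {μ} μ∈ y∈ with ∈-++⁻ (map (x ∷_) (sublists xs)) μ∈
  ... | inj₂ μ∈′ = there (sublists-⊆ xs μ∈′ y∈)
  ... | inj₁ μ∈′ with ∈-map⁻ (x ∷_) μ∈′
  ...   | ν , ν∈ , refl with y∈
  ...     | here refl = here refl
  ...     | there y∈ν = there (sublists-⊆ xs ν∈ y∈ν)

  sublists-unique : {xs : List A} → Unique xs → Unique (sublists xs)
  sublists-unique [] = [] ∷ []
  sublists-unique {xs = x ∷ xs} xs!@(_ ∷ xs!′) =
    Uniqueₚ.++⁺ (Uniqueₚ.map⁺ ∷-injectiveʳ (sublists-unique xs!′)) (sublists-unique xs!′) disjoint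
    where
    disjoint : ∀ {μ} → ¬ (μ ∈ map (x ∷_) (sublists xs) × μ ∈ sublists xs)
    disjoint (p , q) with ∈-map⁻ (x ∷_) p
    ... | ν , _ , refl = Uniqueₚ.Unique[x∷xs]⇒x∉xs xs! (sublists-⊆ xs q (here refl))

  module _ {P : A → Set ℓp} (P? : Unary.Decidable P) where

    filter∈sublists : ∀ xs → filter P? xs ∈ sublists xs
    filter∈sublists []       = here refl
    filter∈sublists (x ∷ xs) with P? x
    ... | yes _ = ∈-++⁺ˡ (∈-map⁺ (x ∷_) (filter∈sublists xs))
    ... | no _  = ∈-++⁺ʳ (map (x ∷_) (sublists xs)) (filter∈sublists xs)

    -- A sublist inherits the order of the repetition-free `xs`, so its members determine it as a
    -- list and not just up to permutation.
    sublist≡filter : ∀ {xs μ} → Unique xs → μ ∈ sublists xs →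
                     (∀ {x} → x ∈ μ → P x) → (∀ {x} → x ∈ xs → P x → x ∈ μ) → μ ≡ filter P? xs
    sublist≡filter {[]}     _ (here refl) _ _ = refl
    sublist≡filter {x ∷ xs} xs!@(_ ∷ xs!′) μ∈ to from with ∈-++⁻ (map (x ∷_) (sublists xs)) μ∈
    ... | inj₂ μ∈′ = trans
      (sublist≡filter xs!′ μ∈′ to (from ∘ there))
      (sym (filter-reject P? (λ Px → Uniqueₚ.Unique[x∷xs]⇒x∉xs xs! (sublists-⊆ xs μ∈′ (from (here refl) Px)))))
    ... | inj₁ μ∈′ with ∈-map⁻ (x ∷_) μ∈′
    ...   | ν , ν∈ , refl = trans
      (cong (x ∷_) (sublist≡filter xs!′ ν∈ (to ∘ there) from′))
      (sym (filter-accept P? (to (here refl))))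
      where
      from′ : ∀ {y} → y ∈ xs → P y → y ∈ ν
      from′ y∈ Py with from (there y∈) Py
      ... | here refl = contradiction y∈ (Uniqueₚ.Unique[x∷xs]⇒x∉xs xs!)
      ... | there y∈ν = y∈ν

  allPairs⁺ : {R : Rel A ℓp} {xs : List A} → Unique xs →
              (∀ {x y} → x ∈ xs → y ∈ xs → x ≢ y → R x y) → AllPairs R xs
  allPairs⁺ []          R! = []
  allPairs⁺ (x∉ ∷ xs!) R! =
    All.tabulate (λ y∈ → R! (here refl) (there y∈) (All.lookup x∉ y∈)) ∷
    allPairs⁺ xs! (λ x∈ y∈ → R! (there x∈) (there y∈))

  map-unique : {xs : List A} {f : A → B} → Unique xs →
               (∀ {x y} → x ∈ xs → y ∈ xs → f x ≡ f y → x ≡ y) → Unique (map f xs)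
  map-unique xs! inj = AllPairsₚ.map⁺ (allPairs⁺ xs! (λ x∈ y∈ x≢y eq → x≢y (inj x∈ y∈ eq)))

  -- `AllPairs` relates an entry to later ones only; symmetry of `R` covers the other order.
  allPairs⁻ : {R : Rel A ℓp} {xs : List A} → Binary.Symmetric R → AllPairs R xs →
              ∀ {x y} → x ∈ xs → y ∈ xs → x ≢ y → R x y
  allPairs⁻ R-sym (_  ∷ _)  (here refl) (here refl) x≢y = contradiction refl x≢y
  allPairs⁻ R-sym (Rx ∷ _)  (here refl) (there y∈)  _   = All.lookup Rx y∈
  allPairs⁻ R-sym (Rx ∷ _)  (there x∈)  (here refl) _   = R-sym (All.lookup Rx x∈)
  allPairs⁻ R-sym (_  ∷ Rs) (there x∈)  (there y∈)  x≢y = allPairs⁻ R-sym Rs x∈ y∈ x≢y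

  vectors-unique : {xs : List A} → Unique xs → ∀ n → Unique (vectors xs n)
  vectors-unique xs! zero    = [] ∷ []
  vectors-unique xs! (suc n) =
    Uniqueₚ.cartesianProductWith⁺ _∷_ (λ { refl → refl , refl }) xs! (vectors-unique xs! n)

  ∈-vectors : {xs : List A} → (∀ x → x ∈ xs) → ∀ {n} (v : Vec A n) → v ∈ vectors xs n
  ∈-vectors ∈xs []      = here refl
  ∈-vectors ∈xs (x ∷ v) = ∈-cartesianProductWith⁺ _∷_ (∈xs x) (∈-vectors ∈xs v)

  bools : List Bool
  bools = true ∷ false ∷ []

  ∈-bools : ∀ b → b ∈ bools
  ∈-bools true  = here refl
  ∈-bools false = there (here refl)

  -- Total, with default `false` beyond the end, so that labels can be plain natural numbers; the
  -- labels of elements stay below `m`.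
  at : ∀ {m} → Vec Bool m → ℕ → Bool
  at []      _       = false
  at (x ∷ S) zero    = x
  at (x ∷ S) (suc j) = at S j

  vec : (ℕ → Bool) → (m : ℕ) → Vec Bool m
  vec f zero    = []
  vec f (suc m) = f 0 ∷ vec (f ∘ suc) m

  at-vec : ∀ f {m j} → j < m → at (vec f m) j ≡ f j
  at-vec f {suc m} {zero}  _         = refl
  at-vec f {suc m} {suc j} (s≤s j<m) = at-vec (f ∘ suc) j<m

  at-injective : ∀ {m} (S S′ : Vec Bool m) → (∀ {j} → j < m → at S j ≡ at S′ j) → S ≡ S′
  at-injective []      []        _ = refl
  at-injective (x ∷ S) (x′ ∷ S′) e = cong₂ _∷_ (e (s≤s z≤n)) (at-injective S S′ (e ∘ s≤s))

  T-injective : ∀ {x y} → (T x → T y) → (T y → T x) → x ≡ y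
  T-injective {false} {false} _ _ = refl
  T-injective {false} {true}  _ g = ⊥-elim (g tt)
  T-injective {true}  {false} f _ = ⊥-elim (f tt)
  T-injective {true}  {true}  _ _ = refl

  -- lab : A → ℕ names the classes of a partition of the elements of xs into m classes.
  record Labelling {A : Set ℓa} (xs : List A) (m : ℕ) (lab : A → ℕ) : Set ℓa where
    field
      lab<   : ∀ {x} → x ∈ xs → lab x < m
      rep    : ℕ → A
      rep∈   : ∀ {j} → j < m → rep j ∈ xs
      labrep : ∀ {j} → j < m → lab (rep j) ≡ j

  module _ {A : Set ℓa} (_≟A_ : DecidableEquality A) {xs : List A} (xs! : Unique xs) {m : ℕ} (lab : A → ℕ)
           (labelling : Labelling xs m lab) where

    open Labelling labelling
    open DecMembership _≟A_ using (_∈?_)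

    union : Vec Bool m → List A
    union S = filter (λ x → T? (at S (lab x))) xs

    ∈-union⁺ : ∀ S {x} → x ∈ xs → T (at S (lab x)) → x ∈ union S
    ∈-union⁺ S = ∈-filter⁺ (λ x → T? (at S (lab x)))

    ∈-union⁻ : ∀ S {x} → x ∈ union S → x ∈ xs × T (at S (lab x))
    ∈-union⁻ S = ∈-filter⁻ (λ x → T? (at S (lab x)))

    -- The representative of class `j` lies in `union S` exactly when `S` chooses `j`.
    union-injective : ∀ {S S′} → union S ≡ union S′ → S ≡ S′
    union-injective {S} {S′} e = at-injective S S′
      (λ j<m → T-injective (half S S′ e j<m) (half S′ S (sym e) j<m))
      where
      half : ∀ S S′ → union S ≡ union S′ → ∀ {j} → j < m → T (at S j) → T (at S′ j)
      half S S′ e {j} j<m t =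
        subst (λ i → T (at S′ i)) (labrep j<m)
          (proj₂ (∈-union⁻ S′ (subst (rep j ∈_) e
            (∈-union⁺ S (rep∈ j<m) (subst (λ i → T (at S i)) (sym (labrep j<m)) t)))))

    -- A saturated sublist is the union of the classes whose representatives it contains, so `S` is
    -- recovered by testing representatives. This replaces a sum over matchings by a sum over bit
    -- vectors; `C` is the condition on a vector that its union belongs to `L`.
    unions-↭ : {L : List (List A)} → Unique L → (∀ {μ} → μ ∈ L → μ ∈ sublists xs) →
               (∀ {μ} → μ ∈ L → ∀ {x y} → x ∈ μ → y ∈ xs → lab x ≡ lab y → y ∈ μ) →
               {C : Vec Bool m → Set} (C? : Unary.Decidable C) →
               (∀ S → C S → union S ∈ L) → (∀ S → union S ∈ L → C S) →
               L ↭ map union (filter C? (vectors bools m))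
    unions-↭ {L} L! L⊆ saturated {C} C? C⇒∈ ∈⇒C =
      unique∧set⇒↭ L! (Uniqueₚ.map⁺ union-injective (Uniqueₚ.filter⁺ C? (vectors-unique bools! m))) to from
      where
      bools! : Unique bools
      bools! = ((λ ()) ∷ []) ∷ [] ∷ []

      to : ∀ {μ} → μ ∈ L → μ ∈ map union (filter C? (vectors bools m))
      to {μ} μ∈ = subst (_∈ map union _) (sym μ≡)
        (∈-map⁺ union (∈-filter⁺ C? (∈-vectors ∈-bools S) (∈⇒C S (subst (_∈ L) μ≡ μ∈))))
        where
        member : ℕ → Bool
        member j = does (rep j ∈? μ)

        S : Vec Bool m
        S = vec member m

        member⁺ : ∀ {j} → rep j ∈ μ → T (member j)
        member⁺ {j} r∈ rewrite dec-true (rep j ∈? μ) r∈ = tt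

        member⁻ : ∀ {j} → T (member j) → rep j ∈ μ
        member⁻ {j} t with rep j ∈? μ
        ... | yes r∈ = r∈
        ... | no _   = ⊥-elim t

        ⊆xs : ∀ {x} → x ∈ μ → x ∈ xs
        ⊆xs = sublists-⊆ xs (L⊆ μ∈)

        μ≡ : μ ≡ union S
        μ≡ = sublist≡filter (λ x → T? (at S (lab x))) xs! (L⊆ μ∈)
          (λ {x} x∈ → subst T (sym (at-vec member (lab< (⊆xs x∈))))
            (member⁺ (saturated μ∈ x∈ (rep∈ (lab< (⊆xs x∈))) (sym (labrep (lab< (⊆xs x∈)))))))
          (λ {x} x∈ t → saturated μ∈ (member⁻ (subst T (at-vec member (lab< x∈)) t)) x∈ (labrep (lab< x∈)))

      from : ∀ {μ} → μ ∈ map union (filter C? (vectors bools m)) → μ ∈ L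
      from μ∈ with ∈-map⁻ union μ∈
      ... | S , S∈ , refl = C⇒∈ S (proj₂ (∈-filter⁻ C? {xs = vectors bools m} S∈))

  -- Of two surviving entries the earlier is not `R`-related to the later, so equal values of `g`
  -- would contradict the assumption.
  dedup-map-unique : {R : Rel A ℓp} (R? : Binary.Decidable R) (g : A → B) (xs : List A) →
                     (∀ {x y} → x ∈ xs → y ∈ xs → g x ≡ g y → R x y) →
                     Unique (map g (deduplicate R? xs))
  dedup-map-unique R? g [] _ = []
  dedup-map-unique R? g (x ∷ xs) R! =
    Allₚ.map⁺ (All.tabulate λ {y} y∈ gx≡gy →
      let y∈D , ¬Rxy = ∈-filter⁻ (¬? ∘ R? x) {xs = deduplicate R? xs} y∈ in
      ¬Rxy (R! (here refl) (there (∈-deduplicate⁻ R? xs y∈D)) gx≡gy)) ∷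
    AllPairsₚ.map⁺ (AllPairsₚ.filter⁺ (¬? ∘ R? x)
      (AllPairsₚ.map⁻ (dedup-map-unique R? g xs (λ x∈ y∈ → R! (there x∈) (there y∈)))))

  -- An entry is dropped only in favour of an earlier one to which `R` relates it, and that one has
  -- the same value of `g`.
  dedup-map-complete : {R : Rel A ℓp} (R? : Binary.Decidable R) (g : A → B) (xs : List A) →
                       (∀ {x y} → x ∈ xs → y ∈ xs → R x y → g x ≡ g y) →
                       ∀ {x} → x ∈ xs → ∃[ y ] y ∈ deduplicate R? xs × g y ≡ g x
  dedup-map-complete R? g (x ∷ xs) R! (here refl) = x , here refl , refl
  dedup-map-complete R? g (x ∷ xs) R! (there z∈)
    with dedup-map-complete R? g xs (λ x∈ y∈ → R! (there x∈) (there y∈)) z∈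
  ... | y , y∈ , e with R? x y
  ...   | yes Rxy = x , here refl , trans (R! (here refl) (there (∈-deduplicate⁻ R? xs y∈)) Rxy) e
  ...   | no ¬Rxy = y , there (∈-filter⁺ (¬? ∘ R? x) y∈ ¬Rxy) , e

  module _ {A : Set ℓa} (f : A → A) where

    open Endo A using (_^_)

    ^-+ : ∀ i j x → (f ^ (i + j)) x ≡ (f ^ i) ((f ^ j) x)
    ^-+ zero    j x = refl
    ^-+ (suc i) j x = cong f (^-+ i j x)

    ^-suc : ∀ i x → (f ^ i) (f x) ≡ (f ^ suc i) x
    ^-suc zero    x = refl
    ^-suc (suc i) x = cong f (^-suc i x)

    ^-period : ∀ {l x} → (f ^ l) x ≡ x → ∀ k → (f ^ (k * l)) x ≡ x
    ^-period         e zero    = refl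
    ^-period {l} {x} e (suc k) = trans (^-+ l (k * l) x) (trans (cong (f ^ l) (^-period e k)) e)

    ^-% : ∀ {l x} .{{_ : NonZero l}} → (f ^ l) x ≡ x → ∀ i → (f ^ i) x ≡ (f ^ (i % l)) x
    ^-% {l} {x} e i = begin
      (f ^ i) x                             ≡⟨ cong (λ k → (f ^ k) x) (m≡m%n+[m/n]*n i l) ⟩
      (f ^ (i % l + i / l * l)) x           ≡⟨ ^-+ (i % l) (i / l * l) x ⟩
      (f ^ (i % l)) ((f ^ (i / l * l)) x)   ≡⟨ cong (f ^ (i % l)) (^-period e (i / l)) ⟩
      (f ^ (i % l)) x                       ∎
      where open ≡-Reasoning

    ∈-iterate⁺ : ∀ {i n} x → i < n → (f ^ i) x ∈ iterate f x n
    ∈-iterate⁺ {zero}  {suc n} x _         = here refl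
    ∈-iterate⁺ {suc i} {suc n} x (s≤s i<n) =
      there (subst (_∈ iterate f (f x) n) (^-suc i x) (∈-iterate⁺ (f x) i<n))

    ∈-iterate⁻ : ∀ n {x y} → y ∈ iterate f x n → ∃[ i ] y ≡ (f ^ i) x
    ∈-iterate⁻ (suc n) (here refl) = 0 , refl
    ∈-iterate⁻ (suc n) {x} (there y∈) with ∈-iterate⁻ n y∈
    ... | i , refl = suc i , ^-suc i x

  module Orbits {A : Set ℓa} (_≟A_ : DecidableEquality A) (f : A → A) (xs : List A) where

    open Endo A using (_^_)
    open Cycles _≟A_ f xs public
    open DecMembership _≟A_ using (_∈?_)

    orbit⁻ : ∀ {x y} → y ∈ orbit x → ∃[ i ] y ≡ (f ^ i) x
    orbit⁻ y∈ = ∈-iterate⁻ f (length xs) (∈-deduplicate⁻ _≟A_ _ y∈)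

    -- `orbit` stops after `length xs` iterates. A period of at most that size lets every exponent
    -- be reduced into the range that is computed.
    orbit⁺ : ∀ {l x} .{{_ : NonZero l}} → l ≤ length xs → (f ^ l) x ≡ x → ∀ i → (f ^ i) x ∈ orbit x
    orbit⁺ {l} {x} l≤ e i = subst (_∈ orbit x) (sym (^-% f e i))
      (∈-deduplicate⁺ _≟A_ (∈-iterate⁺ f x (ℕₚ.<-≤-trans (m%n<n i l) l≤)))

    orbit-length : ∀ {l x} .{{_ : NonZero l}} → l ≤ length xs → (f ^ l) x ≡ x →
                   (∀ {i j} → i < j → j < l → (f ^ i) x ≢ (f ^ j) x) → length (orbit x) ≡ l
    orbit-length {l} {x} l≤ e inj = trans
      (↭-length (unique∧set⇒↭ (DecUniqueₚ.deduplicate-! _≟A_ _) (Uniqueₚ.applyUpTo⁺₁ (λ i → (f ^ i) x) l inj) to from))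
      (trans (sym (cong length (map-applyUpTo id (λ i → (f ^ i) x) l))) (trans (length-map _ (upTo l)) (length-upTo l)))
      where
      to : ∀ {y} → y ∈ orbit x → y ∈ applyUpTo (λ i → (f ^ i) x) l
      to y∈ with orbit⁻ y∈
      ... | i , refl = subst (_∈ applyUpTo (λ i → (f ^ i) x) l) (sym (^-% f e i))
                         (∈-applyUpTo⁺ (λ i → (f ^ i) x) (m%n<n i l))

      from : ∀ {y} → y ∈ applyUpTo (λ i → (f ^ i) x) l → y ∈ orbit x
      from y∈ with ∈-applyUpTo⁻ (λ i → (f ^ i) x) y∈
      ... | i , _ , refl = orbit⁺ l≤ e i

    length-orbit≤ : ∀ x → length (orbit x) ≤ length xs
    length-orbit≤ x = ≤-trans (length-deduplicate (iterate f x (length xs))) (≤-reflexive (length-iterate f x (length xs)))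
      where
      length-deduplicate : ∀ ys → length (deduplicate _≟A_ ys) ≤ length ys
      length-deduplicate []       = z≤n
      length-deduplicate (y ∷ ys) = s≤s (≤-trans (length-filter _ (deduplicate _≟A_ ys)) (length-deduplicate ys))

    x∈orbit : ∀ {x y} → y ∈ xs → x ∈ orbit x
    x∈orbit {x} y∈ = ∈-deduplicate⁺ _≟A_ (∈-iterate⁺ f x (∈-length y∈))

    -- `cycles` is by definition `map orbit transversal`; the name gives access to the starting
    -- points of the cycles.
    transversal : List A
    transversal = deduplicate (λ x y → y ∈? orbit x) xs

    transversal⊆ : ∀ {x} → x ∈ transversal → x ∈ xs
    transversal⊆ = ∈-deduplicate⁻ (λ x y → y ∈? orbit x) xs

    -- When the label is a complete invariant of the orbit, the starting points carry each label
    -- exactly once, so a product over cycles becomes a product over labels.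
    labels-↭ : ∀ {m lab} → Labelling xs m lab →
               (∀ {x y} → x ∈ xs → y ∈ orbit x → lab x ≡ lab y) →
               (∀ {x y} → x ∈ xs → y ∈ xs → lab x ≡ lab y → y ∈ orbit x) →
               map lab transversal ↭ upTo m
    labels-↭ {m} {lab} labelling orbit⇒lab lab⇒orbit =
      unique∧set⇒↭ (dedup-map-unique R? lab xs lab⇒orbit) (Uniqueₚ.upTo⁺ m) to from
      where
      open Labelling labelling
      R? : Binary.Decidable (λ x y → y ∈ orbit x)
      R? x y = y ∈? orbit x

      to : ∀ {j} → j ∈ map lab transversal → j ∈ upTo m
      to j∈ with ∈-map⁻ lab j∈
      ... | x , x∈ , refl = ∈-upTo⁺ (lab< (transversal⊆ x∈))

      from : ∀ {j} → j ∈ upTo m → j ∈ map lab transversal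
      from j∈ with dedup-map-complete R? lab xs (λ x∈ _ → orbit⇒lab x∈) (rep∈ (∈-upTo⁻ j∈))
      ... | y , y∈ , e = subst (_∈ map lab transversal) (trans e (labrep (∈-upTo⁻ j∈))) (∈-map⁺ lab y∈)

  -- Sums and products over lists

  module Fold {c ℓ} (M : CommutativeMonoid c ℓ) where

    open CommutativeMonoid M renaming (refl to ≈-refl; sym to ≈-sym; trans to ≈-trans; setoid to ≈-setoid)
    open import Algebra.Properties.CommutativeSemigroup commutativeSemigroup using (interchange; x∙yz≈y∙xz)
    open import Relation.Binary.Reasoning.Setoid ≈-setoid

    -- `∑` and `∏` are both definitional instances of this fold, so each rearrangement is proved
    -- once for the two of them.
    ⨁ : List A → (A → Carrier) → Carrier
    ⨁ xs f = foldr (λ x s → f x ∙ s) ε xs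

    ⨁-cong : ∀ (xs : List A) {f g} → (∀ {x} → x ∈ xs → f x ≈ g x) → ⨁ xs f ≈ ⨁ xs g
    ⨁-cong []       e = ≈-refl
    ⨁-cong (x ∷ xs) e = ∙-cong (e (here refl)) (⨁-cong xs (e ∘ there))

    ⨁-map : ∀ (h : A → B) xs (f : B → Carrier) → ⨁ (map h xs) f ≡ ⨁ xs (f ∘ h)
    ⨁-map h []       f = refl
    ⨁-map h (x ∷ xs) f = cong (f (h x) ∙_) (⨁-map h xs f)

    ⨁-++ : ∀ (xs ys : List A) f → ⨁ (xs ++ ys) f ≈ ⨁ xs f ∙ ⨁ ys f
    ⨁-++ []       ys f = ≈-sym (identityˡ _)
    ⨁-++ (x ∷ xs) ys f = ≈-trans (∙-congˡ (⨁-++ xs ys f)) (≈-sym (assoc _ _ _))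

    ⨁-↭ : ∀ {xs ys : List A} f → xs ↭ ys → ⨁ xs f ≈ ⨁ ys f
    ⨁-↭ f Perm.refl           = ≈-refl
    ⨁-↭ f (Perm.prep x p)     = ∙-congˡ (⨁-↭ f p)
    ⨁-↭ f (Perm.swap x y p)   = ≈-trans (x∙yz≈y∙xz _ _ _) (∙-congˡ (∙-congˡ (⨁-↭ f p)))
    ⨁-↭ f (Perm.trans p p′)   = ≈-trans (⨁-↭ f p) (⨁-↭ f p′)

    ⨁-∙ : ∀ (xs : List A) f g → ⨁ xs (λ x → f x ∙ g x) ≈ ⨁ xs f ∙ ⨁ xs g
    ⨁-∙ []       f g = ≈-sym (identityˡ _)
    ⨁-∙ (x ∷ xs) f g = ≈-trans (∙-congˡ (⨁-∙ xs f g)) (interchange _ _ _ _)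

    ⨁-ε : ∀ (xs : List A) → ⨁ xs (λ _ → ε) ≈ ε
    ⨁-ε []       = ≈-refl
    ⨁-ε (x ∷ xs) = ≈-trans (identityˡ _) (⨁-ε xs)

    ⨁-swap : ∀ (xs : List A) (ys : List B) (f : A → B → Carrier) →
             ⨁ xs (λ x → ⨁ ys (f x)) ≈ ⨁ ys (λ y → ⨁ xs (λ x → f x y))
    ⨁-swap []       ys f = ≈-sym (⨁-ε ys)
    ⨁-swap (x ∷ xs) ys f = ≈-trans (∙-congˡ (⨁-swap xs ys f)) (≈-sym (⨁-∙ ys (f x) _))

    ⨁-filter : {P : A → Set ℓp} (P? : Unary.Decidable P) → ∀ xs (f : A → Carrier) →
               ⨁ (filter P? xs) f ≈ ⨁ xs (λ x → if does (P? x) then f x else ε)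
    ⨁-filter P? []       f = ≈-refl
    ⨁-filter P? (x ∷ xs) f with does (P? x)
    ... | true  = ∙-congˡ (⨁-filter P? xs f)
    ... | false = ≈-trans (⨁-filter P? xs f) (≈-sym (identityˡ _))

    -- A Kronecker delta. As a product it selects the variable belonging to the length of a cycle,
    -- as a sum the divisor belonging to a rotation.
    ⨁-pick : ∀ {ks l} → Unique ks → l ∈ ks → ∀ (f : ℕ → Carrier) →
             ⨁ ks (λ k → if does (l ℕₚ.≟ k) then f k else ε) ≈ f l
    ⨁-pick {l = l} (l∉ ∷ _) (here {xs = ks} refl) f = begin
      (if does (l ℕₚ.≟ l) then f l else ε) ∙ ⨁ ks (λ k → if does (l ℕₚ.≟ k) then f k else ε)
        ≈⟨ ∙-cong (reflexive (cong (λ b → if b then f l else ε) (dec-true (l ℕₚ.≟ l) refl)))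
                  (⨁-cong ks λ {k} k∈ → reflexive
                    (cong (λ b → if b then f k else ε) (dec-false (l ℕₚ.≟ k) (All.lookup l∉ k∈)))) ⟩
      f l ∙ ⨁ ks (λ _ → ε) ≈⟨ ∙-congˡ (⨁-ε ks) ⟩
      f l ∙ ε              ≈⟨ identityʳ _ ⟩
      f l                  ∎
    ⨁-pick {k ∷ ks} {l} (k∉ ∷ ks!) (there l∈) f = ≈-trans
      (∙-cong (reflexive (cong (λ b → if b then f k else ε)
                (dec-false (l ℕₚ.≟ k) (λ { refl → All.lookup k∉ l∈ refl }))))
              (⨁-pick ks! l∈ f))
      (identityˡ _)

    ⨁-upTo-suc : ∀ m (f : ℕ → Carrier) → ⨁ (upTo (suc m)) f ≈ f 0 ∙ ⨁ (upTo m) (f ∘ suc)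
    ⨁-upTo-suc m f = ∙-congˡ (reflexive (trans (cong (λ ks → ⨁ ks f) (sym (map-applyUpTo id suc m))) (⨁-map suc (upTo m) f)))

  -- Transfer sums over sets without two consecutive members.

  chain : ∀ {m} → Bool → Vec Bool m → Bool → Bool
  chain p []      q = not (p ∧ q)
  chain p (x ∷ S) q = not (p ∧ x) ∧ chain x S q

  -- The head also serves as right neighbour of the last entry. In length one it is its own
  -- neighbour, so a single orbit can never be chosen, which agrees with `T 1 y z = z`.
  cyclicChain : ∀ {m} → Vec Bool (suc m) → Bool
  cyclicChain (x ∷ S) = chain x S x

  module Sums {c ℓ} (K : ℚ-Algebra c ℓ) where

    open ℚ-Algebra K renaming (refl to ≈-refl; sym to ≈-sym; trans to ≈-trans; setoid to ≈-setoid; _+_ to _⊞_; _*_ to _⊠_)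
    open WalshSeries K
    open import Relation.Binary.Reasoning.Setoid ≈-setoid
    open import Algebra.Solver.Ring.NaturalCoefficients.Default commutativeSemiring using (solve; _:=_; _:+_; _:*_; con)

    open Fold +-commutativeMonoid public
      renaming (⨁-cong to ∑-cong; ⨁-map to ∑-map; ⨁-++ to ∑-++; ⨁-↭ to ∑-↭; ⨁-∙ to ∑-+; ⨁-ε to ∑-0; ⨁-swap to ∑-swap;
                ⨁-filter to ∑-filter; ⨁-pick to ∑-pick; ⨁-upTo-suc to ∑-upTo-suc)
      hiding (⨁)
    open Fold *-commutativeMonoid public
      renaming (⨁-cong to ∏-cong; ⨁-map to ∏-map; ⨁-++ to ∏-++; ⨁-↭ to ∏-↭; ⨁-∙ to ∏-*; ⨁-ε to ∏-1; ⨁-swap to ∏-swap;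
                ⨁-filter to ∏-filter; ⨁-pick to ∏-pick; ⨁-upTo-suc to ∏-upTo-suc)
      hiding (⨁)

    ∑-distribˡ : ∀ k (xs : List A) f → k ⊠ ∑ xs f ≈ ∑ xs (λ x → k ⊠ f x)
    ∑-distribˡ k []       f = zeroʳ k
    ∑-distribˡ k (x ∷ xs) f = ≈-trans (distribˡ k _ _) (+-congˡ (∑-distribˡ k xs f))

    ∑-const : ∀ (xs : List A) k → ∑ xs (λ _ → k) ≈ length xs · k
    ∑-const []       k = ≈-refl
    ∑-const (x ∷ xs) k = +-congˡ (∑-const xs k)

    ∑-vectors : ∀ m (f : Vec Bool (suc m) → Carrier) →
      ∑ (vectors bools (suc m)) f ≈ ∑ (vectors bools m) (f ∘ (true ∷_)) ⊞ ∑ (vectors bools m) (f ∘ (false ∷_))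
    ∑-vectors m f = begin
      ∑ (map (true ∷_) vs ++ (map (false ∷_) vs ++ [])) f
        ≈⟨ ∑-++ (map (true ∷_) vs) _ f ⟩
      ∑ (map (true ∷_) vs) f ⊞ ∑ (map (false ∷_) vs ++ []) f
        ≈⟨ +-cong (reflexive (∑-map (true ∷_) vs f)) (∑-++ (map (false ∷_) vs) [] f) ⟩
      ∑ vs (f ∘ (true ∷_)) ⊞ (∑ (map (false ∷_) vs) f ⊞ 0#)
        ≈⟨ +-congˡ (≈-trans (+-identityʳ _) (reflexive (∑-map (false ∷_) vs f))) ⟩
      ∑ vs (f ∘ (true ∷_)) ⊞ ∑ vs (f ∘ (false ∷_)) ∎
      where
      vs : List (Vec Bool m)
      vs = vectors bools m

    -- The generating function of the subsets S of {0, …, m-1} such that p, S, q has no two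
    -- consecutive members, where W j x is the weight of S j = x.
    R : Bool → ℕ → Bool → (ℕ → Bool → Carrier) → Carrier
    R p     zero    q W = if p ∧ q then 0# else 1#
    R true  (suc m) q W = W 0 false ⊠ R false m q (W ∘ suc)
    R false (suc m) q W = W 0 true ⊠ R true m q (W ∘ suc) ⊞ W 0 false ⊠ R false m q (W ∘ suc)

    R-cong : ∀ p m q {W W′} → (∀ {j} → j < m → ∀ x → W j x ≈ W′ j x) → R p m q W ≈ R p m q W′
    R-cong p     zero    q e = ≈-refl
    R-cong true  (suc m) q e = *-cong (e (s≤s z≤n) false) (R-cong false m q (e ∘ s≤s))
    R-cong false (suc m) q e = +-cong
      (*-cong (e (s≤s z≤n) true) (R-cong true m q (e ∘ s≤s)))
      (*-cong (e (s≤s z≤n) false) (R-cong false m q (e ∘ s≤s)))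

    setWeight : ∀ {m} → (ℕ → Bool → Carrier) → Vec Bool m → Carrier
    setWeight {m} W S = ∏ (upTo m) (λ j → W j (at S j))

    setWeight-∷ : ∀ {m} W x (S : Vec Bool m) → setWeight W (x ∷ S) ≈ W 0 x ⊠ setWeight (W ∘ suc) S
    setWeight-∷ {m} W x S = ∏-upTo-suc m (λ j → W j (at (x ∷ S) j))

    private
      ∑-chain-∷ : ∀ m (b : Vec Bool m → Bool) W x →
        ∑ (vectors bools m) (λ S → if b S then setWeight W (x ∷ S) else 0#)
          ≈ W 0 x ⊠ ∑ (vectors bools m) (λ S → if b S then setWeight (W ∘ suc) S else 0#)
      ∑-chain-∷ m b W x = ≈-trans
        (∑-cong (vectors bools m) (λ {S} _ → pull (b S) S))
        (≈-sym (∑-distribˡ (W 0 x) (vectors bools m) _))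
        where
        pull : ∀ b S → (if b then setWeight W (x ∷ S) else 0#) ≈ W 0 x ⊠ (if b then setWeight (W ∘ suc) S else 0#)
        pull true  S = setWeight-∷ W x S
        pull false S = ≈-sym (zeroʳ _)

    ∑-chain-if : ∀ p m q W →
      ∑ (vectors bools m) (λ S → if chain p S q then setWeight W S else 0#) ≈ R p m q W
    ∑-chain-if p zero q W with p ∧ q
    ... | true  = +-identityʳ _
    ... | false = +-identityʳ _
    ∑-chain-if true (suc m) q W = begin
      ∑ (vectors bools (suc m)) (λ S → if chain true S q then setWeight W S else 0#)
        ≈⟨ ∑-vectors m _ ⟩
      ∑ (vectors bools m) (λ _ → 0#) ⊞ ∑ (vectors bools m) (λ S → if chain false S q then setWeight W (false ∷ S) else 0#)
        ≈⟨ +-cong (∑-0 (vectors bools m)) (∑-chain-∷ m (λ S → chain false S q) W false) ⟩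
      0# ⊞ W 0 false ⊠ _
        ≈⟨ +-identityˡ _ ⟩
      W 0 false ⊠ _
        ≈⟨ *-congˡ (∑-chain-if false m q (W ∘ suc)) ⟩
      R true (suc m) q W ∎
    ∑-chain-if false (suc m) q W = begin
      ∑ (vectors bools (suc m)) (λ S → if chain false S q then setWeight W S else 0#)
        ≈⟨ ∑-vectors m _ ⟩
      ∑ (vectors bools m) (λ S → if chain true S q then setWeight W (true ∷ S) else 0#)
        ⊞ ∑ (vectors bools m) (λ S → if chain false S q then setWeight W (false ∷ S) else 0#)
        ≈⟨ +-cong (∑-chain-∷ m (λ S → chain true S q) W true) (∑-chain-∷ m (λ S → chain false S q) W false) ⟩
      W 0 true ⊠ _ ⊞ W 0 false ⊠ _
        ≈⟨ +-cong (*-congˡ (∑-chain-if true m q (W ∘ suc))) (*-congˡ (∑-chain-if false m q (W ∘ suc))) ⟩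
      R false (suc m) q W ∎

    ∑-chain : ∀ p m q W →
      ∑ (filter (λ S → T? (chain p S q)) (vectors bools m)) (setWeight W) ≈ R p m q W
    ∑-chain p m q W = ≈-trans (∑-filter (λ S → T? (chain p S q)) (vectors bools m) (setWeight W)) (∑-chain-if p m q W)

    -- Fixing the first entry cuts the cycle open: it becomes both outer neighbours of the remaining
    -- chain.
    ∑-cyclicChain : ∀ m W →
      ∑ (filter (λ S → T? (cyclicChain S)) (vectors bools (suc m))) (setWeight W)
        ≈ W 0 true ⊠ R true m true (W ∘ suc) ⊞ W 0 false ⊠ R false m false (W ∘ suc)
    ∑-cyclicChain m W = begin
      ∑ (filter (λ S → T? (cyclicChain S)) (vectors bools (suc m))) (setWeight W)
        ≈⟨ ∑-filter (λ S → T? (cyclicChain S)) (vectors bools (suc m)) (setWeight W) ⟩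
      ∑ (vectors bools (suc m)) (λ S → if cyclicChain S then setWeight W S else 0#)
        ≈⟨ ∑-vectors m _ ⟩
      _ ≈⟨ +-cong (∑-chain-∷ m (λ S → chain true S true) W true) (∑-chain-∷ m (λ S → chain false S false) W false) ⟩
      _ ≈⟨ +-cong (*-congˡ (∑-chain-if true m true (W ∘ suc))) (*-congˡ (∑-chain-if false m false (W ∘ suc))) ⟩
      _ ∎

    -- `R` unfolds from the left, but for even `n` the last orbit of a reflection through edges has
    -- a weight of its own. Its value, `false` or `true`, becomes the right neighbour of the
    -- shorter, uniform chain.
    R-last : ∀ p k {W w} → (∀ {j} → j < k → ∀ x → W j x ≈ w x) →
             R p (suc k) false W ≈ W k false ⊠ R p k false (λ _ → w) ⊞ W k true ⊠ R p k true (λ _ → w)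
    R-last true zero {W} e = solve 2 (λ t f → f :* con 1 := f :* con 1 :+ t :* con 0) ≈-refl (W 0 true) (W 0 false)
    R-last false zero {W} e = solve 2 (λ t f → t :* con 1 :+ f :* con 1 := f :* con 1 :+ t :* con 1) ≈-refl (W 0 true) (W 0 false)
    R-last true (suc k) {W} {w} e = ≈-trans
      (*-cong (e (s≤s z≤n) false) (R-last false k (e ∘ s≤s)))
      (solve 5 (λ z f t r r′ → z :* (f :* r :+ t :* r′) := f :* (z :* r) :+ t :* (z :* r′)) ≈-refl
        (w false) (W (suc k) false) (W (suc k) true) _ _)
    R-last false (suc k) {W} {w} e = ≈-trans
      (+-cong (*-cong (e (s≤s z≤n) true) (R-last true k (e ∘ s≤s)))
              (*-cong (e (s≤s z≤n) false) (R-last false k (e ∘ s≤s))))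
      (solve 8 (λ y z f t r r′ s s′ → y :* (f :* r :+ t :* r′) :+ z :* (f :* s :+ t :* s′)
                  := f :* (y :* r :+ z :* s) :+ t :* (y :* r′ :+ z :* s′)) ≈-refl
        (w true) (w false) (W (suc k) false) (W (suc k) true) _ _ _ _)

    -- A right neighbour `true` forces the last entry to be `false`, which splits off its weight.
    -- The recursion of `R` reaches back two entries, hence the two base cases.
    R-FT : ∀ m w → R false (suc m) true (λ _ → w) ≈ w false ⊠ R false m false (λ _ → w)
    R-FT zero w = solve 2 (λ y z → y :* con 0 :+ z :* con 1 := z :* con 1) ≈-refl (w true) (w false)
    R-FT (suc zero) w = solve 2 (λ y z → y :* (z :* con 1) :+ z :* (y :* con 0 :+ z :* con 1)
                                      := z :* (y :* con 1 :+ z :* con 1)) ≈-refl (w true) (w false)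
    R-FT (suc (suc m)) w = ≈-trans
      (+-cong (*-congˡ (*-congˡ (R-FT m w))) (*-congˡ (R-FT (suc m) w)))
      (solve 4 (λ y z r s → y :* (z :* (z :* r)) :+ z :* (z :* s) := z :* (y :* (z :* r) :+ z :* s)) ≈-refl
        (w true) (w false) (R false m false (λ _ → w)) (R false (suc m) false (λ _ → w)))

    -- The right-hand side has the shape of a term of `M`, so matching polynomials too become sums
    -- of products over single edges.
    ∏-if : {P : A → Set ℓp} (P? : Unary.Decidable P) → ∀ xs y z →
           ∏ xs (λ x → if does (P? x) then y else z) ≈ y ^ length (filter P? xs) ⊠ z ^ (length xs ∸ length (filter P? xs))
    ∏-if P? []       y z = ≈-sym (*-identityˡ 1#)
    ∏-if P? (x ∷ xs) y z with does (P? x)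
    ... | true  = ≈-trans (*-congˡ (∏-if P? xs y z)) (≈-sym (*-assoc _ _ _))
    ... | false = begin
      z ⊠ ∏ xs (λ x → if does (P? x) then y else z)       ≈⟨ *-congˡ (∏-if P? xs y z) ⟩
      z ⊠ (y ^ k ⊠ z ^ (length xs ∸ k))                   ≈⟨ x∙yz≈y∙xz _ _ _ ⟩
      y ^ k ⊠ z ^ suc (length xs ∸ k)                     ≡⟨ cong (λ e → y ^ k ⊠ z ^ e) (sym (ℕₚ.+-∸-assoc 1 (length-filter P? xs))) ⟩
      y ^ k ⊠ z ^ (suc (length xs) ∸ k)                   ∎
      where
      open import Algebra.Properties.CommutativeSemigroup *-commutativeSemigroup using (x∙yz≈y∙xz)
      k : ℕ
      k = length (filter P? xs)

    ^-count-∷ : {P : A → Set ℓp} (P? : Unary.Decidable P) → ∀ y x xs →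
                y ^ count P? (x ∷ xs) ≈ (if does (P? x) then y else 1#) ⊠ y ^ count P? xs
    ^-count-∷ P? y x xs with does (P? x)
    ... | true  = ≈-refl
    ... | false = ≈-sym (*-identityˡ _)

    -- The exponents count the cycles by length; grouping the factors by cycle removes the counting.
    ∏-count : ∀ N (x : ℕ → Carrier) {Q : ℕ → List A → Set ℓp} (Q? : ∀ k → Unary.Decidable (Q k)) (b : List A → Bool) κs →
              (∀ k κ → does (Q? k κ) ≡ does (length κ ℕₚ.≟ k) ∧ b κ) →
              (∀ {κ} → κ ∈ κs → 1 ≤ length κ × length κ ≤ N) →
              ∏ (map suc (upTo N)) (λ k → x k ^ count (Q? k) κs) ≈ ∏ κs (λ κ → if b κ then x (length κ) else 1#)
    ∏-count N x Q? b []       Q≡ len = ∏-1 (map suc (upTo N))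
    ∏-count {A = A} N x Q? b (κ ∷ κs) Q≡ len = begin
      ∏ ks (λ k → x k ^ count (Q? k) (κ ∷ κs))
        ≈⟨ ∏-cong ks (λ {k} _ → ^-count-∷ (Q? k) (x k) κ κs) ⟩
      ∏ ks (λ k → (if does (Q? k κ) then x k else 1#) ⊠ x k ^ count (Q? k) κs)
        ≈⟨ ∏-* ks _ _ ⟩
      ∏ ks (λ k → if does (Q? k κ) then x k else 1#) ⊠ ∏ ks (λ k → x k ^ count (Q? k) κs)
        ≈⟨ *-cong (∏-cong ks (λ {k} _ → reflexive (trans (cong (λ b → if b then x k else 1#) (Q≡ k κ)) (if-∧ (does (length κ ℕₚ.≟ k)) (b κ) (x k)))))
                  (∏-count N x Q? b κs Q≡ (len ∘ there)) ⟩
      ∏ ks (λ k → if does (length κ ℕₚ.≟ k) then (if b κ then x k else 1#) else 1#) ⊠ _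
        ≈⟨ *-congʳ (∏-pick (Uniqueₚ.map⁺ suc-injective (Uniqueₚ.upTo⁺ N)) (length∈ (len (here refl)))
                           (λ k → if b κ then x k else 1#)) ⟩
      (if b κ then x (length κ) else 1#) ⊠ ∏ κs (λ κ → if b κ then x (length κ) else 1#) ∎
      where
      ks : List ℕ
      ks = map suc (upTo N)

      if-∧ : ∀ p q (y : Carrier) → (if p ∧ q then y else 1#) ≡ (if p then (if q then y else 1#) else 1#)
      if-∧ true  q y = refl
      if-∧ false q y = refl

      length∈ : ∀ {l} → 1 ≤ l × l ≤ N → l ∈ ks
      length∈ {suc l} (_ , l<N) = ∈-map⁺ suc (∈-upTo⁺ l<N)

  -- The vertices of the cycle graph as residues modulo n

  ⟪⟫-< : ∀ {n} {i j : Fin n} → toℕ i < toℕ j → ⟪ i , j ⟫ ≡ (i , j)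
  ⟪⟫-< {i = i} {j} i<j = cong (λ b → if b then (i , j) else (j , i)) (dec-true (i <? j) i<j)

  ⟪⟫-≮ : ∀ {n} {i j : Fin n} → ¬ (toℕ i < toℕ j) → ⟪ i , j ⟫ ≡ (j , i)
  ⟪⟫-≮ {i = i} {j} i≮j = cong (λ b → if b then (i , j) else (j , i)) (dec-false (i <? j) i≮j)

  ⟪⟫-comm : ∀ {n} {i j : Fin n} → ⟪ i , j ⟫ ≡ ⟪ j , i ⟫
  ⟪⟫-comm {i = i} {j} with i <? j | j <? i
  ... | yes i<j | _       = trans (⟪⟫-< i<j) (sym (⟪⟫-≮ (ℕₚ.<-asym i<j)))
  ... | no i≮j  | yes j<i = trans (⟪⟫-≮ i≮j) (sym (⟪⟫-< j<i))
  ... | no i≮j  | no j≮i  = cong₂ ⟪_,_⟫ i≡j (sym i≡j)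
    where
    i≡j : i ≡ j
    i≡j = toℕ-injective (ℕₚ.≤-antisym (ℕₚ.≮⇒≥ j≮i) (ℕₚ.≮⇒≥ i≮j))

  ⟪⟫-cases : ∀ {n} (i j : Fin n) → (⟪ i , j ⟫ ≡ (i , j)) ⊎ (⟪ i , j ⟫ ≡ (j , i))
  ⟪⟫-cases i j with i <? j
  ... | yes i<j = inj₁ (⟪⟫-< i<j)
  ... | no i≮j  = inj₂ (⟪⟫-≮ i≮j)

  ⟪⟫-ordered : ∀ {n} {i j : Fin n} → i ≢ j → toℕ (proj₁ ⟪ i , j ⟫) < toℕ (proj₂ ⟪ i , j ⟫)
  ⟪⟫-ordered {i = i} {j} i≢j with i <? j
  ... | yes i<j = subst (λ x → toℕ (proj₁ x) < toℕ (proj₂ x)) (sym (⟪⟫-< i<j)) i<j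
  ... | no i≮j  = subst (λ x → toℕ (proj₁ x) < toℕ (proj₂ x)) (sym (⟪⟫-≮ i≮j))
                    (≤∧≢⇒< (ℕₚ.≮⇒≥ i≮j) (λ e → i≢j (sym (toℕ-injective e))))

  edgeMap-⟪⟫ : ∀ {n} (σ : Fin n → Fin n) i j → edgeMap σ ⟪ i , j ⟫ ≡ ⟪ σ i , σ j ⟫
  edgeMap-⟪⟫ σ i j with ⟪⟫-cases i j
  ... | inj₁ e rewrite e = refl
  ... | inj₂ e rewrite e = ⟪⟫-comm

  module Residues (n : ℕ) .{{_ : NonZero n}} where

    -- Vertices are treated as residue classes of natural numbers, so that equations between
    -- vertices can be added and cancelled as congruences.
    q : ℕ → Fin n
    q i = fromℕ< (m%n<n i n)

    toℕ-q : ∀ i → toℕ (q i) ≡ i % n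
    toℕ-q i = toℕ-fromℕ< (m%n<n i n)

    toℕ-q-< : ∀ {i} → i < n → toℕ (q i) ≡ i
    toℕ-q-< {i} i<n = trans (toℕ-q i) (m<n⇒m%n≡m i<n)

    q-toℕ : ∀ v → q (toℕ v) ≡ v
    q-toℕ v = toℕ-injective (toℕ-q-< (toℕ<n v))

    q-cong : ∀ {i j} → i % n ≡ j % n → q i ≡ q j
    q-cong {i} {j} e = toℕ-injective (trans (toℕ-q i) (trans e (sym (toℕ-q j))))

    q-% : ∀ {i j} → q i ≡ q j → i % n ≡ j % n
    q-% {i} {j} e = trans (sym (toℕ-q i)) (trans (cong toℕ e) (toℕ-q j))

    q-+ : ∀ {i i′ j j′} → q i ≡ q i′ → q j ≡ q j′ → q (i + j) ≡ q (i′ + j′)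
    q-+ {i} {i′} {j} {j′} e e′ = q-cong (begin
      (i + j) % n            ≡⟨ %-distribˡ-+ i j n ⟩
      (i % n + j % n) % n    ≡⟨ cong₂ (λ a b → (a + b) % n) (q-% e) (q-% e′) ⟩
      (i′ % n + j′ % n) % n  ≡⟨ sym (%-distribˡ-+ i′ j′ n) ⟩
      (i′ + j′) % n          ∎)
      where open ≡-Reasoning

    q-suc : ∀ {i j} → q i ≡ q j → q (suc i) ≡ q (suc j)
    q-suc {i} {j} = q-+ {1} {1} {i} {j} refl

    q-* : ∀ k {i j} → q i ≡ q j → q (k * i) ≡ q (k * j)
    q-* zero            e = refl
    q-* (suc k) {i} {j} e = q-+ {i} {j} {k * i} {k * j} e (q-* k {i} {j} e)

    q-+*n : ∀ i k → q (i + k * n) ≡ q i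
    q-+*n i k = q-cong ([m+kn]%n≡m%n i k n)

    q-+n : ∀ i → q (i + n) ≡ q i
    q-+n i = q-cong ([m+n]%n≡m%n i n)

    q-n : q n ≡ q 0
    q-n = q-+n 0

    -- `k * pred n` serves as `-k`, because added to `k` it gives the multiple `k * n`.
    q-cancelʳ : ∀ k {i j} → q (i + k) ≡ q (j + k) → q i ≡ q j
    q-cancelʳ k {i} {j} e = trans (sym (undo i)) (trans (q-+ {i + k} {j + k} {k * ℕ.pred n} e refl) (undo j))
      where
      undo : ∀ i → q ((i + k) + k * ℕ.pred n) ≡ q i
      undo i = trans (cong q (begin
        (i + k) + k * ℕ.pred n   ≡⟨ ℕₚ.+-assoc i k (k * ℕ.pred n) ⟩
        i + (k + k * ℕ.pred n)   ≡⟨ cong (i +_) (sym (ℕₚ.*-suc k (ℕ.pred n))) ⟩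
        i + k * suc (ℕ.pred n)   ≡⟨ cong (λ m → i + k * m) (ℕₚ.suc-pred n) ⟩
        i + k * n                ∎)) (q-+*n i k)
        where open ≡-Reasoning

    q-cancelˡ : ∀ k {i j} → q (k + i) ≡ q (k + j) → q i ≡ q j
    q-cancelˡ k {i} {j} e = q-cancelʳ k {i} {j} (subst₂ (λ a b → q a ≡ q b) (ℕₚ.+-comm k i) (ℕₚ.+-comm k j) e)

    q-injective : ∀ {i j} → i < n → j < n → q i ≡ q j → i ≡ j
    q-injective i<n j<n e = trans (sym (toℕ-q-< i<n)) (trans (cong toℕ e) (toℕ-q-< j<n))

    q-∣ : ∀ {i} → q i ≡ q 0 → n ∣ i
    q-∣ {i} e = m%n≡0⇒n∣m i n (trans (q-% {i} {0} e) (m<n⇒m%n≡m (ℕ.>-nonZero⁻¹ n)))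

    ∣-q : ∀ {i} → n ∣ i → q i ≡ q 0
    ∣-q (divides k refl) = q-+*n 0 k

    s : Fin n → Fin n
    s v = q (suc (toℕ v))

    s-q : ∀ i → s (q i) ≡ q (suc i)
    s-q i = q-suc {toℕ (q i)} {i} (q-toℕ (q i))

    s-injective : ∀ {v w} → s v ≡ s w → v ≡ w
    s-injective {v} {w} e = trans (sym (q-toℕ v)) (trans (q-cancelˡ 1 {toℕ v} {toℕ w} e) (q-toℕ w))

    -- A reflection is the map `i ↦ t - i`; stating it as the congruence `i + j ≡ t` avoids the
    -- subtraction.
    Rotates Reflects : ℕ → (Fin n → Fin n) → Set
    Rotates k σ = ∀ i → σ (q i) ≡ q (i + k)
    Reflects t σ = ∀ i j → q (i + j) ≡ q t → σ (q i) ≡ q j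

    rotation reflection : ℕ → Fin n → Fin n
    rotation k v = q (toℕ v + k)
    reflection t v = q (t + (n ∸ toℕ v))

    rotation-rotates : ∀ k → Rotates k (rotation k)
    rotation-rotates k i = q-+ {toℕ (q i)} {i} {k} (q-toℕ (q i)) refl

    opposite : ∀ t v → ∃[ j ] q (toℕ v + j) ≡ q t
    opposite t v = t + (n ∸ toℕ v) , (begin
      q (toℕ v + (t + (n ∸ toℕ v)))   ≡⟨ cong q (rearrange (toℕ v) t (n ∸ toℕ v)) ⟩
      q (t + (toℕ v + (n ∸ toℕ v)))   ≡⟨ cong (λ k → q (t + k)) (m+[n∸m]≡n (<⇒≤ (toℕ<n v))) ⟩
      q (t + n)                       ≡⟨ q-+n t ⟩
      q t                             ∎)
      where
      open ≡-Reasoning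
      rearrange : ∀ a b c → a + (b + c) ≡ b + (a + c)
      rearrange = solve-ℕ

    reflection-reflects : ∀ t → Reflects t (reflection t)
    reflection-reflects t i j e = q-cancelˡ (toℕ (q i)) {t + (n ∸ toℕ (q i))} {j}
      (trans (proj₂ (opposite t (q i))) (trans (sym e) (sym (q-+ {toℕ (q i)} {i} {j} (q-toℕ (q i)) refl))))

    module _ {t : ℕ} {σ : Fin n → Fin n} (σ-refl : Reflects t σ) where

      reflects-involutive : ∀ v → σ (σ v) ≡ v
      reflects-involutive v = let j , e = opposite t v in begin
        σ (σ v)             ≡⟨ cong (σ ∘ σ) (sym (q-toℕ v)) ⟩
        σ (σ (q (toℕ v)))   ≡⟨ cong σ (σ-refl (toℕ v) j e) ⟩
        σ (q j)             ≡⟨ σ-refl j (toℕ v) (trans (cong q (ℕₚ.+-comm j (toℕ v))) e) ⟩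
        q (toℕ v)           ≡⟨ q-toℕ v ⟩
        v                   ∎
        where open ≡-Reasoning

      s-reflects : ∀ v → s (σ (s v)) ≡ σ v
      s-reflects v = let j , e = opposite t (s v) in begin
        s (σ (s v))               ≡⟨ cong (s ∘ σ) (sym (q-toℕ (s v))) ⟩
        s (σ (q (toℕ (s v))))     ≡⟨ cong s (σ-refl (toℕ (s v)) j e) ⟩
        s (q j)                   ≡⟨ s-q j ⟩
        q (suc j)                 ≡⟨ sym (σ-refl (toℕ v) (suc j) (trans (trans (cong q (ℕₚ.+-suc (toℕ v) j)) (q-+ {suc (toℕ v)} {toℕ (s v)} {j} (sym (q-toℕ (s v))) refl)) e)) ⟩
        σ (q (toℕ v))             ≡⟨ cong σ (q-toℕ v) ⟩
        σ v                       ∎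
        where open ≡-Reasoning

      -- `σ ∘ s` is the way in which `σ` moves edges named by their first vertex: `v` goes to
      -- `t - 1 - v`.
      reflects-∘s : ∀ {t′} → q (suc t′) ≡ q t → Reflects t′ (σ ∘ s)
      reflects-∘s {t′} e i j e′ = trans (cong σ (s-q i)) (σ-refl (suc i) j (trans (q-suc {i + j} {t′} e′) e))

    rotates-s : ∀ {k σ} → Rotates k σ → ∀ v → s (σ v) ≡ σ (s v)
    rotates-s {k} {σ} σ-rot v = begin
      s (σ v)               ≡⟨ cong (s ∘ σ) (sym (q-toℕ v)) ⟩
      s (σ (q (toℕ v)))     ≡⟨ cong s (σ-rot (toℕ v)) ⟩
      s (q (toℕ v + k))     ≡⟨ s-q (toℕ v + k) ⟩
      q (suc (toℕ v) + k)   ≡⟨ sym (σ-rot (suc (toℕ v))) ⟩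
      σ (s v)               ∎
      where open ≡-Reasoning

    open Endo (Fin n) using (_^_)

    rotates-^ : ∀ {k σ} → Rotates k σ → ∀ i v → (σ ^ i) v ≡ q (toℕ v + i * k)
    rotates-^ σ-rot zero v = trans (sym (q-toℕ v)) (cong q (sym (ℕₚ.+-identityʳ (toℕ v))))
    rotates-^ {k} {σ} σ-rot (suc i) v = begin
      σ ((σ ^ i) v)               ≡⟨ cong σ (rotates-^ σ-rot i v) ⟩
      σ (q (toℕ v + i * k))       ≡⟨ σ-rot _ ⟩
      q (toℕ v + i * k + k)       ≡⟨ cong q (rearrange (toℕ v) (i * k) k) ⟩
      q (toℕ v + (k + i * k))     ∎
      where
      open ≡-Reasoning
      rearrange : ∀ a b c → a + b + c ≡ a + (c + b)
      rearrange = solve-ℕ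

  -- The edges of the cycle graph, named by vertices.

  module CycleEdges (n : ℕ) (3≤n : 3 ≤ n) where

    instance
      n≢0 : NonZero n
      n≢0 = ℕ.>-nonZero (≤-trans (s≤s z≤n) 3≤n)

    open Residues n public

    Cₙ : Graph n
    Cₙ = cycleGraph n 3≤n

    open Graph Cₙ using (_~_)

    q-shift≢ : ∀ k i → 0 < k → k < n → q (k + i) ≢ q i
    q-shift≢ (suc k) i _ k<n e = ℕₚ.<⇒≱ k<n (∣⇒≤ (q-∣ (q-cancelʳ i {suc k} {0} e)))

    s≢ : ∀ v → s v ≢ v
    s≢ v e = q-shift≢ 1 (toℕ v) (s≤s z≤n) (≤-trans (s≤s (s≤s z≤n)) 3≤n) (trans e (sym (q-toℕ v)))

    -- Here `3 ≤ n` is used in full. An edge then has only one direction along `s`, which makes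
    -- `origin` well defined.
    ss≢ : ∀ v → s (s v) ≢ v
    ss≢ v e = q-shift≢ 2 (toℕ v) (s≤s z≤n) 3≤n (trans (sym (s-q (suc (toℕ v)))) (trans e (sym (q-toℕ v))))

    Adjacent : Fin n → Fin n → Set
    Adjacent v w = (w ≡ s v) ⊎ (v ≡ s w)

    ~⇒adjacent : ∀ {v w} → v ~ w → Adjacent v w
    ~⇒adjacent (inj₁ e) = Sum.map forward backward e
      where
      forward : ∀ {v w : Fin n} → Consecutive v w → w ≡ s v
      forward {v} {w} e = trans (sym (q-toℕ w)) (cong q (sym e))
      backward : ∀ {v w : Fin n} → Ends v w → v ≡ s w
      backward {v} {w} (v≡0 , e) = trans (sym (q-toℕ v)) (trans (cong q v≡0) (sym (trans (cong q e) q-n)))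
    ~⇒adjacent (inj₂ e) = swap (~⇒adjacent (inj₁ e))

    ~s : ∀ v → v ~ s v
    ~s v with suc (toℕ v) ℕₚ.<? n
    ... | yes v+1<n = inj₁ (inj₁ (sym (toℕ-q-< v+1<n)))
    ... | no v+1≮n  = inj₂ (inj₂ (trans (toℕ-q (suc (toℕ v))) (trans (cong (_% n) v+1≡n) (n%n≡0 n)) , v+1≡n))
      where
      v+1≡n : suc (toℕ v) ≡ n
      v+1≡n = ℕₚ.≤-antisym (toℕ<n v) (ℕₚ.≮⇒≥ v+1≮n)

    adjacent⇒~ : ∀ {v w} → Adjacent v w → v ~ w
    adjacent⇒~ (inj₁ refl) = ~s _
    adjacent⇒~ (inj₂ refl) = swap (~s _)

    -- Naming edges by vertices turns the permutation of edges into a map on `Fin n`, although the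
    -- stored pair may list the two endpoints in either order.
    e : Fin n → Edge n
    e v = ⟪ v , s v ⟫

    origin : Edge n → Fin n
    origin (i , j) = if does (s i ≟ j) then i else j

    origin-e : ∀ v → origin (e v) ≡ v
    origin-e v with ⟪⟫-cases v (s v)
    ... | inj₁ eq rewrite eq | dec-true (s v ≟ s v) refl = refl
    ... | inj₂ eq rewrite eq | dec-false (s (s v) ≟ v) (ss≢ v) = refl

    e-injective : ∀ {v w} → e v ≡ e w → v ≡ w
    e-injective {v} {w} eq = trans (sym (origin-e v)) (trans (cong origin eq) (origin-e w))

    E : List (Edge n)
    E = edges Cₙ

    private
      IsEdge? : Unary.Decidable (λ ((i , j) : Edge n) → (toℕ i < toℕ j) × (i ~ j))
      IsEdge? (i , j) = (i <? j) ×-dec (Graph._~?_ Cₙ i j)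

    E-unique : Unique E
    E-unique = Uniqueₚ.filter⁺ IsEdge? (Uniqueₚ.cartesianProduct⁺ (Uniqueₚ.allFin⁺ n) (Uniqueₚ.allFin⁺ n))

    e∈E : ∀ v → e v ∈ E
    e∈E v = ∈-filter⁺ IsEdge? (∈-cartesianProduct⁺ (∈-allFin _) (∈-allFin _)) (⟪⟫-ordered (s≢ v ∘ sym) , adj)
      where
      adj : proj₁ (e v) ~ proj₂ (e v)
      adj with ⟪⟫-cases v (s v)
      ... | inj₁ eq rewrite eq = ~s v
      ... | inj₂ eq rewrite eq = swap (~s v)

    E⇒e : ∀ {x} → x ∈ E → x ≡ e (origin x)
    E⇒e {i , j} x∈ with proj₂ (∈-filter⁻ IsEdge? {xs = cartesianProduct (allFin n) (allFin n)} x∈)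
    ... | i<j , i~j with ~⇒adjacent i~j
    ...   | inj₁ refl = subst (λ x → x ≡ e (origin x)) (⟪⟫-< i<j) (cong e (sym (origin-e i)))
    ...   | inj₂ refl = subst (λ x → x ≡ e (origin x)) (trans ⟪⟫-comm (⟪⟫-< i<j)) (cong e (sym (origin-e j)))

    length-E : length E ≡ n
    length-E = trans
      (↭-length (unique∧set⇒↭ E-unique (Uniqueₚ.map⁺ e-injective (Uniqueₚ.allFin⁺ n))
        (λ {x} x∈ → subst (_∈ map e (allFin n)) (sym (E⇒e x∈)) (∈-map⁺ e (∈-allFin (origin x))))
        (λ x∈ → let v , _ , eq = ∈-map⁻ e x∈ in subst (_∈ E) (sym eq) (e∈E v))))
      (trans (length-map e (allFin n)) (length-tabulate {n = n} id))

    disjoint⇒¬consecutive : ∀ {v} → ¬ Disjoint (e v) (e (s v))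
    disjoint⇒¬consecutive {v} d with ⟪⟫-cases v (s v) | ⟪⟫-cases (s v) (s (s v))
    ... | inj₁ eq | inj₁ eq′ rewrite eq | eq′ = proj₁ (proj₂ (proj₂ d)) refl
    ... | inj₁ eq | inj₂ eq′ rewrite eq | eq′ = proj₂ (proj₂ (proj₂ d)) refl
    ... | inj₂ eq | inj₁ eq′ rewrite eq | eq′ = proj₁ d refl
    ... | inj₂ eq | inj₂ eq′ rewrite eq | eq′ = proj₁ (proj₂ d) refl

    disjoint⁺ : ∀ {v w} → v ≢ w → w ≢ s v → v ≢ s w → Disjoint (e v) (e w)
    disjoint⁺ {v} {w} v≢w w≢sv v≢sw with ⟪⟫-cases v (s v) | ⟪⟫-cases w (s w)
    ... | inj₁ eq | inj₁ eq′ rewrite eq | eq′ = v≢w , v≢sw , w≢sv ∘ sym , v≢w ∘ s-injective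
    ... | inj₁ eq | inj₂ eq′ rewrite eq | eq′ = v≢sw , v≢w , v≢w ∘ s-injective , w≢sv ∘ sym
    ... | inj₂ eq | inj₁ eq′ rewrite eq | eq′ = w≢sv ∘ sym , v≢w ∘ s-injective , v≢w , v≢sw
    ... | inj₂ eq | inj₂ eq′ rewrite eq | eq′ = v≢w ∘ s-injective , w≢sv ∘ sym , v≢sw , v≢w

  Disjoint-sym : ∀ {n} → Binary.Symmetric (Disjoint {n})
  Disjoint-sym (a , b , c , d) = a ∘ sym , c ∘ sym , b ∘ sym , d ∘ sym

  matching? : ∀ {n} → Unary.Decidable (AllPairs (Disjoint {n}))
  matching? = AllPairs.allPairs? disjoint?

  -- Sums over the fixed matchings of an automorphism

  -- The data from which the cycles of `τ` are read off: labels that are constant on orbits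
  -- (`lab-τ`) and separate them (`reach`), and the exact size of each orbit. The size depends on
  -- `v` because a reflection has orbits of sizes one and two.
  record Orbiting {n : ℕ} (τ : Fin n → Fin n) (m : ℕ) : Set where
    open Endo (Fin n) using (_^_)
    field
      lab          : Fin n → ℕ
      lab<         : ∀ v → lab v < m
      rep          : ℕ → Fin n
      labrep       : ∀ {j} → j < m → lab (rep j) ≡ j
      lab-τ        : ∀ v → lab (τ v) ≡ lab v
      reach        : ∀ {v w} → lab v ≡ lab w → ∃[ i ] w ≡ (τ ^ i) v
      period       : Fin n → ℕ
      period≢0     : ∀ v → NonZero (period v)
      period≤n     : ∀ v → period v ≤ n
      τ^period     : ∀ v → (τ ^ period v) v ≡ v
      τ^-injective : ∀ v {i j} → i < j → j < period v → (τ ^ i) v ≢ (τ ^ j) v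

    lab-τ^ : ∀ i v → lab ((τ ^ i) v) ≡ lab v
    lab-τ^ zero    v = refl
    lab-τ^ (suc i) v = trans (lab-τ _) (lab-τ^ i v)

  -- With `X = Fin n` and `e = id` this yields the vertex cycles, with `X = Edge n` the edge cycles.
  module Transport {X : Set} (_≟X_ : DecidableEquality X) {n : ℕ} (e : Fin n → X)
                   (e-injective : ∀ {v w} → e v ≡ e w → v ≡ w)
                   {xs : List X} (e∈xs : ∀ v → e v ∈ xs) (idx : X → Fin n)
                   (xs⇒e : ∀ {x} → x ∈ xs → x ≡ e (idx x)) (length-xs : length xs ≡ n) where

    idx-e : ∀ v → idx (e v) ≡ v
    idx-e v = sym (e-injective (xs⇒e (e∈xs v)))

    labelling : ∀ {m} {lab : Fin n → ℕ} (rep : ℕ → Fin n) → (∀ v → lab v < m) →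
                (∀ {j} → j < m → lab (rep j) ≡ j) → Labelling xs m (lab ∘ idx)
    labelling {lab = lab} rep lab< labrep = record
      { lab<   = λ {x} _ → lab< (idx x)
      ; rep    = e ∘ rep
      ; rep∈   = λ {j} _ → e∈xs (rep j)
      ; labrep = λ {j} j<m → trans (cong lab (idx-e (rep j))) (labrep j<m)
      }

    module WithMap (f : X → X) (τ : Fin n → Fin n) (f-e : ∀ v → f (e v) ≡ e (τ v))
                   {m : ℕ} (O : Orbiting τ m) where

      open Orbiting O
      open Orbits _≟X_ f xs public
      open Endo X using () renaming (_^_ to _^X_)
      open Endo (Fin n) using (_^_)

      orbitLabelling : Labelling xs m (lab ∘ idx)
      orbitLabelling = labelling rep lab< labrep

      f^-e : ∀ i v → (f ^X i) (e v) ≡ e ((τ ^ i) v)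
      f^-e zero    v = refl
      f^-e (suc i) v = trans (cong f (f^-e i v)) (f-e _)

      period≤length : ∀ v → period v ≤ length xs
      period≤length v = ≤-trans (period≤n v) (≤-reflexive (sym length-xs))

      f^period : ∀ v → (f ^X period v) (e v) ≡ e v
      f^period v = trans (f^-e (period v) v) (cong e (τ^period v))

      orbit-e⁻ : ∀ {v x} → x ∈ orbit (e v) → ∃[ i ] x ≡ e ((τ ^ i) v)
      orbit-e⁻ {v} x∈ = let i , eq = orbit⁻ x∈ in i , trans eq (f^-e i v)

      orbit-e⁺ : ∀ v i → e ((τ ^ i) v) ∈ orbit (e v)
      orbit-e⁺ v i = subst (_∈ orbit (e v)) (f^-e i v)
        (orbit⁺ {{period≢0 v}} (period≤length v) (f^period v) i)

      length-orbit-e : ∀ v → length (orbit (e v)) ≡ period v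
      length-orbit-e v = orbit-length {{period≢0 v}} (period≤length v) (f^period v)
        (λ {i} {j} i<j j<l eq → τ^-injective v i<j j<l
          (e-injective (trans (sym (f^-e i v)) (trans eq (f^-e j v)))))

      orbit⇒lab : ∀ {v x} → x ∈ orbit (e v) → lab (idx x) ≡ lab v
      orbit⇒lab {v} x∈ with orbit-e⁻ x∈
      ... | i , refl = trans (cong lab (idx-e _)) (lab-τ^ i v)

      lab⇒orbit : ∀ {v x} → x ∈ xs → lab v ≡ lab (idx x) → x ∈ orbit (e v)
      lab⇒orbit {v} x∈ eq with reach eq
      ... | i , eq′ = subst (_∈ orbit (e v)) (sym (trans (xs⇒e x∈) (cong e eq′))) (orbit-e⁺ v i)

      transversal-↭ : map (lab ∘ idx) transversal ↭ upTo m
      transversal-↭ = labels-↭ orbitLabelling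
        (λ {x} x∈ y∈ → sym (orbit⇒lab (subst (λ x → _ ∈ orbit x) (xs⇒e x∈) y∈)))
        (λ {x} {y} x∈ y∈ eq → subst (λ x → y ∈ orbit x) (sym (xs⇒e x∈)) (lab⇒orbit y∈ eq))

      length-cycle : ∀ {κ} → κ ∈ cycles → 1 ≤ length κ × length κ ≤ length xs
      length-cycle κ∈ with ∈-map⁻ orbit κ∈
      ... | x , x∈ , refl = ∈-length (x∈orbit (transversal⊆ x∈)) , length-orbit≤ x

      module _ {c ℓ} (K : ℚ-Algebra c ℓ) where
        open ℚ-Algebra K using (Carrier; _≈_; reflexive; setoid) renaming (trans to ≈-trans)
        open WalshSeries K using (∏)
        open Sums K
        open import Relation.Binary.Reasoning.Setoid setoid

        ∏-cycles : ∀ {g : List X → Carrier} {g′ : ℕ → Carrier} → (∀ v → g (orbit (e v)) ≈ g′ (lab v)) →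
                   ∏ cycles g ≈ ∏ (upTo m) g′
        ∏-cycles {g} {g′} g≈ = begin
          ∏ cycles g                            ≡⟨ ∏-map orbit transversal g ⟩
          ∏ transversal (g ∘ orbit)             ≈⟨ ∏-cong transversal (λ {x} x∈ → ≈-trans
                                                     (reflexive (cong (g ∘ orbit) (xs⇒e (transversal⊆ x∈)))) (g≈ (idx x))) ⟩
          ∏ transversal (g′ ∘ lab ∘ idx)        ≡⟨ sym (∏-map (lab ∘ idx) transversal g′) ⟩
          ∏ (map (lab ∘ idx) transversal) g′    ≈⟨ ∏-↭ g′ transversal-↭ ⟩
          ∏ (upTo m) g′                         ∎

  module CycleSums (n : ℕ) (3≤n : 3 ≤ n) where

    open CycleEdges n 3≤n public

    module VertexTransport = Transport _≟_ {n} id id {allFin n} ∈-allFin id (λ _ → refl) (length-tabulate {n = n} id)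
    module EdgeTransport = Transport _≟ᵉ_ e e-injective e∈E origin E⇒e length-E

    -- If `v` and `s v` share a label, the condition rules that label out; this is how the orbit of
    -- the edges at a fixed vertex is excluded.
    Admissible : ∀ {m} → (Fin n → ℕ) → Vec Bool m → Set
    Admissible lab S = ∀ v → T (at S (lab v)) → T (at S (lab (s v))) → ⊥

    module Unions {m : ℕ} (lab : Fin n → ℕ) (L : Labelling E m (lab ∘ origin)) where

      ⋃ : Vec Bool m → List (Edge n)
      ⋃ = union _≟ᵉ_ E-unique (lab ∘ origin) L

      e∈⋃⁺ : ∀ S {v} → T (at S (lab v)) → e v ∈ ⋃ S
      e∈⋃⁺ S {v} t = ∈-union⁺ _≟ᵉ_ E-unique (lab ∘ origin) L S (e∈E v)
        (subst (λ w → T (at S (lab w))) (sym (origin-e v)) t)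

      e∈⋃⁻ : ∀ S {v} → e v ∈ ⋃ S → T (at S (lab v))
      e∈⋃⁻ S {v} x∈ = subst (λ w → T (at S (lab w))) (origin-e v)
        (proj₂ (∈-union⁻ _≟ᵉ_ E-unique (lab ∘ origin) L S x∈))

      ⋃⊆E : ∀ S {x} → x ∈ ⋃ S → x ≡ e (origin x)
      ⋃⊆E S x∈ = E⇒e (proj₁ (∈-union⁻ _≟ᵉ_ E-unique (lab ∘ origin) L S x∈))

      ⋃-sublist : ∀ S → ⋃ S ∈ sublists E
      ⋃-sublist S = filter∈sublists (λ x → T? (at S (lab (origin x)))) E

      admissible⇒matching : ∀ S → Admissible lab S → ⋃ S ∈ matchings Cₙ
      admissible⇒matching S adm = ∈-filter⁺ matching? (⋃-sublist S)
        (allPairs⁺ (Uniqueₚ.filter⁺ (λ x → T? (at S (lab (origin x)))) E-unique) disjoint)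
        where
        disjoint′ : ∀ {v w} → T (at S (lab v)) → T (at S (lab w)) → e v ≢ e w → Disjoint (e v) (e w)
        disjoint′ {v} {w} tv tw ev≢ew = disjoint⁺ (ev≢ew ∘ cong e)
          (λ { refl → adm v tv tw }) (λ { refl → adm w tw tv })

        disjoint : ∀ {x y} → x ∈ ⋃ S → y ∈ ⋃ S → x ≢ y → Disjoint x y
        disjoint {x} {y} x∈ y∈ x≢y = subst₂ Disjoint (sym x≡) (sym y≡)
          (disjoint′ (e∈⋃⁻ S (subst (_∈ ⋃ S) x≡ x∈)) (e∈⋃⁻ S (subst (_∈ ⋃ S) y≡ y∈))
            (λ eq → x≢y (trans x≡ (trans eq (sym y≡)))))
          where
          x≡ : x ≡ e (origin x)
          x≡ = ⋃⊆E S x∈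
          y≡ : y ≡ e (origin y)
          y≡ = ⋃⊆E S y∈

      matching⇒admissible : ∀ S → ⋃ S ∈ matchings Cₙ → Admissible lab S
      matching⇒admissible S M∈ v tv tsv = disjoint⇒¬consecutive {v}
        (allPairs⁻ Disjoint-sym (proj₂ (∈-filter⁻ matching? {xs = sublists E} M∈))
          (e∈⋃⁺ S tv) (e∈⋃⁺ S tsv) (λ eq → s≢ v (sym (e-injective eq))))

    matchings-unique : Unique (matchings Cₙ)
    matchings-unique = Uniqueₚ.filter⁺ matching? (sublists-unique E-unique)

    matchings⊆ : ∀ {μ} → μ ∈ matchings Cₙ → μ ∈ sublists E
    matchings⊆ = proj₁ ∘ ∈-filter⁻ matching? {xs = sublists E}

    open Endo (Fin n) using (_^_)

    -- Either the power of `σ` that closes the cycle is the identity, which makes the cycle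
    -- cylindrical, or `σ` flips a single edge. Longer Möbius cycles do not occur: a power that
    -- flips an edge is a reflection, so `σ` is itself a reflection, and an odd power of it is `σ`.
    EdgeKind : ∀ {c ℓ} (K : ℚ-Algebra c ℓ) (b c β γ : ℕ → ℚ-Algebra.Carrier K) (σ τ : Fin n → Fin n) {m : ℕ}
               (O : Orbiting τ m) (W : ℕ → Bool → ℚ-Algebra.Carrier K) (v : Fin n) → Set ℓ
    EdgeKind K b c β γ σ τ O W v =
        ((∀ w → (σ ^ period v) w ≡ w) × (W (lab v) true ≈ b (period v)) × (W (lab v) false ≈ β (period v)))
      ⊎ (period v ≡ 1 × (σ v ≡ s v) × (σ (s v) ≡ v) × (W (lab v) true ≈ c 1) × (W (lab v) false ≈ γ 1))
      where
      open ℚ-Algebra K using (_≈_)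
      open Orbiting O

    module FixedMatchings {c ℓ} (K : ℚ-Algebra c ℓ) (a b c β γ : ℕ → ℚ-Algebra.Carrier K) (σ τ : Fin n → Fin n)
      (σ-e : ∀ v → edgeMap σ (e v) ≡ e (τ v)) {m mᵥ : ℕ} (Oᵥ : Orbiting σ mᵥ) (O : Orbiting τ m)
      (A : ℕ → ℚ-Algebra.Carrier K)
      (a≈A : ∀ v → ℚ-Algebra._≈_ K (a (Orbiting.period Oᵥ v)) (A (Orbiting.lab Oᵥ v)))
      (W : ℕ → Bool → ℚ-Algebra.Carrier K) (kinds : ∀ v → EdgeKind K b c β γ σ τ O W v)
      (C : Vec Bool m → Bool) (C⇒ : ∀ S → T (C S) → Admissible (Orbiting.lab O) S)
      (⇒C : ∀ S → Admissible (Orbiting.lab O) S → T (C S)) where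

      open ℚ-Algebra K renaming (refl to ≈-refl; sym to ≈-sym; trans to ≈-trans; setoid to ≈-setoid; _+_ to _⊞_; _*_ to _⊠_)
      open WalshSeries K hiding (_^_; T; U; W)
      open WalshSeries K using () renaming (_^_ to _^K_)
      open Sums K
      open import Relation.Binary.Reasoning.Setoid ≈-setoid
      open Orbiting O
      module V = VertexTransport.WithMap σ σ (λ _ → refl) Oᵥ
      open EdgeTransport.WithMap (edgeMap σ) τ σ-e O
      open Unions lab orbitLabelling

      fixed⁻ : ∀ {μ} → μ ∈ fixedMatchings Cₙ σ → μ ∈ matchings Cₙ × Stable σ μ
      fixed⁻ = ∈-filter⁻ (stable? σ) {xs = matchings Cₙ}

      stable-^ : ∀ {μ} → Stable σ μ → ∀ i {v} → e v ∈ μ → e ((τ ^ i) v) ∈ μ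
      stable-^ st zero    x∈ = x∈
      stable-^ {μ} st (suc i) x∈ = proj₁ st (subst (_∈ map (edgeMap σ) μ) (σ-e _) (∈-map⁺ (edgeMap σ) (stable-^ st i x∈)))

      saturated : ∀ {μ} → μ ∈ fixedMatchings Cₙ σ →
                  ∀ {x y} → x ∈ μ → y ∈ E → lab (origin x) ≡ lab (origin y) → y ∈ μ
      saturated {μ} μ∈ {x} {y} x∈ y∈ eq =
        let i , eq′ = reach eq in
        subst (_∈ μ) (sym (trans (E⇒e y∈) (cong e eq′)))
          (stable-^ (proj₂ (fixed⁻ μ∈)) i
            (subst (_∈ μ) (E⇒e (sublists-⊆ E (matchings⊆ (proj₁ (fixed⁻ μ∈))) x∈)) x∈))

      ⋃-stable : ∀ S → Stable σ (⋃ S)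
      ⋃-stable S = to , from
        where
        to : ∀ {x} → x ∈ map (edgeMap σ) (⋃ S) → x ∈ ⋃ S
        to x∈ with ∈-map⁻ (edgeMap σ) x∈
        ... | y , y∈ , refl = subst (_∈ ⋃ S) (sym (trans (cong (edgeMap σ) (⋃⊆E S y∈)) (σ-e (origin y))))
          (e∈⋃⁺ S (subst (T ∘ at S) (sym (lab-τ (origin y))) (e∈⋃⁻ S (subst (_∈ ⋃ S) (⋃⊆E S y∈) y∈))))

        from : ∀ {x} → x ∈ ⋃ S → x ∈ map (edgeMap σ) (⋃ S)
        from {x} x∈ = subst (_∈ map (edgeMap σ) (⋃ S)) eq (∈-map⁺ (edgeMap σ) (e∈⋃⁺ S y∈))
          where
          v y : Fin n
          v = origin x
          -- The preimage of `v` under `τ`, since `τ ^ period v` fixes `v`.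
          y = (τ ^ ℕ.pred (period v)) v
          y∈ : T (at S (lab y))
          y∈ = subst (T ∘ at S) (sym (lab-τ^ (ℕ.pred (period v)) v)) (e∈⋃⁻ S (subst (_∈ ⋃ S) (⋃⊆E S x∈) x∈))
          eq : edgeMap σ (e y) ≡ x
          eq = trans (σ-e y) (trans (cong e (trans
            (cong (λ k → (τ ^ k) v) (ℕₚ.suc-pred (period v) {{period≢0 v}})) (τ^period v))) (sym (⋃⊆E S x∈)))

      fixedMatchings-↭ : fixedMatchings Cₙ σ ↭ map ⋃ (filter (λ S → T? (C S)) (vectors bools m))
      fixedMatchings-↭ = unions-↭ _≟ᵉ_ E-unique (lab ∘ origin) orbitLabelling
        (Uniqueₚ.filter⁺ (stable? σ) matchings-unique) (matchings⊆ ∘ proj₁ ∘ fixed⁻) saturated (λ S → T? (C S))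
        (λ S t → ∈-filter⁺ (stable? σ) (admissible⇒matching S (C⇒ S t)) (⋃-stable S))
        (λ S μ∈ → ⇒C S (matching⇒admissible S (proj₁ (fixed⁻ μ∈))))

      sortWeight : (cyl möb Y Z : Bool) → ℕ → Carrier
      sortWeight cyl möb Y Z l =
          (if cyl ∧ Y then b l else 1#)
        ⊠ (if möb ∧ Y then c l else 1#)
        ⊠ (if cyl ∧ Z then β l else 1#)
        ⊠ (if möb ∧ Z then γ l else 1#)

      sortWeight-cong : ∀ {cyl cyl′ möb möb′ Y Y′ Z Z′ l l′} → cyl ≡ cyl′ → möb ≡ möb′ → Y ≡ Y′ → Z ≡ Z′ → l ≡ l′ →
                        sortWeight cyl möb Y Z l ≡ sortWeight cyl′ möb′ Y′ Z′ l′
      sortWeight-cong refl refl refl refl refl = refl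

      cycleWeight : List (Edge n) → List (Edge n) → Carrier
      cycleWeight μ κ = sortWeight (does (cylindrical? σ κ)) (does (möbius? σ κ)) (does (sortY? μ κ)) (does (sortZ? μ κ)) (length κ)

      -- Each of the five families of exponents counts cycles by length, so `∏-count` turns it into
      -- a product over cycles; the four products over edge cycles then merge into one.
      weight≈ : ∀ μ → weight a b c β γ Cₙ σ μ ≈ ∏ (vertexCycles Cₙ σ) (a ∘ length) ⊠ ∏ (edgeCycles Cₙ σ) (cycleWeight μ)
      weight≈ μ = begin
        ∏ ks (λ k → a k ^K #vertexCycles Cₙ σ k ⊠ b k ^K cylY Cₙ σ μ k ⊠ c k ^K möbY Cₙ σ μ k
                    ⊠ β k ^K cylZ Cₙ σ μ k ⊠ γ k ^K möbZ Cₙ σ μ k)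
          ≈⟨ ≈-trans (∏-* ks _ _) (*-congʳ (≈-trans (∏-* ks _ _) (*-congʳ (≈-trans (∏-* ks _ _) (*-congʳ (∏-* ks _ _)))))) ⟩
        ∏ ks (λ k → a k ^K #vertexCycles Cₙ σ k) ⊠ ∏ ks (λ k → b k ^K cylY Cₙ σ μ k) ⊠ ∏ ks (λ k → c k ^K möbY Cₙ σ μ k)
          ⊠ ∏ ks (λ k → β k ^K cylZ Cₙ σ μ k) ⊠ ∏ ks (λ k → γ k ^K möbZ Cₙ σ μ k)
          ≈⟨ *-cong (*-cong (*-cong (*-cong
               (∏-count N a (λ k κ → length κ ℕₚ.≟ k) (λ _ → true) _ (λ k κ → sym (∧-identityʳ _)) length-vertexCycle)
               (∏-count N b _ (λ κ → does (cylindrical? σ κ) ∧ does (sortY? μ κ)) _ (λ k κ → refl) length-edgeCycle))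
               (∏-count N c _ (λ κ → does (möbius?      σ κ) ∧ does (sortY? μ κ)) _ (λ k κ → refl) length-edgeCycle))
               (∏-count N β _ (λ κ → does (cylindrical? σ κ) ∧ does (sortZ? μ κ)) _ (λ k κ → refl) length-edgeCycle))
               (∏-count N γ _ (λ κ → does (möbius?      σ κ) ∧ does (sortZ? μ κ)) _ (λ k κ → refl) length-edgeCycle) ⟩
        ∏ (vertexCycles Cₙ σ) (a ∘ length) ⊠ ∏ Es _ ⊠ ∏ Es _ ⊠ ∏ Es _ ⊠ ∏ Es _
          ≈⟨ reassoc _ _ _ _ _ ⟩
        ∏ (vertexCycles Cₙ σ) (a ∘ length) ⊠ (∏ Es _ ⊠ ∏ Es _ ⊠ ∏ Es _ ⊠ ∏ Es _)
          ≈⟨ *-congˡ (≈-sym (≈-trans (∏-* Es _ _) (*-congʳ (≈-trans (∏-* Es _ _) (*-congʳ (∏-* Es _ _)))))) ⟩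
        ∏ (vertexCycles Cₙ σ) (a ∘ length) ⊠ ∏ Es (cycleWeight μ) ∎
        where
        N : ℕ
        N = n ⊔ length E
        ks : List ℕ
        ks = map suc (upTo N)
        Es : List (List (Edge n))
        Es = edgeCycles Cₙ σ
        length-vertexCycle : ∀ {κ} → κ ∈ vertexCycles Cₙ σ → 1 ≤ length κ × length κ ≤ N
        length-vertexCycle κ∈ = let 1≤ , ≤n = V.length-cycle κ∈ in
          1≤ , ≤-trans ≤n (≤-trans (≤-reflexive (length-tabulate {n = n} id)) (ℕₚ.m≤m⊔n n _))
        length-edgeCycle : ∀ {κ} → κ ∈ Es → 1 ≤ length κ × length κ ≤ N
        length-edgeCycle κ∈ = let 1≤ , ≤E = length-cycle κ∈ in 1≤ , ≤-trans ≤E (ℕₚ.m≤n⊔m n _)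
        open import Algebra.Solver.Ring.NaturalCoefficients.Default commutativeSemiring using (solve; _:=_; _:*_)
        reassoc : ∀ x y z u w → x ⊠ y ⊠ z ⊠ u ⊠ w ≈ x ⊠ (y ⊠ z ⊠ u ⊠ w)
        reassoc = solve 5 (λ x y z u w → x :* y :* z :* u :* w := x :* (y :* z :* u :* w)) ≈-refl

      private
        e∈orbit : ∀ v → e v ∈ orbit (e v)
        e∈orbit v = orbit-e⁺ v 0

        -- The endpoints of an edge differ, so a power of `σ` cannot both fix and exchange them.
        -- This keeps a cycle from being counted under two variables.
        ¬both : ∀ v → Cylindrical σ (orbit (e v)) → Möbius σ (orbit (e v)) → ⊥
        ¬both v cyl möb = ℕₚ.<⇒≢ (⟪⟫-ordered (s≢ v ∘ sym))
          (cong toℕ (trans (sym (proj₁ (All.lookup cyl (e∈orbit v)))) (proj₁ (All.lookup möb (e∈orbit v)))))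

        member-e : ∀ S {v x} → x ∈ orbit (e v) → (x ∈ ⋃ S → T (at S (lab v))) × (T (at S (lab v)) → x ∈ ⋃ S)
        member-e S {v} x∈ = let i , eq = orbit-e⁻ x∈ in
            (λ x∈⋃ → subst (T ∘ at S) (lab-τ^ i v) (e∈⋃⁻ S (subst (_∈ ⋃ S) eq x∈⋃)))
          , (λ t → subst (_∈ ⋃ S) (sym eq) (e∈⋃⁺ S (subst (T ∘ at S) (sym (lab-τ^ i v)) t)))

        sorts : ∀ S v → (does (sortY? (⋃ S) (orbit (e v))) ≡ at S (lab v)) × (does (sortZ? (⋃ S) (orbit (e v))) ≡ not (at S (lab v)))
        sorts S v = go (at S (lab v)) refl
          where
          κ : List (Edge n)
          κ = orbit (e v)
          go : ∀ x → at S (lab v) ≡ x → (does (sortY? (⋃ S) κ) ≡ x) × (does (sortZ? (⋃ S) κ) ≡ not x)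
          go true eq =
              dec-true (sortY? (⋃ S) κ) (All.tabulate (λ x∈ → proj₂ (member-e S {v} x∈) (subst T (sym eq) tt)))
            , dec-false (sortZ? (⋃ S) κ) (λ ∉s → All.lookup ∉s (e∈orbit v) (e∈⋃⁺ S (subst T (sym eq) tt)))
          go false eq =
              dec-false (sortY? (⋃ S) κ) (λ ∈s → subst T eq (e∈⋃⁻ S (All.lookup ∈s (e∈orbit v))))
            , dec-true (sortZ? (⋃ S) κ) (All.tabulate (λ x∈ x∈⋃ → subst T eq (proj₁ (member-e S {v} x∈) x∈⋃)))

      cylindrical : ∀ v → (∀ w → (σ ^ period v) w ≡ w) → Cylindrical σ (orbit (e v))
      cylindrical v fix = All.tabulate (λ {x} _ → fixes (proj₁ x) , fixes (proj₂ x))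
        where
        fixes : ∀ w → (σ ^ length (orbit (e v))) w ≡ w
        fixes w = trans (cong (λ l → (σ ^ l) w) (length-orbit-e v)) (fix w)

      möbius : ∀ v → period v ≡ 1 → σ v ≡ s v → σ (s v) ≡ v → Möbius σ (orbit (e v))
      möbius v p≡1 σv σsv = All.tabulate (λ {x} x∈ → subst₂ Swaps (sym l≡1) (sym (x≡e x∈)) swaps)
        where
        Swaps : ℕ → Edge n → Set
        Swaps l x = ((σ ^ l) (proj₁ x) ≡ proj₂ x) × ((σ ^ l) (proj₂ x) ≡ proj₁ x)
        τv≡v : (τ ^ 1) v ≡ v
        τv≡v = trans (cong (λ l → (τ ^ l) v) (sym p≡1)) (τ^period v)
        l≡1 : length (orbit (e v)) ≡ 1
        l≡1 = trans (length-orbit-e v) p≡1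
        x≡e : ∀ {x} → x ∈ orbit (e v) → x ≡ e v
        x≡e x∈ = let i , eq = orbit-e⁻ x∈ in
          trans eq (cong e (trans (cong (λ k → (τ ^ k) v) (sym (ℕₚ.*-identityʳ i))) (^-period τ {1} τv≡v i)))
        swaps : Swaps 1 (e v)
        swaps with ⟪⟫-cases v (s v)
        ... | inj₁ eq = subst (Swaps 1) (sym eq) (σv , σsv)
        ... | inj₂ eq = subst (Swaps 1) (sym eq) (σsv , σv)

      cycleWeight≈ : ∀ S v → cycleWeight (⋃ S) (orbit (e v)) ≈ W (lab v) (at S (lab v))
      cycleWeight≈ S v with kinds v
      ... | inj₁ (fix , Y , Z) = ≈-trans
        (reflexive (sortWeight-cong (dec-true (cylindrical? σ (orbit (e v))) (cylindrical v fix))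
                                    (dec-false (möbius? σ (orbit (e v))) (¬both v (cylindrical v fix)))
                                    (proj₁ (sorts S v)) (proj₂ (sorts S v)) (length-orbit-e v)))
        (evaluate (at S (lab v)))
        where
        evaluate : ∀ x → sortWeight true false x (not x) (period v) ≈ W (lab v) x
        evaluate true  = ≈-trans (*-identityʳ _) (≈-trans (*-identityʳ _) (≈-trans (*-identityʳ _) (≈-sym Y)))
        evaluate false = ≈-trans (*-identityʳ _) (≈-trans (*-congʳ (*-identityˡ _)) (≈-trans (*-identityˡ _) (≈-sym Z)))
      ... | inj₂ (p≡1 , σv , σsv , Y , Z) = ≈-trans
        (reflexive (sortWeight-cong (dec-false (cylindrical? σ (orbit (e v))) (λ cyl → ¬both v cyl (möbius v p≡1 σv σsv)))
                                    (dec-true (möbius? σ (orbit (e v))) (möbius v p≡1 σv σsv))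
                                    (proj₁ (sorts S v)) (proj₂ (sorts S v)) (trans (length-orbit-e v) p≡1)))
        (evaluate (at S (lab v)))
        where
        evaluate : ∀ x → sortWeight false true x (not x) 1 ≈ W (lab v) x
        evaluate true  = ≈-trans (*-identityʳ _) (≈-trans (*-identityʳ _) (≈-trans (*-identityˡ _) (≈-sym Y)))
        evaluate false = ≈-trans (*-congʳ (≈-trans (*-identityʳ _) (*-identityˡ _))) (≈-trans (*-identityˡ _) (≈-sym Z))

      -- The vertex cycles contribute the same factor for every matching, and the edge factor
      -- depends on `S` label by label.
      ∑-fixedMatchings : ∑ (fixedMatchings Cₙ σ) (weight a b c β γ Cₙ σ)
        ≈ ∏ (upTo mᵥ) A ⊠ ∑ (filter (λ S → T? (C S)) (vectors bools m)) (setWeight W)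
      ∑-fixedMatchings = begin
        ∑ (fixedMatchings Cₙ σ) (weight a b c β γ Cₙ σ)
          ≈⟨ ∑-↭ _ fixedMatchings-↭ ⟩
        ∑ (map ⋃ sets) (weight a b c β γ Cₙ σ)
          ≡⟨ ∑-map ⋃ sets _ ⟩
        ∑ sets (weight a b c β γ Cₙ σ ∘ ⋃)
          ≈⟨ ∑-cong sets (λ {S} _ → ≈-trans (weight≈ (⋃ S)) (*-cong vertexPart (∏-cycles K (cycleWeight≈ S)))) ⟩
        ∑ sets (λ S → ∏ (upTo mᵥ) A ⊠ setWeight W S)
          ≈⟨ ≈-sym (∑-distribˡ _ sets (setWeight W)) ⟩
        ∏ (upTo mᵥ) A ⊠ ∑ sets (setWeight W) ∎
        where
        sets : List (Vec Bool m)
        sets = filter (λ S → T? (C S)) (vectors bools m)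
        vertexPart : ∏ (vertexCycles Cₙ σ) (a ∘ length) ≈ ∏ (upTo mᵥ) A
        vertexPart = V.∏-cycles K (λ v → ≈-trans (reflexive (cong a (V.length-orbit-e v))) (a≈A v))

  -- Rotations and matching polynomials

  T-∧⁺ : ∀ {x y} → T x → T y → T (x ∧ y)
  T-∧⁺ {true} _ ty = ty

  T-∧⁻ : ∀ {x y} → T (x ∧ y) → T x × T y
  T-∧⁻ {true} ty = tt , ty

  T-nand⁺ : ∀ {x y} → (T x → T y → ⊥) → T (not (x ∧ y))
  T-nand⁺ {false}        _ = tt
  T-nand⁺ {true} {false} _ = tt
  T-nand⁺ {true} {true}  f = f tt tt

  T-nand⁻ : ∀ {x y} → T (not (x ∧ y)) → T x → T y → ⊥
  T-nand⁻ {true} {true} ()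

  -- `chain` recurses along the vector, whereas `Admissible` walks around the cycle; conditions by
  -- position mediate between the two.
  record Links {k : ℕ} (p : Bool) (S : Vec Bool (suc k)) (q : Bool) : Set where
    field
      left   : T p → T (at S 0) → ⊥
      middle : ∀ j → j < k → T (at S j) → T (at S (suc j)) → ⊥
      right  : T (at S k) → T q → ⊥

  chain⇒links : ∀ {k} p (S : Vec Bool (suc k)) q → T (chain p S q) → Links p S q
  chain⇒links p (x ∷ []) q t = record
    { left   = T-nand⁻ (proj₁ (T-∧⁻ t))
    ; middle = λ _ ()
    ; right  = T-nand⁻ (proj₂ (T-∧⁻ {not (p ∧ x)} t))
    }
  chain⇒links p (x ∷ S@(_ ∷ _)) q t = record
    { left   = T-nand⁻ (proj₁ (T-∧⁻ t))
    ; middle = λ { zero _ → Links.left rest ; (suc j) (s≤s j<k) → Links.middle rest j j<k }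
    ; right  = Links.right rest
    }
    where
    rest : Links x S q
    rest = chain⇒links x S q (proj₂ (T-∧⁻ {not (p ∧ x)} t))

  links⇒chain : ∀ {k} p (S : Vec Bool (suc k)) q → Links p S q → T (chain p S q)
  links⇒chain p (x ∷ []) q l = T-∧⁺ (T-nand⁺ (Links.left l)) (T-nand⁺ (Links.right l))
  links⇒chain p (x ∷ S@(_ ∷ _)) q l = T-∧⁺ (T-nand⁺ (Links.left l)) (links⇒chain x S q (record
    { left   = Links.middle l 0 (s≤s z≤n)
    ; middle = λ j j<k → Links.middle l (suc j) (s≤s j<k)
    ; right  = Links.right l
    }))

  cyclicChain⇒links : ∀ {k} (S : Vec Bool (suc k)) → T (cyclicChain S) → Links false S (at S 0)
  cyclicChain⇒links (x ∷ S) = chain⇒links false (x ∷ S) x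

  links⇒cyclicChain : ∀ {k} (S : Vec Bool (suc k)) → Links false S (at S 0) → T (cyclicChain S)
  links⇒cyclicChain (x ∷ S) = links⇒chain false (x ∷ S) x

  module ResidueLabels (n : ℕ) (3≤n : 3 ≤ n) (k : ℕ) (d∣n : suc k ∣ n) where

    open CycleSums n 3≤n

    d : ℕ
    d = suc k

    residue : Fin n → ℕ
    residue v = toℕ v % d

    residue-q : ∀ i → residue (q i) ≡ i % d
    residue-q i = trans (cong (_% d) (toℕ-q i)) (m∣n⇒o%n%m≡o%m d n i d∣n)

    residue< : ∀ v → residue v < d
    residue< v = m%n<n (toℕ v) d

    residue-q-< : ∀ {j} → j < d → residue (q j) ≡ j
    residue-q-< {j} j<d = trans (residue-q j) (m<n⇒m%n≡m j<d)

    residue-s : ∀ v → residue (s v) ≡ suc (residue v) % d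
    residue-s v = trans (residue-q (suc (toℕ v))) (trans (%-distribˡ-+ 1 (toℕ v) d) (trans
      (cong (λ i → (1 % d + i) % d) (sym (m%n%n≡m%n (toℕ v) d))) (sym (%-distribˡ-+ 1 (residue v) d))))

    -- Around the cycle the residues rise from `0` to `k` and return to `0`. The return is the link
    -- between the last entry and the first.
    cyclic⇒admissible : ∀ (S : Vec Bool d) → T (cyclicChain S) → Admissible residue S
    cyclic⇒admissible S t v tv tsv with suc (residue v) ℕₚ.<? d
    ... | yes r+1<d = Links.middle l (residue v) (ℕₚ.≤-pred r+1<d) tv
                        (subst (T ∘ at S) (trans (residue-s v) (m<n⇒m%n≡m r+1<d)) tsv)
      where
      l : Links false S (at S 0)
      l = cyclicChain⇒links S t
    ... | no r+1≮d  = Links.right l (subst (T ∘ at S) (suc-injective r+1≡d) tv)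
                        (subst (T ∘ at S) (trans (residue-s v) (trans (cong (_% d) r+1≡d) (n%n≡0 d))) tsv)
      where
      l : Links false S (at S 0)
      l = cyclicChain⇒links S t
      r+1≡d : suc (residue v) ≡ d
      r+1≡d = ℕₚ.≤-antisym (residue< v) (ℕₚ.≮⇒≥ r+1≮d)

    admissible⇒cyclic : ∀ (S : Vec Bool d) → Admissible residue S → T (cyclicChain S)
    admissible⇒cyclic S adm = links⇒cyclicChain S (record
      { left   = λ ()
      ; middle = λ j j<k tj tsj → adm (q j)
          (subst (T ∘ at S) (sym (residue-q-< (ℕₚ.m<n⇒m<1+n j<k))) tj)
          (subst (T ∘ at S) (sym (trans (cong residue (s-q j)) (residue-q-< (s≤s j<k)))) tsj)
      ; right  = λ tk t0 → adm (q k)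
          (subst (T ∘ at S) (sym (residue-q-< (n<1+n k))) tk)
          (subst (T ∘ at S) (sym (trans (cong residue (s-q k)) (trans (residue-q d) (n%n≡0 d)))) t0)
      })

    module Rotation {l k′ : ℕ} .{{_ : NonZero l}} (ld≡n : l * d ≡ n) (d∣k′ : d ∣ k′) (i₀ : ℕ) (i₀k′ : q (i₀ * k′) ≡ q d)
                    {σ : Fin n → Fin n} (σ-rot : Rotates k′ σ) where

      open Endo (Fin n) using (_^_)

      residue-σ : ∀ v → residue (σ v) ≡ residue v
      residue-σ v = begin
        residue (σ v)                ≡⟨ cong residue (rotates-^ {k′} {σ} σ-rot 1 v) ⟩
        residue (q (toℕ v + 1 * k′)) ≡⟨ residue-q _ ⟩
        (toℕ v + 1 * k′) % d         ≡⟨ %-remove-+ʳ (toℕ v) (∣n⇒∣m*n 1 d∣k′) ⟩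
        toℕ v % d                    ∎
        where open ≡-Reasoning

      -- By the choice of `i₀`, a Bézout coefficient, `σ ^ i₀` is the rotation by `d`.
      σ^-multiple : ∀ x v → (σ ^ (x * i₀)) v ≡ q (toℕ v + x * d)
      σ^-multiple x v = trans (rotates-^ σ-rot (x * i₀) v)
        (q-+ {toℕ v} refl (trans (cong q (ℕₚ.*-assoc x i₀ k′)) (q-* x {i₀ * k′} {d} i₀k′)))

      reach : ∀ {v w} → residue v ≡ residue w → ∃[ i ] w ≡ (σ ^ i) v
      reach {v} {w} eq = x * i₀ , sym (trans (σ^-multiple x v) (trans (cong q sum) (trans (q-+*n (toℕ w) V) (q-toℕ w))))
        where
        V W x : ℕ
        V = toℕ v / d
        W = toℕ w / d
        -- This is `W - V` modulo `l`, with `V * pred l` in place of `-V`.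
        x = W + V * ℕ.pred l
        rearrange : ∀ r V W l d → (r + V * d) + (W + V * l) * d ≡ (r + W * d) + V * ((1 + l) * d)
        rearrange = solve-ℕ
        sum : toℕ v + x * d ≡ toℕ w + V * n
        sum = begin
          toℕ v + x * d                                  ≡⟨ cong (_+ x * d) (m≡m%n+[m/n]*n (toℕ v) d) ⟩
          (residue v + V * d) + x * d                    ≡⟨ rearrange (residue v) V W (ℕ.pred l) d ⟩
          (residue v + W * d) + V * (suc (ℕ.pred l) * d) ≡⟨ cong₂ (λ r l → (r + W * d) + V * (l * d)) eq (ℕₚ.suc-pred l) ⟩
          (residue w + W * d) + V * (l * d)              ≡⟨ cong₂ (λ a b → a + V * b) (sym (m≡m%n+[m/n]*n (toℕ w) d)) ld≡n ⟩
          toℕ w + V * n                                  ∎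
          where open ≡-Reasoning

      σ^l : ∀ v → (σ ^ l) v ≡ v
      σ^l v = trans (rotates-^ σ-rot l v) (trans (q-+ {toℕ v} {toℕ v} {l * k′} {0} refl (∣-q n∣lk′))
        (trans (cong q (ℕₚ.+-identityʳ (toℕ v))) (q-toℕ v)))
        where
        n∣lk′ : n ∣ l * k′
        n∣lk′ = subst (_∣ l * k′) ld≡n (*-monoʳ-∣ l d∣k′)

      -- Multiplication by `i₀` turns multiples of `k′` into multiples of `d`, and the numbers
      -- `i * d` with `i < l` are distinct and below `n`.
      σ^-injective : ∀ v {i j} → i < j → j < l → (σ ^ i) v ≢ (σ ^ j) v
      σ^-injective v {i} {j} i<j j<l eq = <⇒≢ i<j (ℕₚ.*-cancelʳ-≡ i j d
        (q-injective (id< (<-trans i<j j<l)) (id< j<l) (trans (sym (times i)) (trans (q-* i₀ {i * k′} {j * k′} ik≡jk) (times j)))))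
        where
        id< : ∀ {i} → i < l → i * d < n
        id< {i} i<l = subst (i * d <_) ld≡n (ℕₚ.*-monoˡ-< d i<l)
        ik≡jk : q (i * k′) ≡ q (j * k′)
        ik≡jk = q-cancelˡ (toℕ v) {i * k′} {j * k′} (trans (sym (rotates-^ σ-rot i v)) (trans eq (rotates-^ σ-rot j v)))
        rearrange : ∀ a b c → a * (b * c) ≡ b * (a * c)
        rearrange = solve-ℕ
        times : ∀ i → q (i₀ * (i * k′)) ≡ q (i * d)
        times i = trans (cong q (rearrange i₀ i k′)) (q-* i {i₀ * k′} {d} i₀k′)

      orbiting : Orbiting σ d
      orbiting = record
        { lab          = residue
        ; lab<         = residue<
        ; rep          = q
        ; labrep       = residue-q-<
        ; lab-τ        = residue-σ
        ; reach        = reach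
        ; period       = λ _ → l
        ; period≢0     = λ _ → ℕ.>-nonZero (ℕ.>-nonZero⁻¹ l)
        ; period≤n     = λ _ → ≤-trans (ℕₚ.m≤m*n l d) (≤-reflexive ld≡n)
        ; τ^period     = σ^l
        ; τ^-injective = σ^-injective
        }

  module MatchingPolynomials {c ℓ} (K : ℚ-Algebra c ℓ) where

    open ℚ-Algebra K renaming (refl to ≈-refl; sym to ≈-sym; trans to ≈-trans; setoid to ≈-setoid; _+_ to _⊞_; _*_ to _⊠_)
    open WalshSeries K hiding (W) renaming (T to Tₙ)
    open Sums K
    open import Relation.Binary.Reasoning.Setoid ≈-setoid
    open import Algebra.Solver.Ring.NaturalCoefficients.Default commutativeSemiring using (solve; _:=_; _:+_; _:*_; con)

    select : Carrier → Carrier → ℕ → Bool → Carrier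
    select y z _ x = if x then y else z

    ∏-labels : ∀ {xs : List A} {m lab} → Unique xs → Labelling xs m lab →
               (∀ {x y} → x ∈ xs → y ∈ xs → lab x ≡ lab y → x ≡ y) → ∀ (f : ℕ → Carrier) →
               ∏ xs (f ∘ lab) ≈ ∏ (upTo m) f
    ∏-labels {xs = xs} {m} {lab} xs! L inj f = ≈-trans (reflexive (sym (∏-map lab xs f))) (∏-↭ f
      (unique∧set⇒↭
        (map-unique xs! inj) (Uniqueₚ.upTo⁺ m)
        (λ j∈ → let x , x∈ , eq = ∈-map⁻ lab j∈ in subst (_∈ upTo m) (sym eq) (∈-upTo⁺ (Labelling.lab< L x∈)))
        (λ j∈ → subst (_∈ map lab xs) (Labelling.labrep L (∈-upTo⁻ j∈)) (∈-map⁺ lab (Labelling.rep∈ L (∈-upTo⁻ j∈))))))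

    -- The case of `unions-↭` with one edge in each class, where saturation is automatic. It gives
    -- the matching polynomials the same form as the sums over fixed matchings.
    matchingPolynomial : ∀ {n} (G : Graph n) {m} (lab : Edge n → ℕ) (G! : Unique (edges G)) (L : Labelling (edges G) m lab) →
      (∀ {x y} → x ∈ edges G → y ∈ edges G → lab x ≡ lab y → x ≡ y) →
      (C : Vec Bool m → Bool) →
      (∀ S → T (C S) → union _≟ᵉ_ G! lab L S ∈ matchings G) → (∀ S → union _≟ᵉ_ G! lab L S ∈ matchings G → T (C S)) →
      ∀ y z → M G y z ≈ ∑ (filter (λ S → T? (C S)) (vectors bools m)) (setWeight (select y z))
    matchingPolynomial G {m} lab G! L inj C C⇒ ⇒C y z = begin
      ∑ (matchings G) term
        ≈⟨ ∑-↭ term (unions-↭ _≟ᵉ_ G! lab L (Uniqueₚ.filter⁺ matching? (sublists-unique G!)) ⊆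
             (λ {μ} μ∈ {x} {y} x∈ y∈ eq → subst (_∈ μ) (inj (sublists-⊆ (edges G) (⊆ μ∈) x∈) y∈ eq) x∈)
             (λ S → T? (C S)) C⇒ ⇒C) ⟩
      ∑ (map ⋃ sets) term
        ≡⟨ ∑-map ⋃ sets term ⟩
      ∑ sets (term ∘ ⋃)
        ≈⟨ ∑-cong sets (λ {S} _ → ≈-trans (≈-sym (∏-if (λ x → T? (at S (lab x))) (edges G) y z))
                                          (∏-labels G! L inj (λ j → if at S j then y else z))) ⟩
      ∑ sets (setWeight (select y z)) ∎
      where
      term : List (Edge _) → Carrier
      term μ = y ^ length μ ⊠ z ^ (length (edges G) ∸ length μ)
      ⋃ : Vec Bool m → List (Edge _)
      ⋃ = union _≟ᵉ_ G! lab L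
      sets : List (Vec Bool m)
      sets = filter (λ S → T? (C S)) (vectors bools m)
      ⊆ : ∀ {μ} → μ ∈ matchings G → μ ∈ sublists (edges G)
      ⊆ = proj₁ ∘ ∈-filter⁻ matching? {xs = sublists (edges G)}

    module _ (y z : Carrier) where

      W : ℕ → Bool → Carrier
      W = select y z

      -- Residues modulo the full number of vertices number the edges one by one, so the criterion
      -- for unions of orbits under rotations applies to plain edge sets.
      M-cycle : ∀ n (3≤n : 3 ≤ suc n) → M (cycleGraph (suc n) 3≤n) y z ≈ y ⊠ R true n true W ⊞ z ⊠ R false n false W
      M-cycle n 3≤n = ≈-trans
        (matchingPolynomial Cₙ (residue ∘ origin) E-unique L
          (λ {x} {y} x∈ y∈ eq → trans (E⇒e x∈) (trans (cong e (toℕ-injective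
            (trans (sym (m<n⇒m%n≡m (toℕ<n (origin x)))) (trans eq (m<n⇒m%n≡m (toℕ<n (origin y))))))) (sym (E⇒e y∈))))
          cyclicChain
          (λ S t → admissible⇒matching S (cyclic⇒admissible S t))
          (λ S M∈ → admissible⇒cyclic S (matching⇒admissible S M∈)) y z)
        (∑-cyclicChain n W)
        where
        open CycleSums (suc n) 3≤n
        open ResidueLabels (suc n) 3≤n n ∣-refl
        L : Labelling E (suc n) (residue ∘ origin)
        L = EdgeTransport.labelling q residue< residue-q-<
        open Unions residue L

      -- The conventions for `T 1` and `T 2` are the values of the cyclic transfer sum in lengths
      -- one and two, so rotations need no distinction between small and large `d`.
      T≈R : ∀ n → Tₙ (suc n) y z ≈ y ⊠ R true n true W ⊞ z ⊠ R false n false W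
      T≈R zero          = solve 2 (λ y z → z := y :* con 0 :+ z :* con 1) ≈-refl y z
      T≈R (suc zero)    = solve 2 (λ y z → (y :* z :+ (y :* z :+ con 0)) :+ z :* (z :* con 1)
                                         := y :* (z :* con 1) :+ z :* (y :* con 1 :+ z :* con 1)) ≈-refl y z
      T≈R (suc (suc n)) = M-cycle (suc (suc n)) (s≤s (s≤s (s≤s z≤n)))

      module Path (k : ℕ) where

        open Residues (suc k)

        G : Graph (suc k)
        G = pathGraph (suc k)

        first : Edge (suc k) → ℕ
        first (i , j) = toℕ i

        isEdge? : Unary.Decidable (λ ((i , j) : Edge (suc k)) → (toℕ i < toℕ j) × (Graph._~_ G i j))
        isEdge? (i , j) = (i <? j) ×-dec (Graph._~?_ G i j)

        edge⁻ : ∀ {i j} → (i , j) ∈ edges G → suc (toℕ i) ≡ toℕ j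
        edge⁻ x∈ with proj₂ (∈-filter⁻ isEdge? {xs = cartesianProduct (allFin (suc k)) (allFin (suc k))} x∈)
        ... | _   , inj₁ i+1≡j = i+1≡j
        ... | i<j , inj₂ j+1≡i = contradiction (≤-trans (≤-reflexive j+1≡i) (<⇒≤ i<j)) ℕₚ.1+n≰n

        edge⁺ : ∀ {i j} → suc (toℕ i) ≡ toℕ j → (i , j) ∈ edges G
        edge⁺ i+1≡j = ∈-filter⁺ isEdge? (∈-cartesianProduct⁺ (∈-allFin _) (∈-allFin _)) (≤-reflexive i+1≡j , inj₁ i+1≡j)

        G! : Unique (edges G)
        G! = Uniqueₚ.filter⁺ isEdge? (Uniqueₚ.cartesianProduct⁺ (Uniqueₚ.allFin⁺ (suc k)) (Uniqueₚ.allFin⁺ (suc k)))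

        rep : ℕ → Edge (suc k)
        rep j = q j , q (suc j)

        rep∈ : ∀ {j} → j < k → rep j ∈ edges G
        rep∈ j<k = edge⁺ (trans (cong suc (toℕ-q-< (ℕₚ.m<n⇒m<1+n j<k))) (sym (toℕ-q-< (s≤s j<k))))

        first-rep : ∀ {j} → j < k → first (rep j) ≡ j
        first-rep j<k = toℕ-q-< (ℕₚ.m<n⇒m<1+n j<k)

        first-injective : ∀ {x y} → x ∈ edges G → y ∈ edges G → first x ≡ first y → x ≡ y
        first-injective x∈ y∈ eq = cong₂ _,_ (toℕ-injective eq)
          (toℕ-injective (trans (sym (edge⁻ x∈)) (trans (cong suc eq) (edge⁻ y∈))))

        L : Labelling (edges G) k first
        L = record
          { lab<   = λ { {i , j} x∈ → ℕₚ.≤-pred (≤-trans (≤-reflexive (cong suc (edge⁻ x∈))) (toℕ<n j)) }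
          ; rep    = rep
          ; rep∈   = rep∈
          ; labrep = first-rep
          }

        ⋃ : Vec Bool k → List (Edge (suc k))
        ⋃ = union _≟ᵉ_ G! first L

        Unlinked : Vec Bool k → Set
        Unlinked S = ∀ j → suc j < k → T (at S j) → T (at S (suc j)) → ⊥

        disjoint⁺ : ∀ {x y} → x ∈ edges G → y ∈ edges G → x ≢ y →
                    suc (first x) ≢ first y → suc (first y) ≢ first x → Disjoint x y
        disjoint⁺ {i , j} {i′ , j′} x∈ y∈ x≢y ¬xy ¬yx =
            (λ i≡i′ → x≢y (first-injective x∈ y∈ (cong toℕ i≡i′)))
          , (λ i≡j′ → ¬yx (trans (edge⁻ y∈) (cong toℕ (sym i≡j′))))
          , (λ j≡i′ → ¬xy (trans (edge⁻ x∈) (cong toℕ j≡i′)))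
          , (λ j≡j′ → x≢y (first-injective x∈ y∈ (suc-injective (trans (edge⁻ x∈) (trans (cong toℕ j≡j′) (sym (edge⁻ y∈)))))))

        unlinked⇒matching : ∀ S → Unlinked S → ⋃ S ∈ matchings G
        unlinked⇒matching S unl = ∈-filter⁺ matching? (filter∈sublists (λ x → T? (at S (first x))) (edges G))
          (allPairs⁺ (Uniqueₚ.filter⁺ (λ x → T? (at S (first x))) G!) disjoint)
          where
          ⋃⁻ : ∀ {x} → x ∈ ⋃ S → x ∈ edges G × T (at S (first x))
          ⋃⁻ = ∈-union⁻ _≟ᵉ_ G! first L S

          ¬linked : ∀ {x y} → x ∈ ⋃ S → y ∈ ⋃ S → suc (first x) ≢ first y
          ¬linked {x} x∈ y∈ eq = unl (first x)
            (subst (_< k) (sym eq) (Labelling.lab< L (proj₁ (⋃⁻ y∈)))) (proj₂ (⋃⁻ x∈))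
            (subst (T ∘ at S) (sym eq) (proj₂ (⋃⁻ y∈)))

          disjoint : ∀ {x y} → x ∈ ⋃ S → y ∈ ⋃ S → x ≢ y → Disjoint x y
          disjoint x∈ y∈ x≢y = disjoint⁺ (proj₁ (⋃⁻ x∈)) (proj₁ (⋃⁻ y∈)) x≢y (¬linked x∈ y∈) (¬linked y∈ x∈)

        matching⇒unlinked : ∀ S → ⋃ S ∈ matchings G → Unlinked S
        matching⇒unlinked S M∈ j j+1<k tj tsj = proj₁ (proj₂ (proj₂
          (allPairs⁻ Disjoint-sym (proj₂ (∈-filter⁻ matching? {xs = sublists (edges G)} M∈)) (rep∈⋃ (<⇒≤ j+1<k) tj) (rep∈⋃ j+1<k tsj)
            (λ eq → ℕₚ.1+n≢n (trans (sym (first-rep j+1<k)) (trans (cong first (sym eq)) (first-rep (<⇒≤ j+1<k)))))))) refl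
          where
          rep∈⋃ : ∀ {j} → j < k → T (at S j) → rep j ∈ ⋃ S
          rep∈⋃ j<k t = ∈-union⁺ _≟ᵉ_ G! first L S (rep∈ j<k) (subst (T ∘ at S) (sym (first-rep j<k)) t)

      linear⇒unlinked : ∀ {k} (S : Vec Bool k) → T (chain false S false) → ∀ j → suc j < k → T (at S j) → T (at S (suc j)) → ⊥
      linear⇒unlinked S@(_ ∷ _) t j (s≤s j<k) = Links.middle (chain⇒links false S false t) j j<k

      unlinked⇒linear : ∀ {k} (S : Vec Bool k) → (∀ j → suc j < k → T (at S j) → T (at S (suc j)) → ⊥) → T (chain false S false)
      unlinked⇒linear []        unl = tt
      unlinked⇒linear S@(_ ∷ _) unl = links⇒chain false S false
        (record { left = λ () ; middle = λ j j<k → unl j (s≤s j<k) ; right = λ _ () })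

      -- The shift by one arises because `k` labels are the edges of a path with `k + 1` vertices.
      M-path : ∀ k → M (pathGraph (suc k)) y z ≈ R false k false W
      M-path k = ≈-trans
        (matchingPolynomial G first G! L first-injective (λ S → chain false S false)
          (λ S t → unlinked⇒matching S (linear⇒unlinked S t))
          (λ S M∈ → unlinked⇒linear S (matching⇒unlinked S M∈)) y z)
        (∑-chain false k false W)
        where open Path k

      module _ (z⁻¹ : Invertible _≈_ 1# _⊠_ z) where

        R-FF : ∀ k → R false k false W ≈ U (suc k) y z z⁻¹
        R-FF k = ≈-sym (M-path k)

        -- The last entry is forced to be `false` and costs a factor `z`. For `k = 0` there is no
        -- entry to pay it, and the value 1 is `z * U₀`.
        R-FT≈zU : ∀ k → R false k true W ≈ z ⊠ U k y z z⁻¹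
        R-FT≈zU zero    = ≈-sym (proj₂ (proj₂ z⁻¹))
        R-FT≈zU (suc k) = ≈-trans (R-FT k (W 0)) (*-congˡ (R-FF k))

        R-TF≈zU : ∀ k → R true k false W ≈ z ⊠ U k y z z⁻¹
        R-TF≈zU zero    = ≈-sym (proj₂ (proj₂ z⁻¹))
        R-TF≈zU (suc k) = *-congˡ (R-FF k)

        -- For `k = 0` both ends forbid the same single entry; its one factor `z` is `z ^ 2 * U₀`.
        R-TT≈z²U : ∀ k → R true (suc k) true W ≈ z ^ 2 ⊠ U k y z z⁻¹
        R-TT≈z²U k = ≈-trans (*-congˡ (R-FT≈zU k))
          (solve 2 (λ z u → z :* (z :* u) := (z :* (z :* con 1)) :* u) ≈-refl z (U k y z z⁻¹))

  -- Reflections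

  module Reflections (n : ℕ) (3≤n : 3 ≤ n) where

    open CycleSums n 3≤n
    open Endo (Fin n) using (_^_)

    -- An involution that acts on the indices r of the vertices u + r as a map F folding [0, n) onto [0, m).
    record Folds (u m : ℕ) (F : ℕ → ℕ) (τ : Fin n → Fin n) : Set where
      field
        u≤n  : u ≤ n
        m≤n  : m ≤ n
        F<   : ∀ {r} → r < n → F r < n
        FF   : ∀ {r} → r < n → F (F r) ≡ r
        low  : ∀ {r} → r < m → r ≤ F r
        high : ∀ {r} → m ≤ r → r < n → F r < m
        τ-F  : ∀ {r} → r < n → τ (q (u + r)) ≡ q (u + F r)

    fixedOr : ∀ {ℓ} {X : Set ℓ} → (ℕ → ℕ) → X → X → ℕ → X
    fixedOr F x y j = if does (F j ℕₚ.≟ j) then x else y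

    fixedOr-fixed : ∀ {ℓ} {X : Set ℓ} {F : ℕ → ℕ} {x y : X} {j} → F j ≡ j → fixedOr F x y j ≡ x
    fixedOr-fixed {F = F} {x} {y} {j} eq = cong (λ b → if b then x else y) (dec-true (F j ℕₚ.≟ j) eq)

    fixedOr-moved : ∀ {ℓ} {X : Set ℓ} {F : ℕ → ℕ} {x y : X} {j} → F j ≢ j → fixedOr F x y j ≡ y
    fixedOr-moved {F = F} {x} {y} {j} eq = cong (λ b → if b then x else y) (dec-false (F j ℕₚ.≟ j) eq)

    module Folding {u m : ℕ} {F : ℕ → ℕ} {τ : Fin n → Fin n} (fold : Folds u m F τ) where

      open Folds fold

      -- The position of `v` counted from `u`, with `n ∸ u` in place of `-u`.
      index : Fin n → ℕ
      index v = toℕ (q (toℕ v + (n ∸ u)))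

      index< : ∀ v → index v < n
      index< v = toℕ<n (q (toℕ v + (n ∸ u)))

      q-index : ∀ v → q (u + index v) ≡ v
      q-index v = begin
        q (u + index v)              ≡⟨ q-+ {u} {u} {index v} refl (q-toℕ (q (toℕ v + (n ∸ u)))) ⟩
        q (u + (toℕ v + (n ∸ u)))    ≡⟨ cong q (rearrange u (toℕ v) (n ∸ u)) ⟩
        q (toℕ v + (u + (n ∸ u)))    ≡⟨ cong (λ i → q (toℕ v + i)) (m+[n∸m]≡n u≤n) ⟩
        q (toℕ v + n)                ≡⟨ q-+n (toℕ v) ⟩
        q (toℕ v)                    ≡⟨ q-toℕ v ⟩
        v                            ∎
        where
        open ≡-Reasoning
        rearrange : ∀ a b c → a + (b + c) ≡ b + (a + c)
        rearrange = solve-ℕ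

      index-q : ∀ {r} → r < n → index (q (u + r)) ≡ r
      index-q {r} r<n = q-injective (index< (q (u + r))) r<n (q-cancelˡ u {index (q (u + r))} {r} (q-index (q (u + r))))

      index-τ : ∀ v → index (τ v) ≡ F (index v)
      index-τ v = trans (cong index (trans (cong τ (sym (q-index v))) (τ-F (index< v)))) (index-q (F< (index< v)))

      index-s : ∀ v → suc (index v) < n → index (s v) ≡ suc (index v)
      index-s v r+1<n = trans (cong index (trans (cong s (sym (q-index v)))
        (trans (s-q (u + index v)) (cong q (sym (ℕₚ.+-suc u (index v))))))) (index-q r+1<n)

      index-s-last : ∀ v → suc (index v) ≡ n → index (s v) ≡ 0
      index-s-last v r+1≡n = trans (cong index (begin
        s v                         ≡⟨ cong s (sym (q-index v)) ⟩
        s (q (u + index v))         ≡⟨ s-q (u + index v) ⟩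
        q (suc (u + index v))       ≡⟨ cong q (sym (ℕₚ.+-suc u (index v))) ⟩
        q (u + suc (index v))       ≡⟨ cong (λ i → q (u + i)) r+1≡n ⟩
        q (u + n)                   ≡⟨ trans (q-+n u) (cong q (sym (ℕₚ.+-identityʳ u))) ⟩
        q (u + 0)                   ∎)) (index-q (ℕ.>-nonZero⁻¹ n))
        where open ≡-Reasoning

      -- The symmetry of `⊓` makes the label invariant under the involution; by `low` and `high` the
      -- minimum is the representative below `m`.
      lab : Fin n → ℕ
      lab v = index v ⊓ F (index v)

      fold-low : ∀ {r} → r < m → r ⊓ F r ≡ r
      fold-low r<m = ℕₚ.m≤n⇒m⊓n≡m (low r<m)

      fold-high : ∀ {r} → m ≤ r → r < n → r ⊓ F r ≡ F r
      fold-high m≤r r<n = ℕₚ.m≥n⇒m⊓n≡n (≤-trans (<⇒≤ (high m≤r r<n)) m≤r)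

      lab-low : ∀ {v} → index v < m → lab v ≡ index v
      lab-low = fold-low

      lab-high : ∀ {v} → m ≤ index v → lab v ≡ F (index v)
      lab-high {v} m≤r = fold-high m≤r (index< v)

      lab-cases : ∀ v → (lab v ≡ index v) ⊎ (lab v ≡ F (index v))
      lab-cases v = ℕₚ.⊓-sel (index v) (F (index v))

      lab< : ∀ v → lab v < m
      lab< v with index v ℕₚ.<? m
      ... | yes r<m = subst (_< m) (sym (lab-low r<m)) r<m
      ... | no r≮m  = subst (_< m) (sym (lab-high (ℕₚ.≮⇒≥ r≮m))) (high (ℕₚ.≮⇒≥ r≮m) (index< v))

      lab-q : ∀ {r} → r < n → lab (q (u + r)) ≡ r ⊓ F r
      lab-q r<n = cong (λ r → r ⊓ F r) (index-q r<n)

      lab-rep : ∀ {j} → j < m → lab (q (u + j)) ≡ j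
      lab-rep j<m = trans (lab-q (ℕₚ.<-≤-trans j<m m≤n)) (fold-low j<m)

      lab-τ : ∀ v → lab (τ v) ≡ lab v
      lab-τ v = begin
        index (τ v) ⊓ F (index (τ v))          ≡⟨ cong (λ r → r ⊓ F r) (index-τ v) ⟩
        F (index v) ⊓ F (F (index v))          ≡⟨ cong (F (index v) ⊓_) (FF (index< v)) ⟩
        F (index v) ⊓ index v                  ≡⟨ ℕₚ.⊓-comm (F (index v)) (index v) ⟩
        index v ⊓ F (index v)                  ∎
        where open ≡-Reasoning

      index-injective : ∀ {v w} → index v ≡ index w → v ≡ w
      index-injective {v} {w} eq = trans (sym (q-index v)) (trans (cong (λ i → q (u + i)) eq) (q-index w))

      F-injective : ∀ {r r′} → r < n → r′ < n → F r ≡ F r′ → r ≡ r′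
      F-injective r<n r′<n eq = trans (sym (FF r<n)) (trans (cong F eq) (FF r′<n))

      reach : ∀ {v w} → lab v ≡ lab w → ∃[ i ] w ≡ (τ ^ i) v
      reach {v} {w} eq with lab-cases v | lab-cases w
      ... | inj₁ ev | inj₁ ew = 0 , index-injective (trans (sym ew) (trans (sym eq) ev))
      ... | inj₂ ev | inj₁ ew = 1 , index-injective (trans (sym ew) (trans (sym eq) (trans ev (sym (index-τ v)))))
      ... | inj₂ ev | inj₂ ew = 0 , index-injective (F-injective (index< w) (index< v) (trans (sym ew) (trans (sym eq) ev)))
      ... | inj₁ ev | inj₂ ew = 1 , index-injective (F-injective (index< w) (index< (τ v))
        (trans (sym ew) (trans (sym eq) (trans ev (trans (sym (FF (index< v))) (cong F (sym (index-τ v))))))))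

      τ-involutive : ∀ v → τ (τ v) ≡ v
      τ-involutive v = index-injective (trans (index-τ (τ v)) (trans (cong F (index-τ v)) (FF (index< v))))

      fixed-lab : ∀ v → F (index v) ≡ index v → F (lab v) ≡ lab v
      fixed-lab v eq = subst (λ r → F r ≡ r) (sym (trans (cong (index v ⊓_) eq) (ℕₚ.⊓-idem (index v)))) eq

      lab-fixed : ∀ v → F (lab v) ≡ lab v → F (index v) ≡ index v
      lab-fixed v eq with lab-cases v
      ... | inj₁ ev = subst (λ r → F r ≡ r) ev eq
      ... | inj₂ ev = sym (trans (sym (FF (index< v))) (subst (λ r → F r ≡ r) ev eq))

      fixed⇒τ : ∀ v → F (lab v) ≡ lab v → τ v ≡ v
      fixed⇒τ v eq = index-injective (trans (index-τ v) (lab-fixed v eq))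

      τ⇒fixed : ∀ v → τ v ≡ v → F (lab v) ≡ lab v
      τ⇒fixed v eq = fixed-lab v (trans (sym (index-τ v)) (cong index eq))

      size : ℕ → ℕ
      size = fixedOr F 1 2

      orbiting : Orbiting τ m
      orbiting = record
        { lab          = lab
        ; lab<         = lab<
        ; rep          = λ j → q (u + j)
        ; labrep       = lab-rep
        ; lab-τ        = lab-τ
        ; reach        = reach
        ; period       = size ∘ lab
        ; period≢0     = λ v → period≢0 (lab v)
        ; period≤n     = λ v → period≤n (lab v)
        ; τ^period     = τ^period
        ; τ^-injective = τ^-injective
        }
        where
        period≢0 : ∀ j → NonZero (size j)
        period≢0 j with does (F j ℕₚ.≟ j)
        ... | true  = _
        ... | false = _
        period≤n : ∀ j → size j ≤ n
        period≤n j with does (F j ℕₚ.≟ j)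
        ... | true  = ≤-trans (s≤s z≤n) 3≤n
        ... | false = ≤-trans (s≤s (s≤s z≤n)) 3≤n
        τ^period : ∀ v → (τ ^ size (lab v)) v ≡ v
        τ^period v with F (lab v) ℕₚ.≟ lab v
        ... | yes eq = trans (cong (λ l → (τ ^ l) v) (fixedOr-fixed {F = F} eq)) (fixed⇒τ v eq)
        ... | no neq = trans (cong (λ l → (τ ^ l) v) (fixedOr-moved {F = F} neq)) (τ-involutive v)
        τ^-injective : ∀ v {i j} → i < j → j < size (lab v) → (τ ^ i) v ≢ (τ ^ j) v
        τ^-injective v {i} {j} i<j j<p with F (lab v) ℕₚ.≟ lab v
        ... | yes eq = contradiction (ℕₚ.<-≤-trans (ℕₚ.≤-<-trans z≤n i<j)
                         (ℕₚ.≤-pred (subst (j <_) (fixedOr-fixed {F = F} eq) j<p))) (<-irrefl refl)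
        ... | no neq = distinct i<j (subst (j <_) (fixedOr-moved {F = F} neq) j<p)
          where
          distinct : ∀ {i j} → i < j → j < 2 → (τ ^ i) v ≢ (τ ^ j) v
          distinct {zero} {suc zero} _ _ eq = neq (τ⇒fixed v (sym eq))
          distinct {_} {suc (suc _)} _ (s≤s (s≤s ()))
          distinct {suc _} {suc zero} (s≤s ())

    -- r ↦ -r, which fixes 0, and also n/2 if n is even.
    negate : ℕ → ℕ
    negate zero    = 0
    negate (suc r) = n ∸ suc r

    -- r ↦ -1-r, which fixes (n-1)/2 if n is odd.
    complement : ℕ → ℕ
    complement r = n ∸ suc r

    -- The conditions on h say that h = ⌊n/2⌋.
    negate-fold : ∀ {u h t τ} → h + h ≤ n → n ≤ suc (h + h) → u ≤ n → q t ≡ q (u + u) → Reflects t τ →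
                  Folds u (suc h) negate τ
    negate-fold {u} {h} {t} {τ} 2h≤n n≤2h+1 u≤n t≡2u τ-refl = record
      { u≤n = u≤n ; m≤n = h<n ; F< = F< ; FF = FF ; low = low ; high = high ; τ-F = τ-F }
      where
      h<n : h < n
      h<n = below h 2h≤n
        where
        below : ∀ h → h + h ≤ n → h < n
        below zero    _  = ≤-trans (s≤s z≤n) 3≤n
        below (suc h) le = ≤-trans (s≤s (ℕₚ.m≤n+m (suc h) h)) le
      F< : ∀ {r} → r < n → negate r < n
      F< {zero}  0<n = 0<n
      F< {suc r} r<n = ℕₚ.∸-monoʳ-< {n} {suc r} {0} (s≤s z≤n) (<⇒≤ r<n)
      FF : ∀ {r} → r < n → negate (negate r) ≡ r
      FF {zero}  _   = refl
      FF {suc r} r<n with n ∸ suc r in eq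
      ... | zero  = contradiction (ℕₚ.m∸n≡0⇒m≤n eq) (ℕₚ.<⇒≱ r<n)
      ... | suc i = trans (cong (n ∸_) (sym eq)) (ℕₚ.m∸[m∸n]≡n (<⇒≤ r<n))
      low : ∀ {r} → r < suc h → r ≤ negate r
      low {zero}  _       = z≤n
      low {suc r} (s≤s r<h) = ℕₚ.m+n≤o⇒m≤o∸n (suc r) (≤-trans (ℕₚ.+-mono-≤ r<h r<h) 2h≤n)
      high : ∀ {r} → suc h ≤ r → r < n → negate r < suc h
      high {suc r} (s≤s h≤r) _ = s≤s (ℕₚ.m≤n+o⇒m∸n≤o n (suc r) (≤-trans n≤2h+1 (s≤s (ℕₚ.+-monoˡ-≤ h h≤r))))
      sum : ∀ u r r′ → (u + r) + (u + r′) ≡ (u + u) + (r + r′)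
      sum = solve-ℕ
      τ-F : ∀ {r} → r < n → τ (q (u + r)) ≡ q (u + negate r)
      τ-F {zero}  _   = τ-refl (u + 0) (u + 0) (trans (cong q (trans (sum u 0 0) (ℕₚ.+-identityʳ (u + u)))) (sym t≡2u))
      τ-F {suc r} r<n = τ-refl (u + suc r) (u + (n ∸ suc r)) (trans (cong q (trans (sum u (suc r) (n ∸ suc r))
        (cong (u + u +_) (m+[n∸m]≡n (<⇒≤ r<n))))) (trans (q-+n (u + u)) (sym t≡2u)))

    -- The conditions on m say that m = ⌈n/2⌉.
    complement-fold : ∀ {u m t τ} → m + m ≤ suc n → n ≤ m + m → u ≤ n → q (suc t) ≡ q (u + u) → Reflects t τ →
                      Folds u m complement τ
    complement-fold {u} {m} {t} {τ} 2m≤n+1 n≤2m u≤n t+1≡2u τ-refl = record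
      { u≤n = u≤n ; m≤n = m≤n ; F< = F< ; FF = FF ; low = low ; high = high ; τ-F = τ-F }
      where
      m≤n : m ≤ n
      m≤n = below m 2m≤n+1
        where
        below : ∀ m → m + m ≤ suc n → m ≤ n
        below zero    _  = z≤n
        below (suc m) le = ≤-trans (s≤s (ℕₚ.m≤m+n m m)) (ℕₚ.≤-pred (subst (_≤ suc n) (cong suc (ℕₚ.+-suc m m)) le))
      F< : ∀ {r} → r < n → complement r < n
      F< {r} r<n = ℕₚ.∸-monoʳ-< {n} {suc r} {0} (s≤s z≤n) r<n
      FF : ∀ {r} → r < n → complement (complement r) ≡ r
      FF {r} r<n = suc-injective (begin
        suc (n ∸ suc (n ∸ suc r)) ≡⟨ sym (ℕₚ.+-∸-assoc 1 (F< r<n)) ⟩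
        n ∸ (n ∸ suc r)           ≡⟨ ℕₚ.m∸[m∸n]≡n r<n ⟩
        suc r                     ∎)
        where open ≡-Reasoning
      low : ∀ {r} → r < m → r ≤ complement r
      low {r} r<m = ℕₚ.m+n≤o⇒m≤o∸n r (ℕₚ.≤-pred (≤-trans (ℕₚ.+-mono-≤ r<m r<m) 2m≤n+1))
      high : ∀ {r} → m ≤ r → r < n → complement r < m
      high {r} m≤r r<n = ℕₚ.<-≤-trans (ℕₚ.∸-monoʳ-< (s≤s m≤r) r<n) (ℕₚ.m≤n+o⇒m∸n≤o n m n≤2m)
      sum : ∀ u r r′ → suc ((u + r) + (u + r′)) ≡ (u + u) + (suc r + r′)
      sum = solve-ℕ
      τ-F : ∀ {r} → r < n → τ (q (u + r)) ≡ q (u + complement r)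
      τ-F {r} r<n = τ-refl (u + r) (u + (n ∸ suc r)) (q-cancelˡ 1 {(u + r) + (u + (n ∸ suc r))} {t} (trans
        (cong q (trans (sum u r (n ∸ suc r)) (cong (u + u +_) (m+[n∸m]≡n r<n))))
        (trans (q-+n (u + u)) (sym t+1≡2u))))

    module _ {u k : ℕ} {τ : Fin n → Fin n} (fold : Folds u (suc k) negate τ) (k<n : suc k < n) where

      open Folding fold

      private
        -- From index `k` on the labels descend. When the walk returns to index 0, the truncated
        -- difference `n ∸ n` is still the right label.
        index-s-negate : ∀ v → k ≤ index v → lab (s v) ≡ n ∸ suc (index v)
        index-s-negate v k≤r with suc (index v) ℕₚ.<? n
        ... | yes r+1<n = trans (cong (λ r → r ⊓ negate r) (index-s v r+1<n)) (fold-high (s≤s k≤r) r+1<n)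
        ... | no r+1≮n  = trans (cong (λ r → r ⊓ negate r) (index-s-last v r+1≡n)) (sym (trans (cong (n ∸_) r+1≡n) (ℕₚ.n∸n≡0 n)))
          where
          r+1≡n : suc (index v) ≡ n
          r+1≡n = ℕₚ.≤-antisym (index< v) (ℕₚ.≮⇒≥ r+1≮n)

        s-rep : ∀ j → s (q (u + j)) ≡ q (u + suc j)
        s-rep j = trans (s-q (u + j)) (cong q (sym (ℕₚ.+-suc u j)))

      -- The two edges e_k and e_{k+1} have the same label k if n = 2k+1, and otherwise n = 2k.
      negate-links : ∀ b (S : Vec Bool (suc k)) → (n ∸ suc k ≡ (if b then k else ℕ.pred k)) → (T (not b) → 0 < k) →
                     Links false S b → Admissible lab S
      negate-links b S turn k>0 l v tv tsv with ℕₚ.<-cmp (index v) k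
      ... | tri< r<k _ _ = Links.middle l (index v) r<k
              (subst (T ∘ at S) (lab-low (ℕₚ.m<n⇒m<1+n r<k)) tv)
              (subst (T ∘ at S) (trans (cong (λ r → r ⊓ negate r) (index-s v r+1<n)) (fold-low (s≤s r<k))) tsv)
        where
        r+1<n : suc (index v) < n
        r+1<n = ≤-trans (s≤s (s≤s (<⇒≤ r<k))) k<n
      -- At the turn: for `b = true` the label `k` repeats and `right` forbids it. For `b = false`
      -- the next label is `k - 1`, so a `middle` link is read backwards.
      ... | tri≈ _ r≡k _ = atTurn b turn k>0 l
              (subst (T ∘ at S) (trans (lab-low (subst (_< suc k) (sym r≡k) (n<1+n k))) r≡k) tv)
              (subst (T ∘ at S) (trans (index-s-negate v (≤-reflexive (sym r≡k))) (cong (λ r → n ∸ suc r) r≡k)) tsv)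
        where
        before : ∀ {k} (S : Vec Bool (suc k)) → 0 < k → Links false S false → T (at S k) → T (at S (ℕ.pred k)) → ⊥
        before {suc k} S _ l tk tk′ = Links.middle l k (n<1+n k) tk′ tk
        atTurn : ∀ b → n ∸ suc k ≡ (if b then k else ℕ.pred k) → (T (not b) → 0 < k) → Links false S b →
                 T (at S k) → T (at S (n ∸ suc k)) → ⊥
        atTurn true  _    _   l tk _  = Links.right l tk tt
        atTurn false turn k>0 l tk t′ = before S (k>0 tt) l tk (subst (T ∘ at S) turn t′)
      -- On the way back `v` carries the label `j + 1` and `s v` the label `j`.
      ... | tri> _ _ k<r = Links.middle l j (ℕₚ.≤-pred (subst (_< suc k) lab≡ (lab< v)))
              (subst (T ∘ at S) (index-s-negate v (<⇒≤ k<r)) tsv)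
              (subst (T ∘ at S) lab≡ tv)
        where
        j : ℕ
        j = n ∸ suc (index v)
        negate≡ : ∀ {r} → 0 < r → r < n → negate r ≡ suc (n ∸ suc r)
        negate≡ {suc r} _ r<n = ℕₚ.+-∸-assoc 1 r<n
        lab≡ : lab v ≡ suc j
        lab≡ = trans (lab-high k<r) (negate≡ (ℕₚ.≤-<-trans z≤n k<r) (index< v))

      -- The ascending half already realizes every pair of successive labels. For `b = true` the
      -- neighbours with indices `k` and `k + 1` share the label `k`, so admissibility there is a
      -- ban on `k`.
      links-negate : ∀ b (S : Vec Bool (suc k)) → (T b → n ∸ suc k ≡ k) → Admissible lab S → Links false S b
      links-negate b S turn adm = record
        { left   = λ ()
        ; middle = λ j j<k tj tsj → adm (q (u + j))
            (subst (T ∘ at S) (sym (lab-rep (ℕₚ.m<n⇒m<1+n j<k))) tj)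
            (subst (T ∘ at S) (sym (trans (cong lab (s-rep j)) (lab-rep (s≤s j<k)))) tsj)
        ; right  = λ tk tb → adm (q (u + k))
            (subst (T ∘ at S) (sym (lab-rep (n<1+n k))) tk)
            (subst (T ∘ at S) (sym (trans (cong lab (s-rep k)) (trans (lab-q k<n) (trans (fold-high ≤-refl k<n) (turn tb))))) tk)
        }

    module _ {u k : ℕ} {τ : Fin n → Fin n} (fold : Folds u (suc k) complement τ) (n≡ : n ≡ suc k + suc k) where

      open Folding fold

      private
        s-rep : ∀ j → s (q (u + j)) ≡ q (u + suc j)
        s-rep j = trans (s-q (u + j)) (cong q (sym (ℕₚ.+-suc u j)))

        k+1<n : suc k < n
        k+1<n = subst (suc k <_) (sym n≡) (s≤s (ℕₚ.m≤n+m (suc k) k))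

        complement-middle : complement (suc k) ≡ k
        complement-middle = trans (cong (_∸ suc (suc k)) n≡) (ℕₚ.m+n∸n≡m k (suc k))

        last : ℕ
        last = ℕ.pred n

        suc-last : suc last ≡ n
        suc-last = ℕₚ.suc-pred n

      -- Both outer neighbours are `true` because each end label is shared by two neighbours: `0` by
      -- the indices `n - 1` and `0`, and `k` by `k` and `k + 1`.
      complement-links : ∀ (S : Vec Bool (suc k)) → Links true S true → Admissible lab S
      complement-links S l v tv tsv with ℕₚ.<-cmp (index v) k
      ... | tri< r<k _ _ = Links.middle l (index v) r<k
              (subst (T ∘ at S) (lab-low (ℕₚ.m<n⇒m<1+n r<k)) tv)
              (subst (T ∘ at S) (trans (cong (λ r → r ⊓ complement r) (index-s v (≤-trans (s≤s (s≤s (<⇒≤ r<k))) k+1<n))) (fold-low (s≤s r<k))) tsv)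
      ... | tri≈ _ r≡k _ = Links.right l (subst (T ∘ at S) (trans (lab-low (subst (_< suc k) (sym r≡k) (n<1+n k))) r≡k) tv) tt
      ... | tri> _ _ k<r with suc (index v) ℕₚ.<? n
      ...   | no r+1≮n = Links.left l tt (subst (T ∘ at S) (trans (lab-high k<r) (ℕₚ.m≤n⇒m∸n≡0 (ℕₚ.≮⇒≥ r+1≮n))) tv)
      ...   | yes r+1<n = Links.middle l (complement (suc (index v)))
                (ℕₚ.≤-pred (subst (_< suc k) lab≡ (lab< v)))
                (subst (T ∘ at S) (trans (cong (λ r → r ⊓ complement r) (index-s v r+1<n)) (fold-high (ℕₚ.m≤n⇒m≤1+n k<r) r+1<n)) tsv)
                (subst (T ∘ at S) lab≡ tv)
        where
        lab≡ : lab v ≡ suc (complement (suc (index v)))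
        lab≡ = trans (lab-high k<r) (ℕₚ.+-∸-assoc 1 r+1<n)

      links-complement : ∀ (S : Vec Bool (suc k)) → Admissible lab S → Links true S true
      links-complement S adm = record
        -- Index `n - 1` and its successor, index 0, both have label 0.
        { left   = λ _ t0 → adm (q (u + last))
            (subst (T ∘ at S) (sym (trans (lab-q (≤-reflexive suc-last)) (trans (fold-high (ℕₚ.≤-pred (subst (suc (suc k) ≤_) (sym suc-last) k+1<n)) (≤-reflexive suc-last))
              (trans (cong (n ∸_) suc-last) (ℕₚ.n∸n≡0 n))))) t0)
            (subst (T ∘ at S) (sym (trans (cong lab (trans (s-rep last) (trans (cong (λ i → q (u + i)) suc-last)
              (trans (q-+n u) (cong q (sym (ℕₚ.+-identityʳ u))))))) (lab-rep (s≤s z≤n)))) t0)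
        ; middle = λ j j<k tj tsj → adm (q (u + j))
            (subst (T ∘ at S) (sym (lab-rep (ℕₚ.m<n⇒m<1+n j<k))) tj)
            (subst (T ∘ at S) (sym (trans (cong lab (s-rep j)) (lab-rep (s≤s j<k)))) tsj)
        ; right  = λ tk _ → adm (q (u + k))
            (subst (T ∘ at S) (sym (lab-rep (n<1+n k))) tk)
            (subst (T ∘ at S) (sym (trans (cong lab (s-rep k)) (trans (lab-q k+1<n) (trans (fold-high ≤-refl k+1<n) complement-middle)))) tk)
        }

  -- The sum over fixed matchings for each type of automorphism.

  module InnerSums {ℓ₁ ℓ₂} (K : ℚ-Algebra ℓ₁ ℓ₂) (a b c β γ : ℕ → ℚ-Algebra.Carrier K) (n : ℕ) (3≤n : 3 ≤ n) where

    open ℚ-Algebra K renaming (refl to ≈-refl; sym to ≈-sym; trans to ≈-trans; setoid to ≈-setoid; _+_ to _⊞_; _*_ to _⊠_)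
    open WalshSeries K hiding (W) renaming (T to Tₙ)
    open Sums K
    open MatchingPolynomials K
    open CycleSums n 3≤n
    open Reflections n 3≤n
    open import Relation.Binary.Reasoning.Setoid ≈-setoid
    open import Algebra.Solver.Ring.NaturalCoefficients.Default commutativeSemiring using (solve; _:=_; _:+_; _:*_; con)

    inner : (Fin n → Fin n) → Carrier
    inner σ = ∑ (fixedMatchings Cₙ σ) (weight a b c β γ Cₙ σ)

    ∏-upTo-const : ∀ m {f : ℕ → Carrier} {x} → (∀ {j} → j < m → f j ≈ x) → ∏ (upTo m) f ≈ x ^ m
    ∏-upTo-const zero    e = ≈-refl
    ∏-upTo-const (suc m) {f} e = ≈-trans (∏-upTo-suc m f) (*-cong (e (s≤s z≤n)) (∏-upTo-const m (e ∘ s≤s)))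

    ∏-upTo-last : ∀ m (f : ℕ → Carrier) → ∏ (upTo (suc m)) f ≈ ∏ (upTo m) f ⊠ f m
    ∏-upTo-last m f = begin
      ∏ (upTo (suc m)) f          ≡⟨ cong (λ js → ∏ js f) (sym (upTo-∷ʳ m)) ⟩
      ∏ (upTo m ++ [ m ]) f       ≈⟨ ∏-++ (upTo m) [ m ] f ⟩
      ∏ (upTo m) f ⊠ (f m ⊠ 1#)   ≈⟨ *-congˡ (*-identityʳ _) ⟩
      ∏ (upTo m) f ⊠ f m          ∎

    module _ (k : ℕ) (d∣n : suc k ∣ n) {l k′ : ℕ} .{{_ : NonZero l}} (ld≡n : l * suc k ≡ n) (d∣k′ : suc k ∣ k′)
             (i₀ : ℕ) (i₀k′ : q (i₀ * k′) ≡ q (suc k)) {σ : Fin n → Fin n} (σ-rot : Rotates k′ σ) where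

      open ResidueLabels n 3≤n k d∣n
      open Rotation ld≡n d∣k′ i₀ i₀k′ {σ} σ-rot

      private
        σ-e : ∀ v → edgeMap σ (e v) ≡ e (σ v)
        σ-e v = trans (edgeMap-⟪⟫ σ v (s v)) (cong ⟪ σ v ,_⟫ (sym (rotates-s {k′} {σ} σ-rot v)))

        module F = FixedMatchings K a b c β γ σ σ σ-e orbiting orbiting (λ _ → a l) (λ _ → ≈-refl) (select (b l) (β l))
          (λ v → inj₁ (σ^l , ≈-refl , ≈-refl)) cyclicChain cyclic⇒admissible admissible⇒cyclic

      -- All cycles have the same length `l`, and `σ ^ l` is the identity, so every edge cycle is
      -- cylindrical and the weights do not depend on the label.
      inner-rotation : inner σ ≈ a l ^ suc k ⊠ Tₙ (suc k) (b l) (β l)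
      inner-rotation = ≈-trans F.∑-fixedMatchings (*-cong (∏-upTo-const (suc k) (λ _ → ≈-refl))
        (≈-trans (∑-cyclicChain k (select (b l) (β l))) (≈-sym (T≈R (b l) (β l) k))))

    -- A label fixed by `F` is an edge that the reflection maps to itself by flipping it, hence the
    -- Möbius variables of length 1; the other edges form cylindrical pairs.
    reflectionWeight : (ℕ → ℕ) → ℕ → Bool → Carrier
    reflectionWeight F j x = if x then fixedOr F (c 1) (b 2) j else fixedOr F (γ 1) (β 2) j

    reflectionWeight-moved : ∀ {F j} → F j ≢ j → ∀ x → reflectionWeight F j x ≈ select (b 2) (β 2) j x
    reflectionWeight-moved {F} F≢ true  = reflexive (fixedOr-moved {F = F} F≢)
    reflectionWeight-moved {F} F≢ false = reflexive (fixedOr-moved {F = F} F≢)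

    reflectionWeight-fixed : ∀ {F j} → F j ≡ j → ∀ x → reflectionWeight F j x ≈ select (c 1) (γ 1) j x
    reflectionWeight-fixed {F} F≡ true  = reflexive (fixedOr-fixed {F = F} F≡)
    reflectionWeight-fixed {F} F≡ false = reflexive (fixedOr-fixed {F = F} F≡)

    orbitSizes : (ℕ → ℕ) → ℕ → Carrier
    orbitSizes F j = a (fixedOr F 1 2 j)

    module _ {t : ℕ} {σ : Fin n → Fin n} (σ-refl : Reflects t σ) {uᵥ mᵥ u m : ℕ} {Fᵥ F : ℕ → ℕ}
             (foldᵥ : Folds uᵥ mᵥ Fᵥ σ) (fold : Folds u m F (σ ∘ s)) where

      private
        module FV = Folding foldᵥ
        module FE = Folding fold
        open Endo (Fin n) using () renaming (_^_ to _^σ_)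

        -- A reflection reverses the orientation, so the image of the edge from `v` to `s v` starts
        -- at the image of `s v`.
        σ-e : ∀ v → edgeMap σ (e v) ≡ e (σ (s v))
        σ-e v = trans (edgeMap-⟪⟫ σ v (s v)) (trans ⟪⟫-comm (cong ⟪ σ (s v) ,_⟫ (sym (s-reflects {t} {σ} σ-refl v))))

        kinds : ∀ v → EdgeKind K b c β γ σ (σ ∘ s) FE.orbiting (reflectionWeight F) v
        kinds v with F (FE.lab v) ℕₚ.≟ FE.lab v
        ... | yes eq = inj₂
          ( fixedOr-fixed {F = F} eq
          , sym (trans (cong s (sym (FE.fixed⇒τ v eq))) (s-reflects {t} {σ} σ-refl v))
          , FE.fixed⇒τ v eq
          , reflectionWeight-fixed {F} eq true , reflectionWeight-fixed {F} eq false)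
        ... | no neq = inj₁
          ( (λ w → trans (cong (λ l → (σ ^σ l) w) size≡2) (reflects-involutive {t} {σ} σ-refl w))
          , ≈-trans (reflectionWeight-moved {F} neq true) (reflexive (cong b (sym size≡2)))
          , ≈-trans (reflectionWeight-moved {F} neq false) (reflexive (cong β (sym size≡2))))
          where
          size≡2 : fixedOr F 1 2 (FE.lab v) ≡ 2
          size≡2 = fixedOr-moved {F = F} neq

      inner-reflection : (p q : Bool) →
        (∀ S → T (chain p S q) → Admissible FE.lab S) → (∀ S → Admissible FE.lab S → T (chain p S q)) →
        inner σ ≈ ∏ (upTo mᵥ) (orbitSizes Fᵥ) ⊠ R p m q (reflectionWeight F)
      inner-reflection p q C⇒ ⇒C = ≈-trans FM.∑-fixedMatchings (*-congˡ (∑-chain p m q (reflectionWeight F)))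
        where
        module FM = FixedMatchings K a b c β γ σ (σ ∘ s) σ-e FV.orbiting FE.orbiting (orbitSizes Fᵥ) (λ _ → ≈-refl)
          (reflectionWeight F) kinds (λ S → chain p S q) C⇒ ⇒C

    odd≢even : ∀ i j → suc (i + i) ≢ j + j
    odd≢even zero    (suc j) eq = case trans (suc-injective eq) (ℕₚ.+-suc j j) of λ ()
    odd≢even (suc i) (suc j) eq = odd≢even i j (suc-injective (trans (sym (cong suc (ℕₚ.+-suc i i))) (trans (suc-injective eq) (ℕₚ.+-suc j j))))

    double-injective : ∀ i j → i + i ≡ j + j → i ≡ j
    double-injective zero    zero    _  = refl
    double-injective (suc i) (suc j) eq = cong suc (double-injective i j
      (suc-injective (trans (sym (ℕₚ.+-suc i i)) (trans (suc-injective eq) (ℕₚ.+-suc j j)))))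

    negate-sum : ∀ {j} → suc j ≤ n → negate (suc j) ≡ suc j → n ≡ suc j + suc j
    negate-sum {j} j<n eq = trans (sym (m+[n∸m]≡n j<n)) (cong (_+_ (suc j)) eq)

    complement-sum : ∀ {j} → suc j ≤ n → complement j ≡ j → n ≡ suc (j + j)
    complement-sum {j} j<n eq = trans (sym (m+[n∸m]≡n j<n)) (cong (_+_ (suc j)) eq)

    orbitSizes-fixed : ∀ {F j} → F j ≡ j → orbitSizes F j ≈ a 1
    orbitSizes-fixed {F} eq = reflexive (cong a (fixedOr-fixed {F = F} eq))

    orbitSizes-moved : ∀ {F j} → F j ≢ j → orbitSizes F j ≈ a 2
    orbitSizes-moved {F} neq = reflexive (cong a (fixedOr-moved {F = F} neq))

    module _ (β₂⁻¹ : Invertible _≈_ 1# _⊠_ (β 2)) where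

      U₂ : ℕ → Carrier
      U₂ k = U k (b 2) (β 2) β₂⁻¹

      w : Bool → Carrier
      w = select (b 2) (β 2) 0

      -- `k` is `(n - 4) / 2`, the smallest index in the formula, so the other indices are
      -- successors of it.
      module Even (k : ℕ) (n≡ : n ≡ suc (suc k) + suc (suc k)) where

        h : ℕ
        h = suc (suc k)

        h+h≤n : h + h ≤ n
        h+h≤n = ≤-reflexive (sym n≡)

        n≤h+h : n ≤ h + h
        n≤h+h = ≤-reflexive n≡

        h+1<n : suc h < n
        h+1<n = subst (suc h <_) (sym n≡) (s≤s (s≤s (ℕₚ.m≤n+m h k)))

        h<n : h < n
        h<n = <⇒≤ h+1<n

        negate-h : negate h ≡ h
        negate-h = trans (cong (_∸ h) n≡) (ℕₚ.m+n∸n≡m h h)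

        negate-moved : ∀ {j} → suc j < h → negate (suc j) ≢ suc j
        negate-moved {j} j<h eq = <⇒≢ j<h (double-injective (suc j) h (trans (sym (negate-sum (<⇒≤ (<-trans j<h h<n)) eq)) n≡))

        complement-moved : ∀ {j} → j < h → complement j ≢ j
        complement-moved {j} j<h eq = odd≢even j h (trans (sym (complement-sum (<-trans j<h h<n) eq)) n≡)

        -- The axis passes through the vertices `u` and `u + h`, which gives the factor `a 1 ^ 2`.
        -- No edge is flipped; the first and the last edge orbit consist of the two edges at a fixed
        -- vertex and stay unchosen, which gives `β 2 ^ 2`.
        through-vertices : ∀ {t σ u} → Reflects t σ → u ≤ n → q t ≡ q (u + u) →
          inner σ ≈ a 1 ^ 2 ⊠ a 2 ^ suc k ⊠ β 2 ^ 2 ⊠ U₂ (suc k)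
        through-vertices {t} {σ} {u} σ-refl u≤n t≡2u = begin
          inner σ
            ≈⟨ inner-reflection σ-refl foldᵥ fold true true
                 (λ S → complement-links fold n≡ S ∘ chain⇒links true S true)
                 (λ S → links⇒chain true S true ∘ links-complement fold n≡ S) ⟩
          ∏ (upTo (suc h)) (orbitSizes negate) ⊠ R true h true (reflectionWeight complement)
            ≈⟨ *-cong vertexPart (≈-trans
                 (R-cong true h true (λ {j} j<h → reflectionWeight-moved {complement} {j} (complement-moved j<h)))
                 (R-TT≈z²U (b 2) (β 2) β₂⁻¹ (suc k))) ⟩
          (a 1 ⊠ (a 2 ^ suc k ⊠ a 1)) ⊠ (β 2 ^ 2 ⊠ U₂ (suc k))
            ≈⟨ solve 4 (λ a₁ x y u → (a₁ :* (x :* a₁)) :* (y :* u) := (a₁ :* (a₁ :* con 1)) :* x :* y :* u) ≈-refl _ _ _ _ ⟩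
          a 1 ^ 2 ⊠ a 2 ^ suc k ⊠ β 2 ^ 2 ⊠ U₂ (suc k) ∎
          where
          foldᵥ : Folds u (suc h) negate σ
          foldᵥ = negate-fold h+h≤n (ℕₚ.m≤n⇒m≤1+n n≤h+h) u≤n t≡2u σ-refl
          t′ : ℕ
          -- This is `t - 1` modulo `n`, the constant of the reflection `σ ∘ s`.
          t′ = t + ℕ.pred n
          t′+1≡t : q (suc t′) ≡ q t
          t′+1≡t = trans (cong q (trans (sym (ℕₚ.+-suc t (ℕ.pred n))) (cong (_+_ t) (ℕₚ.suc-pred n)))) (q-+n t)
          fold : Folds u h complement (σ ∘ s)
          fold = complement-fold {t = t′} (ℕₚ.m≤n⇒m≤1+n h+h≤n) n≤h+h u≤n (trans t′+1≡t t≡2u) (reflects-∘s {t} {σ} σ-refl t′+1≡t)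
          vertexPart : ∏ (upTo (suc h)) (orbitSizes negate) ≈ a 1 ⊠ (a 2 ^ suc k ⊠ a 1)
          vertexPart = ≈-trans (∏-upTo-suc h (orbitSizes negate)) (*-cong (orbitSizes-fixed {negate} {0} refl) (≈-trans
            (∏-upTo-last (suc k) _) (*-cong (∏-upTo-const (suc k) (λ {j} j<k → orbitSizes-moved {negate} {suc j} (negate-moved (s≤s j<k))))
                                            (orbitSizes-fixed {negate} {h} negate-h))))

        -- The axis bisects the edges `e (q u)` and `e (q (u + h))`, so no vertex is fixed and the
        -- labels `0` and `h` are Möbius edges. Choosing neither, one or both of them gives the
        -- three terms, the middle one twice.
        through-edges : ∀ {t σ u} → Reflects t σ → suc u ≤ n → q t ≡ q (suc (u + u)) →
          inner σ ≈ a 2 ^ h ⊠ (γ 1 ^ 2 ⊠ U₂ h ⊞ 2 · (c 1 ⊠ γ 1 ⊠ β 2 ⊠ U₂ (suc k)) ⊞ c 1 ^ 2 ⊠ β 2 ^ 2 ⊠ U₂ k)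
        through-edges {t} {σ} {u} σ-refl u<n t≡2u+1 = begin
          inner σ
            ≈⟨ inner-reflection σ-refl foldᵥ fold false false
                 (λ S → negate-links fold h+1<n false S turn (λ _ → s≤s z≤n) ∘ chain⇒links false S false)
                 (λ S → links⇒chain false S false ∘ links-negate fold h+1<n false S (λ ())) ⟩
          ∏ (upTo h) (orbitSizes complement) ⊠ R false (suc h) false (reflectionWeight negate)
            ≈⟨ *-cong (∏-upTo-const h (λ {j} j<h → orbitSizes-moved {complement} {j} (complement-moved j<h))) edgePart ⟩
          a 2 ^ h ⊠ (c 1 ⊠ (γ 1 ⊠ (β 2 ⊠ U₂ (suc k)) ⊞ c 1 ⊠ (β 2 ^ 2 ⊠ U₂ k))
                     ⊞ γ 1 ⊠ (γ 1 ⊠ U₂ h ⊞ c 1 ⊠ (β 2 ⊠ U₂ (suc k))))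
            ≈⟨ *-congˡ (solve 7 (λ c γ β β² x y z →
                 c :* (γ :* (β :* y) :+ c :* (β² :* z)) :+ γ :* (γ :* x :+ c :* (β :* y))
                 := (γ :* (γ :* con 1)) :* x :+ ((c :* γ :* β :* y) :+ ((c :* γ :* β :* y) :+ con 0)) :+ (c :* (c :* con 1)) :* β² :* z)
                 ≈-refl (c 1) (γ 1) (β 2) (β 2 ^ 2) _ _ _) ⟩
          a 2 ^ h ⊠ (γ 1 ^ 2 ⊠ U₂ h ⊞ 2 · (c 1 ⊠ γ 1 ⊠ β 2 ⊠ U₂ (suc k)) ⊞ c 1 ^ 2 ⊠ β 2 ^ 2 ⊠ U₂ k) ∎
          where
          foldᵥ : Folds (suc u) h complement σ
          -- The axis lies between the vertices `u` and `u + 1`, and `complement` counts from the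
          -- latter.
          foldᵥ = complement-fold (ℕₚ.m≤n⇒m≤1+n h+h≤n) n≤h+h u<n
            (trans (q-suc {t} {suc (u + u)} t≡2u+1) (cong (q ∘ suc) (sym (ℕₚ.+-suc u u)))) σ-refl
          fold : Folds u (suc h) negate (σ ∘ s)
          fold = negate-fold h+h≤n (ℕₚ.m≤n⇒m≤1+n n≤h+h) (<⇒≤ u<n) refl (reflects-∘s {t} {σ} σ-refl (sym t≡2u+1))
          turn : n ∸ suc h ≡ suc k
          turn = trans (cong (_∸ suc h) n≡) (trans (cong (_∸ suc h) (sym (ℕₚ.+-suc (suc k) h))) (ℕₚ.m+n∸n≡m (suc k) (suc h)))
          Wᵣ : ℕ → Bool → Carrier
          Wᵣ = reflectionWeight negate
          last : ∀ p → R p h false (Wᵣ ∘ suc) ≈ γ 1 ⊠ R p (suc k) false (λ _ → w) ⊞ c 1 ⊠ R p (suc k) true (λ _ → w)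
          last p = ≈-trans
            (R-last p (suc k) (λ {j} j<k → reflectionWeight-moved {negate} {suc j} (negate-moved (s≤s j<k))))
            (+-cong (*-congʳ (reflectionWeight-fixed {negate} {h} negate-h false)) (*-congʳ (reflectionWeight-fixed {negate} {h} negate-h true)))
          edgePart : R false (suc h) false Wᵣ ≈
            c 1 ⊠ (γ 1 ⊠ (β 2 ⊠ U₂ (suc k)) ⊞ c 1 ⊠ (β 2 ^ 2 ⊠ U₂ k))
            ⊞ γ 1 ⊠ (γ 1 ⊠ U₂ h ⊞ c 1 ⊠ (β 2 ⊠ U₂ (suc k)))
          edgePart = +-cong
            (*-cong (reflectionWeight-fixed {negate} {0} refl true) (≈-trans (last true)
              (+-cong (*-congˡ (R-TF≈zU (b 2) (β 2) β₂⁻¹ (suc k))) (*-congˡ (R-TT≈z²U (b 2) (β 2) β₂⁻¹ k)))))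
            (*-cong (reflectionWeight-fixed {negate} {0} refl false) (≈-trans (last false)
              (+-cong (*-congˡ (R-FF (b 2) (β 2) β₂⁻¹ (suc k))) (*-congˡ (R-FT≈zU (b 2) (β 2) β₂⁻¹ (suc k))))))

      module Odd (k : ℕ) (n≡ : n ≡ suc (suc k + suc k)) where

        h : ℕ
        h = suc k

        h+h≤n : h + h ≤ n
        h+h≤n = ≤-trans (ℕₚ.n≤1+n _) (≤-reflexive (sym n≡))

        n≤h+h+1 : n ≤ suc (h + h)
        n≤h+h+1 = ≤-reflexive n≡

        h+1<n : suc h < n
        h+1<n = subst (suc h <_) (sym n≡) (s≤s (s≤s (ℕₚ.m≤n+m h k)))

        complement-h : complement h ≡ h
        complement-h = trans (cong (_∸ suc h) n≡) (ℕₚ.m+n∸n≡m h h)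

        complement-moved : ∀ {j} → j < h → complement j ≢ j
        complement-moved {j} j<h eq = <⇒≢ j<h (double-injective j h
          (suc-injective (trans (sym (complement-sum (<-trans j<h (<⇒≤ h+1<n)) eq)) n≡)))

        negate-moved : ∀ {j} → j < h → negate (suc j) ≢ suc j
        negate-moved {j} j<h eq = odd≢even h (suc j) (trans (sym n≡) (negate-sum (<-trans j<h (<⇒≤ h+1<n)) eq))

        -- The axis bisects the edge `e (q u)` and passes through the vertex with index `u + 1 + h`.
        -- The last edge orbit consists of the two edges at that vertex and stays unchosen; the two
        -- terms correspond to the bisected edge being unmatched or matched.
        reflection-odd : ∀ {t σ u} → Reflects t σ → suc u ≤ n → q t ≡ q (suc (u + u)) →
          inner σ ≈ a 1 ⊠ a 2 ^ h ⊠ (β 2 ⊠ γ 1 ⊠ U₂ h ⊞ β 2 ^ 2 ⊠ c 1 ⊠ U₂ k)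
        reflection-odd {t} {σ} {u} σ-refl u<n t≡2u+1 = begin
          inner σ
            ≈⟨ inner-reflection σ-refl foldᵥ fold false true
                 (λ S → negate-links fold h+1<n true S turn (λ ()) ∘ chain⇒links false S true)
                 (λ S → links⇒chain false S true ∘ links-negate fold h+1<n true S (λ _ → turn)) ⟩
          ∏ (upTo (suc h)) (orbitSizes complement) ⊠ R false (suc h) true Wᵣ
            ≈⟨ *-cong vertexPart edgePart ⟩
          (a 2 ^ h ⊠ a 1) ⊠ (c 1 ⊠ (β 2 ^ 2 ⊠ U₂ k) ⊞ γ 1 ⊠ (β 2 ⊠ U₂ h))
            ≈⟨ solve 8 (λ x a₁ c β² y γ β z → (x :* a₁) :* (c :* (β² :* y) :+ γ :* (β :* z))
                 := a₁ :* x :* (β :* γ :* z :+ β² :* c :* y)) ≈-refl _ _ _ _ _ _ _ _ ⟩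
          a 1 ⊠ a 2 ^ h ⊠ (β 2 ⊠ γ 1 ⊠ U₂ h ⊞ β 2 ^ 2 ⊠ c 1 ⊠ U₂ k) ∎
          where
          foldᵥ : Folds (suc u) (suc h) complement σ
          foldᵥ = complement-fold (≤-reflexive (trans (cong suc (ℕₚ.+-suc h h)) (cong suc (sym n≡))))
            (≤-trans n≤h+h+1 (s≤s (ℕₚ.+-monoʳ-≤ h (ℕₚ.n≤1+n h)))) u<n
            (trans (q-suc {t} {suc (u + u)} t≡2u+1) (cong (q ∘ suc) (sym (ℕₚ.+-suc u u)))) σ-refl
          fold : Folds u (suc h) negate (σ ∘ s)
          fold = negate-fold h+h≤n n≤h+h+1 (<⇒≤ u<n) refl (reflects-∘s {t} {σ} σ-refl (sym t≡2u+1))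
          turn : n ∸ suc h ≡ h
          turn = complement-h
          Wᵣ : ℕ → Bool → Carrier
          Wᵣ = reflectionWeight negate
          vertexPart : ∏ (upTo (suc h)) (orbitSizes complement) ≈ a 2 ^ h ⊠ a 1
          vertexPart = ≈-trans (∏-upTo-last h (orbitSizes complement))
            (*-cong (∏-upTo-const h (λ {j} j<h → orbitSizes-moved {complement} {j} (complement-moved j<h))) (orbitSizes-fixed {complement} {h} complement-h))
          uniform : ∀ p → R p h true (Wᵣ ∘ suc) ≈ R p h true (λ _ → w)
          uniform p = R-cong p h true (λ {j} j<h → reflectionWeight-moved {negate} {suc j} (negate-moved j<h))
          edgePart : R false (suc h) true Wᵣ ≈ c 1 ⊠ (β 2 ^ 2 ⊠ U₂ k) ⊞ γ 1 ⊠ (β 2 ⊠ U₂ h)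
          edgePart = +-cong
            (*-cong (reflectionWeight-fixed {negate} {0} refl true) (≈-trans (uniform true) (R-TT≈z²U (b 2) (β 2) β₂⁻¹ k)))
            (*-cong (reflectionWeight-fixed {negate} {0} refl false) (≈-trans (uniform false) (R-FT≈zU (b 2) (β 2) β₂⁻¹ h)))

  -- Automorphisms and greatest common divisors

  module CycleAutomorphisms (n : ℕ) (3≤n : 3 ≤ n) where

    open CycleEdges n 3≤n
    open Graph Cₙ using (_~_)

    IsAut : (Fin n → Fin n) → Set
    IsAut = IsAutomorphism Cₙ

    rotates⇒aut : ∀ {k σ} → Rotates k σ → IsAut σ
    rotates⇒aut {k} {σ} σ-rot = (injective , surjective) , λ v w → preserves , reflects
      where
      injective : ∀ {v w} → σ v ≡ σ w → v ≡ w
      injective {v} {w} eq = trans (sym (q-toℕ v)) (trans (q-cancelʳ k {toℕ v} {toℕ w}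
        (trans (sym (σ-rot (toℕ v))) (trans (trans (cong σ (q-toℕ v)) (trans eq (cong σ (sym (q-toℕ w))))) (σ-rot (toℕ w))))) (q-toℕ w))
      surjective : ∀ w → ∃[ v ] (∀ {z} → z ≡ v → σ z ≡ w)
      surjective w = q (toℕ w + k * ℕ.pred n) , λ { refl → begin
        σ (q (toℕ w + k * ℕ.pred n))       ≡⟨ σ-rot _ ⟩
        q (toℕ w + k * ℕ.pred n + k)       ≡⟨ cong q (rearrange (toℕ w) k (ℕ.pred n)) ⟩
        q (toℕ w + k * suc (ℕ.pred n))     ≡⟨ cong (λ m → q (toℕ w + k * m)) (ℕₚ.suc-pred n) ⟩
        q (toℕ w + k * n)                  ≡⟨ q-+*n (toℕ w) k ⟩
        q (toℕ w)                          ≡⟨ q-toℕ w ⟩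
        w                                  ∎ }
        where
        open ≡-Reasoning
        rearrange : ∀ w k p → w + k * p + k ≡ w + k * (1 + p)
        rearrange = solve-ℕ
      preserves : ∀ {v w} → v ~ w → σ v ~ σ w
      preserves v~w with ~⇒adjacent v~w
      ... | inj₁ refl = adjacent⇒~ (inj₁ (sym (rotates-s {k} {σ} σ-rot _)))
      ... | inj₂ refl = adjacent⇒~ (inj₂ (sym (rotates-s {k} {σ} σ-rot _)))
      reflects : ∀ {v w} → σ v ~ σ w → v ~ w
      reflects σv~σw with ~⇒adjacent σv~σw
      ... | inj₁ eq = adjacent⇒~ (inj₁ (injective (trans eq (rotates-s {k} {σ} σ-rot _))))
      ... | inj₂ eq = adjacent⇒~ (inj₂ (injective (trans eq (rotates-s {k} {σ} σ-rot _))))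

    reflects⇒aut : ∀ {t σ} → Reflects t σ → IsAut σ
    reflects⇒aut {t} {σ} σ-refl = (injective , surjective) , λ v w → preserves , reflects
      where
      σσ : ∀ v → σ (σ v) ≡ v
      σσ = reflects-involutive {t} {σ} σ-refl
      injective : ∀ {v w} → σ v ≡ σ w → v ≡ w
      injective {v} {w} eq = trans (sym (σσ v)) (trans (cong σ eq) (σσ w))
      surjective : ∀ w → ∃[ v ] (∀ {z} → z ≡ v → σ z ≡ w)
      surjective w = σ w , λ { refl → σσ w }
      preserves : ∀ {v w} → v ~ w → σ v ~ σ w
      preserves v~w with ~⇒adjacent v~w
      ... | inj₁ refl = adjacent⇒~ (inj₂ (sym (s-reflects {t} {σ} σ-refl _)))
      ... | inj₂ refl = adjacent⇒~ (inj₁ (sym (s-reflects {t} {σ} σ-refl _)))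
      reflects : ∀ {v w} → σ v ~ σ w → v ~ w
      reflects {v} {w} σv~σw = subst₂ _~_ (σσ v) (σσ w) (preserves σv~σw)

    module _ {σ : Fin n → Fin n} (σ-aut : IsAut σ) where

      private
        injective : ∀ {v w} → σ v ≡ σ w → v ≡ w
        injective = proj₁ (proj₁ σ-aut)

        step : ∀ i → Adjacent (σ (q i)) (σ (q (suc i)))
        step i = ~⇒adjacent (proj₁ (proj₂ σ-aut (q i) (q (suc i))) (subst (q i ~_) (s-q i) (~s (q i))))

        no-return : ∀ i → σ (q (suc (suc i))) ≢ σ (q i)
        no-return i eq = q-shift≢ 2 i (s≤s z≤n) 3≤n (injective eq)

        k : ℕ
        k = toℕ (σ (q 0))

        forward : σ (q 1) ≡ s (σ (q 0)) → ∀ i → σ (q (suc i)) ≡ s (σ (q i))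
        forward e₀ zero    = e₀
        forward e₀ (suc i) with step (suc i)
        ... | inj₁ e₁ = e₁
        ... | inj₂ e₂ = contradiction (s-injective (trans (sym e₂) (forward e₀ i))) (no-return i)

        backward : σ (q 0) ≡ s (σ (q 1)) → ∀ i → σ (q i) ≡ s (σ (q (suc i)))
        backward e₀ zero    = e₀
        backward e₀ (suc i) with step (suc i)
        ... | inj₂ e₂ = e₂
        ... | inj₁ e₁ = contradiction (trans e₁ (sym (backward e₀ i))) (no-return i)

        forward⇒rotates : σ (q 1) ≡ s (σ (q 0)) → Rotates k σ
        forward⇒rotates e₀ zero    = sym (q-toℕ (σ (q 0)))
        forward⇒rotates e₀ (suc i) = trans (forward e₀ i) (trans (cong s (forward⇒rotates e₀ i)) (s-q (i + k)))

        -- If each step forward is mapped to a step backward, the sum of a vertex and its image is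
        -- constant modulo `n`.
        backward⇒reflects : σ (q 0) ≡ s (σ (q 1)) → Reflects k σ
        backward⇒reflects e₀ i j eq = trans (sym (q-toℕ (σ (q i))))
          (q-cancelˡ i {toℕ (σ (q i))} {j} (trans (constant i) (sym eq)))
          where
          constant : ∀ i → q (i + toℕ (σ (q i))) ≡ q k
          constant zero    = refl
          constant (suc i) = trans (cong q (sym (ℕₚ.+-suc i (toℕ (σ (q (suc i)))))))
            (trans (q-+ {i} {i} refl (trans (sym (backward e₀ i)) (sym (q-toℕ (σ (q i)))))) (constant i))

      -- The image of the first step fixes a direction. An injective map cannot turn back
      -- (`no-return`), so the direction persists around the cycle.
      classification : Rotates k σ ⊎ Reflects k σ
      classification with step 0
      ... | inj₁ e₀ = inj₁ (forward⇒rotates e₀)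
      ... | inj₂ e₀ = inj₂ (backward⇒reflects e₀)

    rotationVec reflectionVec : ℕ → Vec (Fin n) n
    rotationVec k = Vec.tabulate (rotation k)
    reflectionVec t = Vec.tabulate (reflection t)

    rotationVec-rotates : ∀ k → Rotates k (lookup (rotationVec k))
    rotationVec-rotates k i = trans (lookup∘tabulate (rotation k) (q i)) (rotation-rotates k i)

    reflectionVec-reflects : ∀ t → Reflects t (lookup (reflectionVec t))
    reflectionVec-reflects t i j eq = trans (lookup∘tabulate (reflection t) (q i)) (reflection-reflects t i j eq)

    -- The identity is listed as the rotation by `n`; the range agrees with that in `φ`.
    [1‥n] : List ℕ
    [1‥n] = map suc (upTo n)

    private
      isAut? : Unary.Decidable (IsAut ∘ lookup)
      isAut? = isAutomorphism? Cₙ ∘ lookup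

      vec-ext : ∀ {f : Fin n → Fin n} (v : Vec (Fin n) n) → (∀ i → lookup v i ≡ f i) → v ≡ Vec.tabulate f
      vec-ext v eq = trans (sym (tabulate∘lookup v)) (tabulate-cong eq)

      rotates⇒∈ : ∀ {k} v → Rotates k (lookup v) → v ∈ map rotationVec [1‥n]
      rotates⇒∈ {k} v v-rot = subst (_∈ map rotationVec [1‥n]) (sym (vec-ext v λ i → begin
        lookup v i               ≡⟨ cong (lookup v) (sym (q-toℕ i)) ⟩
        lookup v (q (toℕ i))     ≡⟨ v-rot (toℕ i) ⟩
        q (toℕ i + k)            ≡⟨ q-+ {toℕ i} {toℕ i} {k} refl (sym q-k′) ⟩
        q (toℕ i + suc k′)       ∎))
        (∈-map⁺ rotationVec (∈-map⁺ suc (∈-upTo⁺ (toℕ<n (q (k + ℕ.pred n))))))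
        where
        open ≡-Reasoning
        k′ : ℕ
        -- The residue of `k - 1`, so that `suc k′` represents `k` between 1 and `n`.
        k′ = toℕ (q (k + ℕ.pred n))
        q-k′ : q (suc k′) ≡ q k
        q-k′ = begin
          q (suc k′)              ≡⟨ q-suc {k′} {k + ℕ.pred n} (q-toℕ (q (k + ℕ.pred n))) ⟩
          q (suc (k + ℕ.pred n))  ≡⟨ cong q (sym (ℕₚ.+-suc k (ℕ.pred n))) ⟩
          q (k + suc (ℕ.pred n))  ≡⟨ cong (λ m → q (k + m)) (ℕₚ.suc-pred n) ⟩
          q (k + n)               ≡⟨ q-+n k ⟩
          q k                     ∎

      reflects⇒∈ : ∀ {t} v → t < n → Reflects t (lookup v) → v ∈ map reflectionVec (upTo n)
      reflects⇒∈ {t} v t<n v-refl = subst (_∈ map reflectionVec (upTo n)) (sym (vec-ext v λ i →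
        let j , eq = opposite t i in
        trans (cong (lookup v) (sym (q-toℕ i))) (trans (v-refl (toℕ i) j eq)
          (trans (sym (reflection-reflects t (toℕ i) j eq)) (cong (reflection t) (q-toℕ i))))))
        (∈-map⁺ reflectionVec (∈-upTo⁺ t<n))

      -- If they agreed, `i + (i + k) ≡ t` would hold for all `i`; the cases 0 and 1 give `2 ≡ 0`
      -- modulo `n`.
      rotation≢reflection : ∀ {k t} → rotationVec k ≢ reflectionVec t
      rotation≢reflection {k} {t} eq = q-shift≢ 2 k (s≤s z≤n) 3≤n (trans (sum 1) (sym (sum 0)))
        where
        sum : ∀ i → q (i + (i + k)) ≡ q t
        sum i = let j , e = opposite t (q i)
                    i+j≡t : q (i + j) ≡ q t
                    i+j≡t = trans (q-+ {i} {toℕ (q i)} {j} (sym (q-toℕ (q i))) refl) e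
                in trans (q-+ {i} {i} {i + k} {j} refl (trans (sym (rotationVec-rotates k i))
                     (trans (cong (λ v → lookup v (q i)) eq) (reflectionVec-reflects t i j i+j≡t)))) i+j≡t

      rotationVec-injective : ∀ {k k′} → k ∈ [1‥n] → k′ ∈ [1‥n] → rotationVec k ≡ rotationVec k′ → k ≡ k′
      rotationVec-injective k∈ k′∈ eq with ∈-map⁻ suc k∈ | ∈-map⁻ suc k′∈
      ... | i , i∈ , refl | i′ , i′∈ , refl = cong suc (q-injective (∈-upTo⁻ i∈) (∈-upTo⁻ i′∈) (q-cancelˡ 1 {i} {i′}
        (trans (sym (rotationVec-rotates (suc i) 0)) (trans (cong (λ v → lookup v (q 0)) eq) (rotationVec-rotates (suc i′) 0)))))

      reflectionVec-injective : ∀ {t t′} → t ∈ upTo n → t′ ∈ upTo n → reflectionVec t ≡ reflectionVec t′ → t ≡ t′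
      reflectionVec-injective {t} {t′} t∈ t′∈ eq = q-injective (∈-upTo⁻ t∈) (∈-upTo⁻ t′∈)
        (trans (sym (reflectionVec-reflects t 0 t refl)) (trans (cong (λ v → lookup v (q 0)) eq) (reflectionVec-reflects t′ 0 t′ refl)))

    automorphisms-↭ : automorphisms Cₙ ↭ map rotationVec [1‥n] ++ map reflectionVec (upTo n)
    automorphisms-↭ = unique∧set⇒↭
      (Uniqueₚ.filter⁺ isAut? (vectors-unique (Uniqueₚ.allFin⁺ n) n))
      (Uniqueₚ.++⁺ (map-unique (Uniqueₚ.map⁺ suc-injective (Uniqueₚ.upTo⁺ n)) rotationVec-injective)
                   (map-unique (Uniqueₚ.upTo⁺ n) reflectionVec-injective) disjoint)
      to from
      where
      disjoint : ∀ {v} → ¬ (v ∈ map rotationVec [1‥n] × v ∈ map reflectionVec (upTo n))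
      disjoint (p , p′) with ∈-map⁻ rotationVec p | ∈-map⁻ reflectionVec p′
      ... | k , _ , eq | t , _ , eq′ = rotation≢reflection {k} {t} (trans (sym eq) eq′)

      to : ∀ {v} → v ∈ automorphisms Cₙ → v ∈ map rotationVec [1‥n] ++ map reflectionVec (upTo n)
      to {v} v∈ with classification {lookup v} (proj₂ (∈-filter⁻ isAut? {xs = vectors (allFin n) n} v∈))
      ... | inj₁ v-rot  = ∈-++⁺ˡ (rotates⇒∈ v v-rot)
      ... | inj₂ v-refl = ∈-++⁺ʳ (map rotationVec [1‥n]) (reflects⇒∈ v (toℕ<n _) v-refl)

      aut∈ : ∀ v → IsAut (lookup v) → v ∈ automorphisms Cₙ
      aut∈ v = ∈-filter⁺ isAut? (∈-vectors ∈-allFin v)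

      from : ∀ {v} → v ∈ map rotationVec [1‥n] ++ map reflectionVec (upTo n) → v ∈ automorphisms Cₙ
      from v∈ with ∈-++⁻ (map rotationVec [1‥n]) v∈
      ... | inj₁ p = let k , _ , eq = ∈-map⁻ rotationVec p in
        subst (_∈ automorphisms Cₙ) (sym eq) (aut∈ (rotationVec k) (rotates⇒aut {k} (rotationVec-rotates k)))
      ... | inj₂ p = let t , _ , eq = ∈-map⁻ reflectionVec p in
        subst (_∈ automorphisms Cₙ) (sym eq) (aut∈ (reflectionVec t) (reflects⇒aut {t} (reflectionVec-reflects t)))

    ∣Aut∣≡2n : length (automorphisms Cₙ) ≡ 2 * n
    ∣Aut∣≡2n = begin
      length (automorphisms Cₙ)
        ≡⟨ ↭-length automorphisms-↭ ⟩
      length (map rotationVec [1‥n] ++ map reflectionVec (upTo n))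
        ≡⟨ length-++ (map rotationVec [1‥n]) ⟩
      length (map rotationVec [1‥n]) + length (map reflectionVec (upTo n))
        ≡⟨ cong₂ _+_ (trans (length-map rotationVec [1‥n]) (trans (length-map suc (upTo n)) (length-upTo n)))
                     (trans (length-map reflectionVec (upTo n)) (length-upTo n)) ⟩
      n + n
        ≡⟨ cong (n +_) (sym (ℕₚ.+-identityʳ n)) ⟩
      2 * n ∎
      where open ≡-Reasoning

  -- Multiplication by `d` maps the numbers up to `n / d` that are coprime to `n / d` onto the
  -- numbers up to `n` whose gcd with `n` is `d`. The predecessor of the gcd appears because
  -- divisors are listed as `suc i`.
  count-gcd : ∀ n i .{{_ : NonZero n}} → suc i ∣ n →
              count (λ k → ℕ.pred (gcd k n) ℕₚ.≟ i) (map suc (upTo n)) ≡ φ (n / suc i)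
  count-gcd n i d∣n = trans
    (↭-length (unique∧set⇒↭ (Uniqueₚ.filter⁺ gcd? (Uniqueₚ.map⁺ suc-injective (Uniqueₚ.upTo⁺ n)))
      (Uniqueₚ.map⁺ (λ {x} {y} → ℕₚ.*-cancelʳ-≡ x y d) (Uniqueₚ.filter⁺ coprime-L? (Uniqueₚ.map⁺ suc-injective (Uniqueₚ.upTo⁺ L))))
      to from))
    (length-map (_* d) coprimes)
    where
    d L : ℕ
    d = suc i
    L = n / d

    Ld≡n : L * d ≡ n
    Ld≡n = m/n*n≡m d∣n

    gcd? : Unary.Decidable (λ k → ℕ.pred (gcd k n) ≡ i)
    gcd? k = ℕ.pred (gcd k n) ℕₚ.≟ i

    coprime-L? : Unary.Decidable (λ k → Coprime k L)
    coprime-L? k = coprime? k L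

    coprimes : List ℕ
    coprimes = filter coprime-L? (map suc (upTo L))

    multiple : ∀ {k} → k < n → gcd (suc k) n ≡ d → suc k ∈ map (_* d) coprimes
    multiple {k} k<n gcd≡d with subst (_∣ suc k) gcd≡d (gcd[m,n]∣m (suc k) n)
    ... | divides (suc x) eq = subst (_∈ map (_* d) coprimes) (sym eq)
      (∈-map⁺ (_* d) (∈-filter⁺ coprime-L? (∈-map⁺ suc (∈-upTo⁺ x<L)) coprime))
      where
      x<L : suc x ≤ L
      x<L = ℕₚ.*-cancelʳ-≤ (suc x) L d (subst₂ _≤_ eq (sym Ld≡n) k<n)
      coprime : Coprime (suc x) L
      coprime {c} (c∣x , c∣L) = ∣1⇒≡1 (*-cancelʳ-∣ d (subst (c * d ∣_) (trans gcd≡d (sym (ℕₚ.*-identityˡ d)))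
        (gcd-greatest {suc k} {n} (subst (c * d ∣_) (sym eq) (*-monoˡ-∣ d c∣x)) (subst (c * d ∣_) Ld≡n (*-monoˡ-∣ d c∣L)))))

    to : ∀ {k} → k ∈ filter gcd? (map suc (upTo n)) → k ∈ map (_* d) coprimes
    to {k} k∈ with ∈-filter⁻ gcd? {xs = map suc (upTo n)} k∈
    ... | k∈′ , pred-gcd with ∈-map⁻ suc k∈′
    ...   | k₀ , k₀∈ , refl = multiple (∈-upTo⁻ k₀∈)
      (trans (sym (ℕₚ.suc-pred (gcd k n) {{ℕ.≢-nonZero (GCD.gcd[m,n]≢0 k n (inj₁ λ ()))}})) (cong suc pred-gcd))

    from : ∀ {k} → k ∈ map (_* d) coprimes → k ∈ filter gcd? (map suc (upTo n))
    from k∈ with ∈-map⁻ (_* d) k∈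
    ... | x , x∈ , refl with ∈-filter⁻ coprime-L? {xs = map suc (upTo L)} x∈
    ...   | x∈′ , coprime with ∈-map⁻ suc x∈′
    ...     | x₀ , x₀∈ , refl = ∈-filter⁺ gcd? (∈-map⁺ suc (∈-upTo⁺ xd≤n)) (cong ℕ.pred gcd≡d)
      where
      xd≤n : suc x₀ * d ≤ n
      xd≤n = subst (suc x₀ * d ≤_) Ld≡n (ℕₚ.*-monoˡ-≤ d (∈-upTo⁻ x₀∈))
      gcd≡d : gcd (suc x₀ * d) n ≡ d
      gcd≡d = begin
        gcd (suc x₀ * d) n         ≡⟨ cong₂ gcd (ℕₚ.*-comm (suc x₀) d) (trans (sym Ld≡n) (ℕₚ.*-comm L d)) ⟩
        gcd (d * suc x₀) (d * L)   ≡⟨ sym (GCD.c*gcd[m,n]≡gcd[cm,cn] d (suc x₀) L) ⟩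
        d * gcd (suc x₀) L         ≡⟨ cong (d *_) (coprime⇒gcd≡1 coprime) ⟩
        d * 1                      ≡⟨ ℕₚ.*-identityʳ d ⟩
        d                          ∎
        where open ≡-Reasoning

  module _ (n : ℕ) .{{_ : NonZero n}} where

    open Residues n

    gcd-multiple : ∀ k → ∃[ i ] q (i * k) ≡ q (gcd k n)
    gcd-multiple k with GCD.Bézout.identity (GCD.gcd-GCD k n)
    ... | GCD.Bézout.Identity.+- x y eq = x , trans (cong q (sym eq)) (q-+*n (gcd k n) y)
    -- Here `gcd k n + x * k = y * n`, so the coefficient is `-x`, represented by `x * pred n`.
    ... | GCD.Bézout.Identity.-+ x y eq = x * ℕ.pred n , q-cancelʳ (x * k) {x * ℕ.pred n * k} {gcd k n} (begin
        q (x * ℕ.pred n * k + x * k)    ≡⟨ cong q (rearrange x (ℕ.pred n) k) ⟩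
        q (x * k * suc (ℕ.pred n))      ≡⟨ cong (λ m → q (x * k * m)) (ℕₚ.suc-pred n) ⟩
        q (0 + x * k * n)               ≡⟨ q-+*n 0 (x * k) ⟩
        q 0                             ≡⟨ sym (q-+*n 0 y) ⟩
        q (y * n)                       ≡⟨ cong q (sym eq) ⟩
        q (gcd k n + x * k)             ∎)
      where
      open ≡-Reasoning
      rearrange : ∀ x p k → x * p * k + x * k ≡ x * k * (1 + p)
      rearrange = solve-ℕ

  -- Parity, division by natural numbers and averaging.

  parity : ∀ n → (∃[ h ] n ≡ h + h) ⊎ (∃[ h ] n ≡ suc (h + h))
  parity zero = inj₁ (0 , refl)
  parity (suc n) with parity n
  ... | inj₁ (h , refl) = inj₂ (h , refl)
  ... | inj₂ (h , refl) = inj₁ (suc h , cong suc (sym (ℕₚ.+-suc h h)))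

  h+h≡h*2 : ∀ h → h + h ≡ h * 2
  h+h≡h*2 = solve-ℕ

  [h+h]/2 : ∀ {m} h → m ≡ h + h → m / 2 ≡ h
  [h+h]/2 h refl = trans (cong (_/ 2) (h+h≡h*2 h)) (m*n/n≡m h 2)

  -- The fractions in `ℚ` are normalised, so the identity is checked on unnormalised ones, where it
  -- is a cross multiplication.
  +/N-suc : ∀ k N .{{_ : NonZero N}} → (ℤ.+ 1 ℚ./ N) ℚ.+ (ℤ.+ k ℚ./ N) ≡ ℤ.+ suc k ℚ./ N
  +/N-suc k N@(suc N-1) = ℚₚ.toℚᵘ-injective (begin
    ℚ.toℚᵘ ((ℤ.+ 1 ℚ./ N) ℚ.+ (ℤ.+ k ℚ./ N))                ≈⟨ ℚₚ.toℚᵘ-homo-+ (ℤ.+ 1 ℚ./ N) (ℤ.+ k ℚ./ N) ⟩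
    ℚ.toℚᵘ (ℤ.+ 1 ℚ./ N) ℚᵘ.+ ℚ.toℚᵘ (ℤ.+ k ℚ./ N)          ≈⟨ ℚᵘₚ.+-cong (ℚₚ.toℚᵘ-fromℚᵘ (ℚᵘ.mkℚᵘ (ℤ.+ 1) N-1)) (ℚₚ.toℚᵘ-fromℚᵘ (ℚᵘ.mkℚᵘ (ℤ.+ k) N-1)) ⟩
    ℚᵘ.mkℚᵘ (ℤ.+ 1) N-1 ℚᵘ.+ ℚᵘ.mkℚᵘ (ℤ.+ k) N-1            ≈⟨ ℚᵘ.*≡* (cross (ℤ.+ k) (ℤ.+ N)) ⟩
    ℚᵘ.mkℚᵘ (ℤ.+ suc k) N-1                                 ≈⟨ ℚᵘₚ.≃-sym (ℚₚ.toℚᵘ-fromℚᵘ (ℚᵘ.mkℚᵘ (ℤ.+ suc k) N-1)) ⟩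
    ℚ.toℚᵘ (ℤ.+ suc k ℚ./ N)                                ∎)
    where
    open import Relation.Binary.Reasoning.Setoid ℚᵘₚ.≃-setoid
    cross : ∀ k N → (ℤ.+ 1 ℤ.* N ℤ.+ k ℤ.* N) ℤ.* N ≡ (ℤ.+ 1 ℤ.+ k) ℤ.* (N ℤ.* N)
    cross = solve-ℤ

  N/N : ∀ N .{{_ : NonZero N}} → ℤ.+ N ℚ./ N ≡ ℚ.1ℚ
  N/N N@(suc N-1) = ℚₚ.fromℚᵘ-cong {ℚᵘ.mkℚᵘ (ℤ.+ N) N-1} {ℚᵘ.mkℚᵘ (ℤ.+ 1) 0} (ℚᵘ.*≡* (ℤₚ.*-comm (ℤ.+ N) (ℤ.+ 1)))

  0/N : ∀ N .{{_ : NonZero N}} → ℤ.+ 0 ℚ./ N ≡ ℚ.0ℚ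
  0/N N@(suc N-1) = ℚₚ.fromℚᵘ-cong {ℚᵘ.mkℚᵘ (ℤ.+ 0) N-1} {ℚᵘ.mkℚᵘ (ℤ.+ 0) 0} (ℚᵘ.*≡* refl)

  module Averaging {ℓ₁ ℓ₂} (K : ℚ-Algebra ℓ₁ ℓ₂) where

    open ℚ-Algebra K renaming (refl to ≈-refl; sym to ≈-sym; trans to ≈-trans; setoid to ≈-setoid; _+_ to _⊞_; _*_ to _⊠_)
    open WalshSeries K
    open Sums K
    open import Algebra.Properties.Semiring.Mult semiring using (×-congʳ; ×-comm-*; ×-assoc-*; ×-assocˡ)
    open IsRingHomomorphism ι-homomorphism using (+-homo; 0#-homo; 1#-homo)
    open import Relation.Binary.Reasoning.Setoid ≈-setoid

    ι-multiple : ∀ k N .{{_ : NonZero N}} → k · (1/ N) ≈ ι (ℤ.+ k ℚ./ N)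
    ι-multiple zero    N = ≈-sym (≈-trans (reflexive (cong ι (0/N N))) 0#-homo)
    ι-multiple (suc k) N = ≈-trans (+-congˡ (ι-multiple k N)) (≈-trans (≈-sym (+-homo _ _)) (reflexive (cong ι (+/N-suc k N))))

    N·1/N : ∀ N .{{_ : NonZero N}} → N · (1/ N) ≈ 1#
    N·1/N N = ≈-trans (ι-multiple N N) (≈-trans (reflexive (cong ι (N/N N))) 1#-homo)

    1/-cong : ∀ {m k} .{{_ : NonZero m}} .{{_ : NonZero k}} → m ≡ k → 1/ m ≈ 1/ k
    1/-cong refl = ≈-refl

    -- Insert `m · 1/ m` in front, gather the multiplicities `m * k` into `N`, and cancel them
    -- against `1/ N`.
    1/-cancel : ∀ m k N .{{_ : NonZero m}} .{{_ : NonZero N}} → N ≡ m * k → ∀ X → 1/ N ⊠ (k · X) ≈ 1/ m ⊠ X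
    1/-cancel m k N N≡mk X = begin
      1/ N ⊠ (k · X)                      ≈⟨ ≈-sym (*-identityˡ _) ⟩
      1# ⊠ (1/ N ⊠ (k · X))               ≈⟨ *-congʳ (≈-sym (N·1/N m)) ⟩
      (m · 1/ m) ⊠ (1/ N ⊠ (k · X))       ≈⟨ ×-assoc-* m (1/ m) _ ⟩
      m · (1/ m ⊠ (1/ N ⊠ (k · X)))       ≈⟨ ×-congʳ m (*-congˡ (×-comm-* k (1/ N) X)) ⟩
      m · (1/ m ⊠ (k · (1/ N ⊠ X)))       ≈⟨ ×-congʳ m (×-comm-* k (1/ m) _) ⟩
      m · (k · (1/ m ⊠ (1/ N ⊠ X)))       ≈⟨ ×-assocˡ _ m k ⟩
      (m * k) · (1/ m ⊠ (1/ N ⊠ X))       ≡⟨ cong (_· (1/ m ⊠ (1/ N ⊠ X))) (sym N≡mk) ⟩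
      N · (1/ m ⊠ (1/ N ⊠ X))             ≈⟨ ≈-sym (×-comm-* N (1/ m) _) ⟩
      1/ m ⊠ (N · (1/ N ⊠ X))             ≈⟨ *-congˡ (≈-sym (×-assoc-* N (1/ N) X)) ⟩
      1/ m ⊠ ((N · 1/ N) ⊠ X)             ≈⟨ *-congˡ (≈-trans (*-congʳ (N·1/N N)) (*-identityˡ X)) ⟩
      1/ m ⊠ X                            ∎

    -- For even `n` the reflections alternate with their constant: `2u` gives an axis through
    -- vertices, `2u + 1` one through edges.
    ∑-pairs : ∀ h (G : ℕ → Carrier) X Y → (∀ {u} → u < h → G (u + u) ≈ X) → (∀ {u} → u < h → G (suc (u + u)) ≈ Y) →
              ∑ (upTo (h + h)) G ≈ h · (X ⊞ Y)
    ∑-pairs zero    G X Y ex ey = ≈-refl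
    ∑-pairs (suc h) G X Y ex ey = begin
      ∑ (upTo (suc h + suc h)) G
        ≈⟨ ∑-upTo-suc (h + suc h) G ⟩
      G 0 ⊞ ∑ (upTo (h + suc h)) (G ∘ suc)
        ≡⟨ cong (λ m → G 0 ⊞ ∑ (upTo m) (G ∘ suc)) (ℕₚ.+-suc h h) ⟩
      G 0 ⊞ ∑ (upTo (suc (h + h))) (G ∘ suc)
        ≈⟨ +-cong (ex (s≤s z≤n)) (≈-trans (∑-upTo-suc (h + h) (G ∘ suc)) (+-cong (ey (s≤s z≤n))
             (∑-pairs h (G ∘ suc ∘ suc) X Y
               (λ {u} u<h → ≈-trans (reflexive (cong (G ∘ suc) (sym (ℕₚ.+-suc u u)))) (ex (s≤s u<h)))
               (λ {u} u<h → ≈-trans (reflexive (cong (G ∘ suc ∘ suc) (sym (ℕₚ.+-suc u u)))) (ey (s≤s u<h)))))) ⟩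
      X ⊞ (Y ⊞ h · (X ⊞ Y))
        ≈⟨ ≈-sym (+-assoc X Y _) ⟩
      suc h · (X ⊞ Y) ∎

    divisors : ℕ → List ℕ
    divisors n = filter (λ i → suc i ∣? n) (upTo n)

    -- φ(n/d) of the k in {1, …, n} have gcd(k, n) = d.
    ∑-gcd : ∀ n .{{_ : NonZero n}} (F H : ℕ → Carrier) → (∀ k i → suc i ≡ gcd k n → F k ≈ H i) →
            ∑ (map suc (upTo n)) F ≈ ∑ (divisors n) (λ i → φ (n / suc i) · H i)
    ∑-gcd n F H F≈H = begin
      ∑ ks F
        ≈⟨ ∑-cong ks (λ {k} _ → ≈-trans (F≈H k (ℕ.pred (gcd k n)) (suc-pred-gcd k))
             (≈-sym (∑-pick (Uniqueₚ.filter⁺ (λ i → suc i ∣? n) (Uniqueₚ.upTo⁺ n)) (gcd∈ k) H))) ⟩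
      ∑ ks (λ k → ∑ (divisors n) (λ i → if does (ℕ.pred (gcd k n) ℕₚ.≟ i) then H i else 0#))
        ≈⟨ ∑-swap ks (divisors n) _ ⟩
      ∑ (divisors n) (λ i → ∑ ks (λ k → if does (ℕ.pred (gcd k n) ℕₚ.≟ i) then H i else 0#))
        ≈⟨ ∑-cong (divisors n) (λ {i} i∈ → begin
             ∑ ks (λ k → if does (ℕ.pred (gcd k n) ℕₚ.≟ i) then H i else 0#)
               ≈⟨ ≈-sym (∑-filter (λ k → ℕ.pred (gcd k n) ℕₚ.≟ i) ks (λ _ → H i)) ⟩
             ∑ (filter (λ k → ℕ.pred (gcd k n) ℕₚ.≟ i) ks) (λ _ → H i)
               ≈⟨ ∑-const (filter (λ k → ℕ.pred (gcd k n) ℕₚ.≟ i) ks) (H i) ⟩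
             count (λ k → ℕ.pred (gcd k n) ℕₚ.≟ i) ks · H i
               ≡⟨ cong (_· H i) (count-gcd n i (proj₂ (∈-filter⁻ (λ i → suc i ∣? n) {xs = upTo n} i∈))) ⟩
             φ (n / suc i) · H i ∎) ⟩
      ∑ (divisors n) (λ i → φ (n / suc i) · H i) ∎
      where
      ks : List ℕ
      ks = map suc (upTo n)

      suc-pred-gcd : ∀ k → suc (ℕ.pred (gcd k n)) ≡ gcd k n
      suc-pred-gcd k = ℕₚ.suc-pred (gcd k n) {{ℕ.≢-nonZero (GCD.gcd[m,n]≢0 k n (inj₂ (ℕ.≢-nonZero⁻¹ n)))}}

      gcd∈ : ∀ k → ℕ.pred (gcd k n) ∈ divisors n
      gcd∈ k = ∈-filter⁺ (λ i → suc i ∣? n) (∈-upTo⁺ (∣⇒≤ d∣n)) d∣n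
        where
        d∣n : suc (ℕ.pred (gcd k n)) ∣ n
        d∣n = subst (_∣ n) (sym (suc-pred-gcd k)) (gcd[m,n]∣n k n)

  -- The Walsh series of the cycle.

  module CycleIndex {ℓ₁ ℓ₂} (K : ℚ-Algebra ℓ₁ ℓ₂) (a b c β γ : ℕ → ℚ-Algebra.Carrier K) (n : ℕ) (3≤n : 3 ≤ n) where

    open ℚ-Algebra K renaming (refl to ≈-refl; sym to ≈-sym; trans to ≈-trans; setoid to ≈-setoid; _+_ to _⊞_; _*_ to _⊠_)
    open WalshSeries K renaming (T to Tₙ)
    open Sums K
    open Averaging K
    open CycleEdges n 3≤n
    open CycleAutomorphisms n 3≤n
    open InnerSums K a b c β γ n 3≤n using (inner; inner-rotation; module Odd; module Even)
    open import Relation.Binary.Reasoning.Setoid ≈-setoid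

    instance
      2n≢0 : NonZero (2 * n)
      2n≢0 = m*n≢0 2 n

    rotationTerm : (n/d d : ℕ) .{{_ : NonZero d}} → Carrier
    rotationTerm n/d d = a n/d ^ d ⊠ Tₙ d (b n/d) (β n/d)

    rotationSum : Carrier
    rotationSum = ∑-divisors n (λ n/d d → φ n/d · rotationTerm n/d d)

    ∑-rotations : ∑ [1‥n] (inner ∘ lookup ∘ rotationVec) ≈ rotationSum
    ∑-rotations = ∑-gcd n (inner ∘ lookup ∘ rotationVec) (λ i → rotationTerm (n / suc i) (suc i)) (λ k i eq →
      let i₀ , q≡ = gcd-multiple n k
          d∣n = subst (_∣ n) (sym eq) (gcd[m,n]∣n k n)
      in inner-rotation i d∣n {{ℕ.>-nonZero (m≥n⇒m/n>0 {n} {suc i} (∣⇒≤ d∣n))}} (m/n*n≡m d∣n)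
           (subst (_∣ k) (sym eq) (gcd[m,n]∣m k n)) i₀ (trans q≡ (cong q (sym eq))) {lookup (rotationVec k)} (rotationVec-rotates k))

    reflectionSum : Carrier
    reflectionSum = ∑ (upTo n) (inner ∘ lookup ∘ reflectionVec)

    W≈ : W a b c β γ Cₙ ≈ 1/ (2 * n) ⊠ rotationSum ⊞ 1/ (2 * n) ⊠ reflectionSum
    W≈ = begin
      W a b c β γ Cₙ
        ≈⟨ *-cong (1/-cong {{∣Aut∣≢0 Cₙ}} ∣Aut∣≡2n) (≈-trans (∑-↭ (inner ∘ lookup) automorphisms-↭)
             (∑-++ (map rotationVec [1‥n]) (map reflectionVec (upTo n)) (inner ∘ lookup))) ⟩
      1/ (2 * n) ⊠ (∑ (map rotationVec [1‥n]) (inner ∘ lookup) ⊞ ∑ (map reflectionVec (upTo n)) (inner ∘ lookup))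
        ≈⟨ *-congˡ (+-cong (≈-trans (reflexive (∑-map rotationVec [1‥n] (inner ∘ lookup))) ∑-rotations)
                           (reflexive (∑-map reflectionVec (upTo n) (inner ∘ lookup)))) ⟩
      1/ (2 * n) ⊠ (rotationSum ⊞ reflectionSum)
        ≈⟨ distribˡ _ _ _ ⟩
      1/ (2 * n) ⊠ rotationSum ⊞ 1/ (2 * n) ⊠ reflectionSum ∎

    module _ (β₂⁻¹ : Invertible _≈_ 1# _⊠_ (β 2)) where

      private
        U₂ : ℕ → Carrier
        U₂ k = U k (b 2) (β 2) β₂⁻¹

      oddTerm : ℕ → ℕ → Carrier
      oddTerm h k = a 1 ⊠ a 2 ^ h ⊠ (β 2 ⊠ γ 1 ⊠ U₂ h ⊞ β 2 ^ 2 ⊠ c 1 ⊠ U₂ k)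

      oddReflections : ∀ k → n ≡ suc (suc k + suc k) → 1/ (2 * n) ⊠ reflectionSum ≈ 1/ 2 ⊠ oddTerm (suc k) k
      oddReflections k n≡ = begin
        1/ (2 * n) ⊠ reflectionSum
          ≈⟨ *-congˡ (≈-trans (∑-cong (upTo n) (λ {t} t∈ → let u , u<n , q≡ = edge t (∈-upTo⁻ t∈) in
               reflection-odd {t} {lookup (reflectionVec t)} {u} (reflectionVec-reflects t) u<n q≡)) (∑-const (upTo n) _)) ⟩
        1/ (2 * n) ⊠ (length (upTo n) · oddTerm (suc k) k)
          ≡⟨ cong (λ m → 1/ (2 * n) ⊠ (m · oddTerm (suc k) k)) (length-upTo n) ⟩
        1/ (2 * n) ⊠ (n · oddTerm (suc k) k)
          ≈⟨ 1/-cancel 2 n (2 * n) refl _ ⟩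
        1/ 2 ⊠ oddTerm (suc k) k ∎
        where
        open Odd β₂⁻¹ k n≡ using (reflection-odd)
        h : ℕ
        h = suc k
        rearrange : ∀ u h → u + u + (1 + (h + h)) ≡ 1 + (u + h + (u + h))
        rearrange = solve-ℕ
        edge : ∀ t → t < n → ∃[ u ] suc u ≤ n × q t ≡ q (suc (u + u))
        edge t t<n with parity t
        ... | inj₂ (u , refl) = u , ≤-trans (s≤s (ℕₚ.m≤m+n u u)) (<⇒≤ t<n) , refl
        -- Since `n` is odd, `2u + n = 2(u + h) + 1` is an odd representative of the even constant
        -- `2u`. Hence all reflections are of one type.
        ... | inj₁ (u , refl) = u + h
            , subst (suc (u + h) ≤_) (sym n≡) (s≤s (ℕₚ.+-monoˡ-≤ h u≤h))
            , trans (sym (q-+n (u + u))) (cong q (trans (cong (u + u +_) n≡) (rearrange u h)))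
          where
          u≤h : u ≤ h
          u≤h = ℕₚ.≮⇒≥ (λ h<u → ℕₚ.<⇒≱ (ℕₚ.+-mono-< h<u h<u) (ℕₚ.≤-pred (subst (u + u <_) n≡ t<n)))

      vertexTerm : ℕ → Carrier
      vertexTerm k = a 1 ^ 2 ⊠ a 2 ^ k ⊠ β 2 ^ 2 ⊠ U₂ k

      edgeTerm : ℕ → ℕ → ℕ → Carrier
      edgeTerm h k l = a 2 ^ h ⊠ (γ 1 ^ 2 ⊠ U₂ h ⊞ 2 · (c 1 ⊠ γ 1 ⊠ β 2 ⊠ U₂ k) ⊞ c 1 ^ 2 ⊠ β 2 ^ 2 ⊠ U₂ l)

      evenReflections : ∀ k → n ≡ suc (suc k) + suc (suc k) →
        1/ (2 * n) ⊠ reflectionSum ≈ 1/ 4 ⊠ (vertexTerm (suc k) ⊞ edgeTerm (suc (suc k)) (suc k) k)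
      evenReflections k n≡ = begin
        1/ (2 * n) ⊠ reflectionSum
          ≡⟨ cong (λ m → 1/ (2 * n) ⊠ ∑ (upTo m) (inner ∘ lookup ∘ reflectionVec)) n≡ ⟩
        1/ (2 * n) ⊠ ∑ (upTo (h + h)) (inner ∘ lookup ∘ reflectionVec)
          ≈⟨ *-congˡ (∑-pairs h (inner ∘ lookup ∘ reflectionVec) _ _
               (λ {u} u<h → through-vertices {u + u} {lookup (reflectionVec (u + u))} {u} (reflectionVec-reflects (u + u))
                  (<⇒≤ (<-trans u<h h<n)) refl)
               (λ {u} u<h → through-edges {suc (u + u)} {lookup (reflectionVec (suc (u + u)))} {u} (reflectionVec-reflects (suc (u + u)))
                  (<-trans u<h h<n) refl)) ⟩
        1/ (2 * n) ⊠ (h · (vertexTerm (suc k) ⊞ edgeTerm h (suc k) k))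
          ≈⟨ 1/-cancel 4 h (2 * n) (trans (cong (2 *_) n≡) (2[h+h] h)) _ ⟩
        1/ 4 ⊠ (vertexTerm (suc k) ⊞ edgeTerm h (suc k) k) ∎
        where
        open Even β₂⁻¹ k n≡ using (h; h<n; through-vertices; through-edges)
        2[h+h] : ∀ h → 2 * (h + h) ≡ 4 * h
        2[h+h] = solve-ℕ

      oddFormula evenFormula : Carrier
      oddFormula  = 1/ (2 * n) ⊠ rotationSum ⊞ 1/ 2 ⊠ oddTerm ((n ∸ 1) / 2) ((n ∸ 3) / 2)
      evenFormula = 1/ (2 * n) ⊠ rotationSum ⊞ 1/ 4 ⊠ (vertexTerm ((n ∸ 2) / 2) ⊞ edgeTerm (n / 2) ((n ∸ 2) / 2) ((n ∸ 4) / 2))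

      oddCase : ¬ 2 ∣ n → W a b c β γ Cₙ ≈ oddFormula
      oddCase 2∤n = go (parity n)
        where
        go : (∃[ h ] n ≡ h + h) ⊎ (∃[ h ] n ≡ suc (h + h)) → W a b c β γ Cₙ ≈ oddFormula
        go (inj₁ (h , n≡))     = contradiction (divides h (trans n≡ (h+h≡h*2 h))) 2∤n
        go (inj₂ (zero , n≡))  = contradiction (subst (3 ≤_) n≡ 3≤n) λ { (s≤s ()) }
        go (inj₂ (suc k , n≡)) = ≈-trans W≈ (+-congˡ (≈-trans (oddReflections k n≡)
          (reflexive (cong₂ (λ h k → 1/ 2 ⊠ oddTerm h k) (sym h≡) (sym h-1≡)))))
          where
          h≡ : (n ∸ 1) / 2 ≡ suc k
          h≡ = [h+h]/2 (suc k) (cong (_∸ 1) n≡)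
          h-1≡ : (n ∸ 3) / 2 ≡ k
          h-1≡ = [h+h]/2 k (trans (cong (_∸ 3) n≡) (cong (_∸ 1) (ℕₚ.+-suc k k)))

      evenCase : 2 ∣ n → W a b c β γ Cₙ ≈ evenFormula
      evenCase (divides h n≡h*2) = go h (trans n≡h*2 (sym (h+h≡h*2 h)))
        where
        go : ∀ h → n ≡ h + h → W a b c β γ Cₙ ≈ evenFormula
        go zero          n≡ = contradiction (subst (3 ≤_) n≡ 3≤n) λ ()
        go (suc zero)    n≡ = contradiction (subst (3 ≤_) n≡ 3≤n) λ { (s≤s (s≤s ())) }
        go (suc (suc k)) n≡ = ≈-trans W≈ (+-congˡ (≈-trans (evenReflections k n≡) (reflexive
          (trans (cong₂ (λ h k′ → 1/ 4 ⊠ (vertexTerm k′ ⊞ edgeTerm h k′ k)) (sym h≡) (sym h-1≡))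
                 (cong (λ l → 1/ 4 ⊠ (vertexTerm ((n ∸ 2) / 2) ⊞ edgeTerm (n / 2) ((n ∸ 2) / 2) l)) (sym h-2≡))))))
          where
          h≡ : n / 2 ≡ suc (suc k)
          h≡ = [h+h]/2 (suc (suc k)) n≡
          h-1≡ : (n ∸ 2) / 2 ≡ suc k
          h-1≡ = [h+h]/2 (suc k) (trans (cong (_∸ 2) n≡) (ℕₚ.+-suc k (suc k)))
          h-2≡ : (n ∸ 4) / 2 ≡ k
          h-2≡ = [h+h]/2 k (trans (cong (_∸ 4) n≡) (trans (cong (_∸ 2) (ℕₚ.+-suc k (suc k))) (cong (_∸ 1) (ℕₚ.+-suc k k))))

theorem5 : ∀ {ℓ₁ ℓ₂} (K : ℚ-Algebra ℓ₁ ℓ₂) →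
  let open ℚ-Algebra K
      open WalshSeries K
  in
  (a b c β γ : ℕ → Carrier) (β₂⁻¹ : Invertible _≈_ 1# _*_ (β 2)) →
  (n : ℕ) (3≤n : 3 ≤ n) →
  let instance
        n≢0 : NonZero n
        n≢0 = ℕ.>-nonZero (≤-trans (ℕ.s≤s ℕ.z≤n) 3≤n)
        2n≢0 : NonZero (2 ℕ.* n)
        2n≢0 = m*n≢0 2 n
      U₂ : ℕ → Carrier
      U₂ k = U k (b 2) (β 2) β₂⁻¹
      rotations : Carrier
      rotations = 1/ (2 ℕ.* n) *
        ∑-divisors n (λ n/d d → φ n/d · (a n/d ^ d * T d (b n/d) (β n/d)))
  in
  (¬ 2 ∣ n →
     W a b c β γ (cycleGraph n 3≤n) ≈
       rotations
       + 1/ 2 * (a 1 * a 2 ^ ((n ∸ 1) / 2)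
           * (β 2 * γ 1 * U₂ ((n ∸ 1) / 2) + β 2 ^ 2 * c 1 * U₂ ((n ∸ 3) / 2))))
  ×
  (2 ∣ n →
     W a b c β γ (cycleGraph n 3≤n) ≈
       rotations
       + 1/ 4 * ( a 1 ^ 2 * a 2 ^ ((n ∸ 2) / 2) * β 2 ^ 2 * U₂ ((n ∸ 2) / 2)
                + a 2 ^ (n / 2)
                  * ( γ 1 ^ 2 * U₂ (n / 2)
                    + 2 · (c 1 * γ 1 * β 2 * U₂ ((n ∸ 2) / 2))
                    + c 1 ^ 2 * β 2 ^ 2 * U₂ ((n ∸ 4) / 2) )))
theorem5 K a b c β γ β₂⁻¹ n 3≤n = oddCase β₂⁻¹ , evenCase β₂⁻¹
  where open MatchedCycles.CycleIndex K a b c β γ n 3≤n
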